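{- Let $2\leq m<n$ be integers. Then the resultant of $\Psi_m(x,y)$ and $\Psi_n(x,y)$ with respect to $x$ is $$\begin{cases} p^{\varphi(m)}y^{\varphi(m)\varphi(n)}&\text{if $n/m=p^\alpha$ for some prime $p$ and some positive integer $\alpha$};\\ y^{\varphi(m)\varphi(n)}&\text{otherwise}. \end{cases}$$
   Context: The Fibonacci polynomials are defined by $F_1(x)=1$, $F_2(x)=x$, and $F_n(x)=xF_{n-1}(x)+F_{n-2}(x)$ for $n\geq 3$. For $n\geq 2$, the $n$-th fibotomic polynomial $\Psi_n(x)$ is the product of the monic irreducible factors (in $\mathbb{Z}[x]$) of $F_n(x)$ which are not factors of $F_k(x)$ for any $k<n$; also $\Psi_1(x)=1$, so that $F_n(x)=\prod_{d\mid n}\Psi_d(x)$. Equivalently, $\Psi_n(x)=\prod_{1\le s\le n,\ \gcd(s,n)=1}\left(x-2i\cos\frac{\pi s}{n}\right)$ for $n\ge2$, so $\deg\Psi_n=\varphi(n)$, where $\varphi$ is Euler's totient function. The homogenized fibotomic polynomial is $\Psi_1(x,y)=1$ and $\Psi_n(x,y)=y^{\varphi(n)}\Psi_n(x/y)$ for $n\geq 2$; it is monic in $x$. -}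

module Defs where

open import Data.Nat as ℕ using (ℕ; zero; suc; _∸_; _≤_; _<_; _≤ᵇ_; _<ᵇ_)
open import Data.Nat.GCD using (gcd)
open import Data.Nat.Divisibility using (_∣?_)
open import Data.Integer as ℤ using (ℤ)
open import Data.Fin using (Fin; zero; suc; toℕ; punchIn)
open import Data.List using (List; []; _∷_; map; foldr; filter; upTo; allFin; length; replicate; _++_)
open import Data.Bool using (Bool; true; false; if_then_else_; _∧_)
open import Relation.Binary.PropositionalEquality using (_≡_)

-- Generic dense polynomials (coefficient lists, lowest degree first)
-- over a carrier with ring operations.

module PolyOps {A : Set} (0# 1# : A) (_+_ _*_ : A → A → A) (-_ : A → A) where

  Poly : Set
  Poly = List A

  coeff : Poly → ℕ → A
  coeff []       _       = 0#
  coeff (a ∷ p)  zero    = a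
  coeff (a ∷ p)  (suc i) = coeff p i

  _≈P_ : Poly → Poly → Set
  p ≈P q = ∀ i → coeff p i ≡ coeff q i

  _⊕_ : Poly → Poly → Poly
  []      ⊕ q       = q
  (a ∷ p) ⊕ []      = a ∷ p
  (a ∷ p) ⊕ (b ∷ q) = (a + b) ∷ (p ⊕ q)

  scale : A → Poly → Poly
  scale a p = map (a *_) p

  _⊗_ : Poly → Poly → Poly
  []      ⊗ q = []
  (a ∷ p) ⊗ q = scale a q ⊕ (0# ∷ (p ⊗ q))

  negP : Poly → Poly
  negP = map -_

  constP : A → Poly
  constP a = a ∷ []

  oneP : Poly
  oneP = constP 1#

  zeroP : Poly
  zeroP = []

  X : Poly
  X = 0# ∷ 1# ∷ []

  monomial : A → ℕ → Poly
  monomial c k = replicate k 0# ++ (c ∷ [])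

  productP : List Poly → Poly
  productP = foldr _⊗_ oneP

module DetOps {A : Set} (0# 1# : A) (_+_ _*_ : A → A → A) (-_ : A → A) where

  isEven : ℕ → Bool
  isEven zero          = true
  isEven (suc zero)    = false
  isEven (suc (suc n)) = isEven n

  det : (n : ℕ) → (Fin n → Fin n → A) → A
  det zero    M = 1#
  det (suc n) M =
    foldr _+_ 0#
      (map (λ j → let t = M zero j * det n (λ r c → M (suc r) (punchIn j c))
                  in if isEven (toℕ j) then t else - t)
           (allFin (suc n)))

module ZY = PolyOps (ℤ.+ 0) (ℤ.+ 1) ℤ._+_ ℤ._*_ ℤ.-_
open ZY public using () renaming (Poly to ℤ[y]; _≈P_ to _≈ʸ_)

module ZYX = PolyOps ZY.zeroP ZY.oneP ZY._⊕_ ZY._⊗_ ZY.negP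
open ZYX public using () renaming (Poly to ℤ[y][x])

module ZX = PolyOps (ℤ.+ 0) (ℤ.+ 1) ℤ._+_ ℤ._*_ ℤ.-_
open ZX public using () renaming (Poly to ℤ[x]; _≈P_ to _≈ˣ_)

F : ℕ → ℤ[x]
F zero          = ZX.zeroP
F (suc zero)    = ZX.oneP
F (suc (suc n)) = (ZX.X ZX.⊗ F (suc n)) ZX.⊕ F n

φ : ℕ → ℕ
φ n = length (filter (λ s → gcd s n ℕ.≟ 1) (map suc (upTo n)))

divisors : ℕ → List ℕ
divisors n = filter (λ d → d ∣? n) (map suc (upTo n))

-- Fibotomic polynomials, characterised by Ψ₁ = 1 and
-- F_n = ∏_{d ∣ n} Ψ_d for all n ≥ 1 (this determines Ψ uniquely).

record IsFibotomic (Ψ : ℕ → ℤ[x]) : Set where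
  field
    Ψ-one   : Ψ 1 ≈ˣ ZX.oneP
    F-prod  : ∀ n → 1 ≤ n → F n ≈ˣ ZX.productP (map Ψ (divisors n))

-- homogenization of a polynomial p(x) of (formal) degree d:
-- y^d p(x/y) = Σ_{i ≤ d} p_i x^i y^{d-i}
homogenize : ℕ → ℤ[x] → ℤ[y][x]
homogenize d p = map (λ i → ZY.monomial (ZX.coeff p i) (d ∸ i)) (upTo (suc d))

Ψhom : (ℕ → ℤ[x]) → ℕ → ℤ[y][x]
Ψhom Ψ zero          = ZYX.oneP
Ψhom Ψ (suc zero)    = ZYX.oneP
Ψhom Ψ (suc (suc n)) = homogenize (φ (suc (suc n))) (Ψ (suc (suc n)))

-- Resultant with respect to x of f (formal degree d) and g (formal
-- degree e), as the determinant of the (d+e)×(d+e) Sylvester matrix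
-- over ℤ[y].  Row r < e holds the coefficients f_d,…,f_0 starting at
-- column r; row e+r holds g_e,…,g_0 starting at column r.

module DetY = DetOps ZY.zeroP ZY.oneP ZY._⊕_ ZY._⊗_ ZY.negP

sylvesterEntry : ℕ → ℤ[y][x] → ℕ → ℤ[y][x] → ℕ → ℕ → ℤ[y]
sylvesterEntry d f e g r c =
  if r <ᵇ e
  then (if (r ≤ᵇ c) ∧ ((c ∸ r) ≤ᵇ d)
        then ZYX.coeff f (d ∸ (c ∸ r)) else ZY.zeroP)
  else (if ((r ∸ e) ≤ᵇ c) ∧ ((c ∸ (r ∸ e)) ≤ᵇ e)
        then ZYX.coeff g (e ∸ (c ∸ (r ∸ e))) else ZY.zeroP)

resultantₓ : ℕ → ℤ[y][x] → ℕ → ℤ[y][x] → ℤ[y]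
resultantₓ d f e g =
  DetY.det (d ℕ.+ e) (λ r c → sylvesterEntry d f e g (toℕ r) (toℕ c))

{-# OPTIONS --safe #-}
-- Scaling row r of the Sylvester matrix by y^r (in each of its two bands) turns column c into y^c times
-- an integer column, so the resultant is y^(φ(m)φ(n)) times the resultant of Ψ_m(x) and Ψ_n(x).
-- Reducing modulo Ψ_m, that integer is N(Ψ_n), where N(g) is the determinant of multiplication by g on
-- ℤ[x]/(Ψ_m); N is multiplicative and depends only on g modulo Ψ_m.
--
-- If neither of m, e divides the other and g = gcd(m, e), then F_g is a combination of F_m and F_e; dividing
-- by F_g shows Ψ_m and Ψ_e comaximal, so N(Ψ_e) = ±1.  If m ∣ d, then F_kd / F_d ≡ k F_(d-1)^(k-1) modulo
-- F_d with F_(d-1) a unit, so the product of |N(Ψ_e)| over e ∣ kd, e ∤ d is k^φ(m).  For n = m p^α take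
-- d = m p^(α-1), k = p: only e = n contributes.  For n = abm with a, b > 1 coprime, compare (d, k) = (am, b)
-- with (m, b): both products are b^φ(m), and only the first contains e = n.
--
-- For the sign, Ψ_n with n ≥ 3 is even, because F_n is even or odd and Ψ_n(0) > 0.  Hence for m ≥ 3 the
-- Sylvester matrix is a checkerboard of two equal blocks and its determinant is a square; for m = 2 the
-- resultant is Ψ_n(0).
module Submission where

-- Its multiplicativity, and through it the link with the Sylvester matrix, rests on one fact: an
-- alternating multilinear function of the columns is determined by its value at the identity. The
-- same fact gives the block formula for checkerboard matrices.
--
-- A unit modulo Ψ_m has norm 1 or -1, and comaximality cannot tell which. The values are therefore
-- found in absolute value, in ℕ, where a product equal to 1 has only factors 1, and the sign is
-- settled on its own. The positivity of Ψ_n(0) used there comes from the lowest nonzero coefficient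
-- of F_n, which is 1 for odd n and n/2 for even n.
--
-- The resultant is taken in formal degrees φ(m) and φ(n), while the product formula for F_n says
-- nothing about degrees. That φ(n) is the true degree of Ψ_n for n ≥ 2 is proved by induction from
-- deg F_n = n - 1 and the divisor sum of φ.

open import Defs

-- Determinants over ℤ and alternating functions of the columns.

module Determinants where

  open import Data.Nat as ℕ using (ℕ; zero; suc; _≤_; _<_; z≤n; s≤s; _∸_)
  import Data.Nat.Properties as ℕₚ
  open import Data.Integer as ℤ using (ℤ; +_; _+_; _*_; -_; _^_)
  import Data.Integer.Properties as ℤₚ
  open import Data.Integer.Tactic.RingSolver using (solve-∀)
  open import Data.Bool using (Bool; true; false; not)
  open import Data.Product using (_×_; _,_; proj₁; proj₂)
  open import Data.Sum using (_⊎_; inj₁; inj₂)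
  open import Relation.Nullary using (¬_; yes; no)
  open import Relation.Nullary.Negation using (contradiction)
  open import Relation.Binary.Definitions using (tri<; tri≈; tri>)
  open import Relation.Binary.PropositionalEquality

  Vector Matrix : Set
  Vector = ℕ → ℤ
  Matrix = ℕ → ℕ → ℤ

  Σ< : ℕ → Vector → ℤ
  Σ< zero    f = + 0
  Σ< (suc n) f = f 0 + Σ< n (λ i → f (suc i))

  Σ<-cong : ∀ n {f g} → (∀ i → i < n → f i ≡ g i) → Σ< n f ≡ Σ< n g
  Σ<-cong zero    h = refl
  Σ<-cong (suc n) h = cong₂ _+_ (h 0 (s≤s z≤n)) (Σ<-cong n (λ i i<n → h (suc i) (s≤s i<n)))

  Σ<-zero : ∀ n {f} → (∀ i → i < n → f i ≡ + 0) → Σ< n f ≡ + 0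
  Σ<-zero zero    h = refl
  Σ<-zero (suc n) h = cong₂ _+_ (h 0 (s≤s z≤n)) (Σ<-zero n (λ i i<n → h (suc i) (s≤s i<n)))

  Σ<-lin : ∀ n (f : Vector) a (g : Vector) → Σ< n (λ i → f i + a * g i) ≡ Σ< n f + a * Σ< n g
  Σ<-lin zero    f a g = sym (trans (ℤₚ.+-identityˡ _) (ℤₚ.*-zeroʳ a))
  Σ<-lin (suc n) f a g = trans (cong (_+_ (f 0 + a * g 0)) (Σ<-lin n _ a _))
                               (lemma (f 0) a (g 0) _ _)
    where
    lemma : ∀ u a v s t → u + a * v + (s + a * t) ≡ u + s + a * (v + t)
    lemma = solve-∀

  Σ<-single : ∀ n j {f} → j < n → (∀ i → i < n → i ≢ j → f i ≡ + 0) → Σ< n f ≡ f j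
  Σ<-single (suc n) zero    {f} _ h =
    trans (cong (_+_ (f 0)) (Σ<-zero n (λ i i<n → h (suc i) (s≤s i<n) λ ()))) (ℤₚ.+-identityʳ _)
  Σ<-single (suc n) (suc j) {f} (s≤s j<n) h =
    trans (cong₂ _+_ (h 0 (s≤s z≤n) λ ()) (Σ<-single n j j<n
            (λ i i<n i≢j → h (suc i) (s≤s i<n) (λ e → i≢j (ℕₚ.suc-injective e)))))
          (ℤₚ.+-identityˡ _)

  Σ<-*ʳ : ∀ n (f : Vector) a → Σ< n (λ i → f i * a) ≡ Σ< n f * a
  Σ<-*ʳ zero    f a = refl
  Σ<-*ʳ (suc n) f a = trans (cong (_+_ (f 0 * a)) (Σ<-*ʳ n _ a)) (sym (ℤₚ.*-distribʳ-+ a (f 0) _))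

  Σ<-last : ∀ n (f : Vector) → Σ< (suc n) f ≡ Σ< n f + f n
  Σ<-last zero    f = ℤₚ.+-comm (f 0) (+ 0)
  Σ<-last (suc n) f = trans (cong (_+_ (f 0)) (Σ<-last n _)) (sym (ℤₚ.+-assoc (f 0) _ _))

  Σ<-split : ∀ m n (f : Vector) → Σ< (m ℕ.+ n) f ≡ Σ< m f + Σ< n (λ i → f (m ℕ.+ i))
  Σ<-split zero    n f = sym (ℤₚ.+-identityˡ _)
  Σ<-split (suc m) n f = trans (cong (_+_ (f 0)) (Σ<-split m n _)) (sym (ℤₚ.+-assoc (f 0) _ _))

  sign : ℕ → ℤ
  sign zero    = + 1
  sign (suc n) = - sign n

  punch : ℕ → ℕ → ℕ
  punch zero    c       = suc c
  punch (suc j) zero    = zero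
  punch (suc j) (suc c) = suc (punch j c)

  -- The inverse of `punch j` on indices other than j; its value at j itself is arbitrary and is
  -- never relied on.
  unpunch : ℕ → ℕ → ℕ
  unpunch zero    c       = ℕ.pred c
  unpunch (suc j) zero    = zero
  unpunch (suc j) (suc c) = suc (unpunch j c)

  punch-≢ : ∀ j c → punch j c ≢ j
  punch-≢ (suc j) (suc c) e = punch-≢ j c (ℕₚ.suc-injective e)

  punch-< : ∀ j c {n} → c < n → punch j c < suc n
  punch-< zero    c       h       = s≤s h
  punch-< (suc j) zero    h       = s≤s z≤n
  punch-< (suc j) (suc c) (s≤s h) = s≤s (punch-< j c h)

  unpunch-punch : ∀ j c → unpunch j (punch j c) ≡ c
  unpunch-punch zero    c       = refl
  unpunch-punch (suc j) zero    = refl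
  unpunch-punch (suc j) (suc c) = cong suc (unpunch-punch j c)

  punch-unpunch : ∀ j c → c ≢ j → punch j (unpunch j c) ≡ c
  punch-unpunch zero    zero    h = contradiction refl h
  punch-unpunch zero    (suc c) h = refl
  punch-unpunch (suc j) zero    h = refl
  punch-unpunch (suc j) (suc c) h = cong suc (punch-unpunch j c (λ e → h (cong suc e)))

  unpunch-< : ∀ j c {n} → c ≢ j → j < suc n → c < suc n → unpunch j c < n
  unpunch-< zero    zero    h _       _       = contradiction refl h
  unpunch-< zero    (suc c) h _       (s≤s q) = q
  unpunch-< (suc j) zero    {suc n} h _ _     = s≤s z≤n
  unpunch-< (suc j) zero    {zero} h (s≤s ()) _
  unpunch-< (suc j) (suc c) {zero} h (s≤s ()) _
  unpunch-< (suc j) (suc c) {suc n} h (s≤s p) (s≤s q) = s≤s (unpunch-< j c (λ e → h (cong suc e)) p q)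

  minor : ℕ → Matrix → Matrix
  minor j M r c = M (suc r) (punch j c)

  -- Matrices are indexed by all of ℕ and the size is kept apart, which avoids arithmetic in `Fin`.
  -- The expansion along row 0 copies `DetOps.det`, so that the two can be matched term by term.
  det : ℕ → Matrix → ℤ
  det zero    M = + 1
  det (suc n) M = Σ< (suc n) (λ j → sign j * (M 0 j * det n (minor j M)))

  -- Opaque, so that a replaced column is seen only through `≔-same` and `≔-other` and the decision
  -- on indices never unfolds.
  abstract
    _[_]≔_ : Matrix → ℕ → Vector → Matrix
    (M [ c ]≔ v) r c′ with c′ ℕ.≟ c
    ... | yes _ = v r
    ... | no  _ = M r c′

    ≔-same : ∀ M c v r → (M [ c ]≔ v) r c ≡ v r
    ≔-same M c v r with c ℕ.≟ c
    ... | yes _ = refl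
    ... | no h  = contradiction refl h

    ≔-other : ∀ M c v r {c′} → c′ ≢ c → (M [ c ]≔ v) r c′ ≡ M r c′
    ≔-other M c v r {c′} h with c′ ℕ.≟ c
    ... | yes e = contradiction e h
    ... | no _  = refl

  -- lin relates any three matrices that agree off column c, so it applies without replacing columns.
  record Alternating (n : ℕ) (G : Matrix → ℤ) : Set where
    field
      ext   : ∀ {M M′} → (∀ r c → r < n → c < n → M r c ≡ M′ r c) → G M ≡ G M′
      lin   : ∀ {M U V} c a → c < n →
              (∀ r c′ → r < n → c′ < n → c′ ≢ c → M r c′ ≡ U r c′ × M r c′ ≡ V r c′) →
              (∀ r → r < n → M r c ≡ U r c + a * V r c) → G M ≡ G U + a * G V
      adj   : ∀ M c → suc c < n → (∀ r → r < n → M r c ≡ M r (suc c)) → G M ≡ + 0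

  det-resp : ∀ n {M M′} → (∀ r c → r < n → c < n → M r c ≡ M′ r c) → det n M ≡ det n M′
  det-resp zero    h = refl
  det-resp (suc n) h = Σ<-cong (suc n) λ j j<n →
    cong (sign j *_) (cong₂ _*_ (h 0 j (s≤s z≤n) j<n)
      (det-resp n (λ r c r<n c<n → h (suc r) (punch j c) (s≤s r<n) (punch-< j c c<n))))

  -- In the term of the expansion at j = c the linearity sits in the entry and the minors coincide;
  -- at every other j the entries coincide and the minor is linear in the column `unpunch j c`.
  det-lin : ∀ n {M U V} c a → c < n →
            (∀ r c′ → r < n → c′ < n → c′ ≢ c → M r c′ ≡ U r c′ × M r c′ ≡ V r c′) →
            (∀ r → r < n → M r c ≡ U r c + a * V r c) → det n M ≡ det n U + a * det n V
  det-lin (suc n) {M} {U} {V} c a c<n off on =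
    trans (Σ<-cong (suc n) term) (Σ<-lin (suc n) (T U) a (T V))
    where
    T : Matrix → ℕ → ℤ
    T M j = sign j * (M 0 j * det n (minor j M))

    same : ∀ s u a v D → s * ((u + a * v) * D) ≡ s * (u * D) + a * (s * (v * D))
    same = solve-∀

    other : ∀ s m a D E → s * (m * (D + a * E)) ≡ s * (m * D) + a * (s * (m * E))
    other = solve-∀

    term : ∀ j → j < suc n → T M j ≡ T U j + a * T V j
    term j j<n with c ℕ.≟ j
    ... | yes refl = trans (cong (λ z → sign c * (z * D)) (on 0 (s≤s z≤n)))
                       (trans (same (sign c) (U 0 c) a (V 0 c) D)
                       (cong₂ (λ x y → sign c * (U 0 c * x) + a * (sign c * (V 0 c * y)))
                         (det-resp n (λ r c′ p q → proj₁ (off′ r c′ p q)))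
                         (det-resp n (λ r c′ p q → proj₂ (off′ r c′ p q)))))
      where
      D : ℤ
      D = det n (minor c M)
      off′ : ∀ r c′ → r < n → c′ < n → minor c M r c′ ≡ minor c U r c′ × minor c M r c′ ≡ minor c V r c′
      off′ r c′ p q = off (suc r) (punch c c′) (s≤s p) (punch-< c c′ q) (punch-≢ c c′)
    ... | no c≢j = trans (cong (λ z → sign j * (M 0 j * z)) (det-lin n (unpunch j c) a
                       (unpunch-< j c c≢j j<n c<n)
                       (λ r c′ p q h → off (suc r) (punch j c′) (s≤s p) (punch-< j c′ q)
                         (λ e → h (trans (sym (unpunch-punch j c′)) (cong (unpunch j) e))))
                       (λ r p → subst (λ z → M (suc r) z ≡ U (suc r) z + a * V (suc r) z)
                         (sym (punch-unpunch j c c≢j)) (on (suc r) (s≤s p)))))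
                     (trans (other (sign j) (M 0 j) a (det n (minor j U)) (det n (minor j V)))
                       (cong₂ (λ x y → sign j * (x * det n (minor j U)) + a * (sign j * (y * det n (minor j V))))
                         (proj₁ (off 0 j (s≤s z≤n) j<n (λ e → c≢j (sym e))))
                         (proj₂ (off 0 j (s≤s z≤n) j<n (λ e → c≢j (sym e))))))

  Σ<-cancel : ∀ n c {f} → suc c < n → f c + f (suc c) ≡ + 0 →
    (∀ i → i < n → i ≢ c → i ≢ suc c → f i ≡ + 0) → Σ< n f ≡ + 0
  Σ<-cancel (suc (suc n)) zero {f} _ e h =
    trans (sym (ℤₚ.+-assoc (f 0) (f 1) _)) (cong₂ _+_ e
      (Σ<-zero n (λ i i<n → h (suc (suc i)) (s≤s (s≤s i<n)) (λ ()) (λ ()))))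
  Σ<-cancel (suc zero) zero (s≤s ()) e h
  Σ<-cancel (suc n) (suc c) (s≤s p) e h =
    cong₂ _+_ (h 0 (s≤s z≤n) (λ ()) (λ ()))
      (Σ<-cancel n c p e (λ i i<n a b → h (suc i) (s≤s i<n)
        (λ x → a (ℕₚ.suc-injective x)) (λ x → b (ℕₚ.suc-injective x))))

  unpunch-suc : ∀ j c → c ≢ j → suc c ≢ j → unpunch j (suc c) ≡ suc (unpunch j c)
  unpunch-suc zero    zero    p q = contradiction refl p
  unpunch-suc zero    (suc c) p q = refl
  unpunch-suc (suc zero)    zero p q = contradiction refl q
  unpunch-suc (suc (suc j)) zero p q = refl
  unpunch-suc (suc j) (suc c) p q = cong suc (unpunch-suc j c (λ e → p (cong suc e)) (λ e → q (cong suc e)))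

  -- Omitting column c or column c + 1 makes a difference in position c only, where the other one of
  -- the two survives.
  punch-adj : ∀ c c′ → (c′ ≡ c × punch c c′ ≡ suc c × punch (suc c) c′ ≡ c) ⊎ (punch c c′ ≡ punch (suc c) c′)
  punch-adj zero    zero     = inj₁ (refl , refl , refl)
  punch-adj zero    (suc c′) = inj₂ refl
  punch-adj (suc c) zero     = inj₂ refl
  punch-adj (suc c) (suc c′) with punch-adj c c′
  ... | inj₁ (a , b , d) = inj₁ (cong suc a , cong suc b , cong suc d)
  ... | inj₂ e = inj₂ (cong suc e)

  -- The terms at c and c + 1 have equal minors and opposite signs; every other minor still contains
  -- both equal columns, again adjacent.
  det-adj : ∀ n M c → suc c < n → (∀ r → r < n → M r c ≡ M r (suc c)) → det n M ≡ + 0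
  det-adj (suc n) M c c<n h = Σ<-cancel (suc n) c c<n two others
    where
    minors : ∀ r c′ → r < n → c′ < n → minor c M r c′ ≡ minor (suc c) M r c′
    minors r c′ r<n _ with punch-adj c c′
    ... | inj₁ (_ , a , b) = trans (cong (M (suc r)) a) (trans (sym (h (suc r) (s≤s r<n))) (cong (M (suc r)) (sym b)))
    ... | inj₂ e = cong (M (suc r)) e

    opposite : ∀ s x → s * x + (- s) * x ≡ + 0
    opposite = solve-∀

    two : sign c * (M 0 c * det n (minor c M)) + sign (suc c) * (M 0 (suc c) * det n (minor (suc c) M)) ≡ + 0
    two = trans (cong (λ z → sign c * z + - sign c * (M 0 (suc c) * det n (minor (suc c) M)))
                 (cong₂ _*_ (h 0 (s≤s z≤n)) (det-resp n minors)))
                (opposite (sign c) _)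

    others : ∀ j → j < suc n → j ≢ c → j ≢ suc c → sign j * (M 0 j * det n (minor j M)) ≡ + 0
    others j j<n p q = trans (cong (λ z → sign j * (M 0 j * z))
        (det-adj n (minor j M) (unpunch j c) bound cols))
        (trans (cong (sign j *_) (ℤₚ.*-zeroʳ (M 0 j))) (ℤₚ.*-zeroʳ (sign j)))
      where
      c≢j : c ≢ j
      c≢j e = p (sym e)
      sc≢j : suc c ≢ j
      sc≢j e = q (sym e)
      up : unpunch j (suc c) ≡ suc (unpunch j c)
      up = unpunch-suc j c c≢j sc≢j
      bound : suc (unpunch j c) < n
      bound = subst (_< n) up (unpunch-< j (suc c) sc≢j j<n c<n)
      cols : ∀ r → r < n → minor j M r (unpunch j c) ≡ minor j M r (suc (unpunch j c))
      cols r r<n = trans (cong (M (suc r)) (punch-unpunch j c c≢j)) (trans (h (suc r) (s≤s r<n))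
        (cong (M (suc r)) (trans (sym (punch-unpunch j (suc c) sc≢j)) (cong (punch j) up))))

  det-alternating : ∀ n → Alternating n (det n)
  det-alternating n = record { ext = det-resp n ; lin = det-lin n ; adj = det-adj n }

  δ : ℕ → ℕ → ℤ
  δ zero    zero    = + 1
  δ zero    (suc c) = + 0
  δ (suc r) zero    = + 0
  δ (suc r) (suc c) = δ r c

  δ-diag : ∀ r → δ r r ≡ + 1
  δ-diag zero    = refl
  δ-diag (suc r) = δ-diag r

  δ-off : ∀ r c → r ≢ c → δ r c ≡ + 0
  δ-off zero    zero    h = contradiction refl h
  δ-off zero    (suc c) h = refl
  δ-off (suc r) zero    h = refl
  δ-off (suc r) (suc c) h = δ-off r c (λ e → h (cong suc e))

  δ-sym : ∀ r c → δ r c ≡ δ c r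
  δ-sym zero    zero    = refl
  δ-sym zero    (suc c) = refl
  δ-sym (suc r) zero    = refl
  δ-sym (suc r) (suc c) = δ-sym r c

  Σ<-δ : ∀ n (f : Vector) r → r < n → Σ< n (λ k → f k * δ k r) ≡ f r
  Σ<-δ n f r r<n = trans
    (Σ<-single n r r<n (λ i _ h → trans (cong (f i *_) (δ-off i r h)) (ℤₚ.*-zeroʳ (f i))))
    (trans (cong (f r *_) (δ-diag r)) (ℤₚ.*-identityʳ (f r)))

  module AlternatingProperties {n : ℕ} {G : Matrix → ℤ} (alt : Alternating n G) where
    open Alternating alt

    cancel : ∀ x → x + - + 1 * x ≡ + 0
    cancel = solve-∀

    -- A zero column satisfies 0 = 0 + (-1) · 0, so linearity with all three matrices equal to M
    -- gives G M = G M - G M.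
    zero-column : ∀ M c → c < n → (∀ r → r < n → M r c ≡ + 0) → G M ≡ + 0
    zero-column M c c<n h = trans
      (lin {M} {M} {M} c (- + 1) c<n (λ _ _ _ _ _ → refl , refl)
        (λ r p → trans (h r p) (sym (cong (λ z → z + - + 1 * z) (h r p)))))
      (cancel (G M))

    lin-Σ : ∀ K {M} (V : ℕ → Matrix) c (a : Vector) → c < n →
            (∀ k r c′ → r < n → c′ < n → c′ ≢ c → M r c′ ≡ V k r c′) →
            (∀ r → r < n → M r c ≡ Σ< K (λ k → a k * V k r c)) →
            G M ≡ Σ< K (λ k → a k * G (V k))
    lin-Σ zero    {M} V c a c<n off on = zero-column M c c<n on
    lin-Σ (suc K) {M} V c a c<n off on = trans
      (lin {M} {U} {V 0} c (a 0) c<n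
        (λ r c′ p q h → sym (≔-other M c w r h) , off 0 r c′ p q h)
        (λ r p → trans (on r p) (trans (ℤₚ.+-comm _ (w r)) (cong (λ z → z + a 0 * V 0 r c) (sym (≔-same M c w r))))))
      (trans (ℤₚ.+-comm (G U) _) (cong (_+_ (a 0 * G (V 0)))
        (lin-Σ K {U} (λ k → V (suc k)) c (λ k → a (suc k)) c<n
          (λ k r c′ p q h → trans (≔-other M c w r h) (off (suc k) r c′ p q h))
          (λ r p → ≔-same M c w r))))
      where
      w : Vector
      w r = Σ< K (λ k → a (suc k) * V (suc k) r c)
      U : Matrix
      U = M [ c ]≔ w

    Vanishing : ℕ → ℕ → Set
    Vanishing i j = ∀ M → (∀ r → r < n → M r i ≡ M r j) → G M ≡ + 0

    -- Polarisation: expand G on the matrix whose columns i and j are both u + v.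
    swap : ∀ {M M′} i j → i < n → j < n → i ≢ j → Vanishing i j →
           (∀ r → r < n → M′ r i ≡ M r j) → (∀ r → r < n → M′ r j ≡ M r i) →
           (∀ r c → r < n → c < n → c ≢ i → c ≢ j → M′ r c ≡ M r c) → G M′ ≡ - G M
    swap {M} {M′} i j i<n j<n i≢j vanish hi hj hother = trans (ext M′≈) (trans conclude (cong -_ (ext ≈M)))
      where
      u v s : Vector
      u r = M r i
      v r = M r j
      s r = u r + + 1 * v r
      Y : Vector → Vector → Matrix
      Y a b = (M [ i ]≔ a) [ j ]≔ b
      Yj : ∀ a b r → Y a b r j ≡ b r
      Yj a b r = ≔-same (M [ i ]≔ a) j b r
      Yi : ∀ a b r → Y a b r i ≡ a r
      Yi a b r = trans (≔-other (M [ i ]≔ a) j b r i≢j) (≔-same M i a r)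
      Yo : ∀ a b r c → c ≢ i → c ≢ j → Y a b r c ≡ M r c
      Yo a b r c p q = trans (≔-other (M [ i ]≔ a) j b r q) (≔-other M i a r p)
      M′≈ : ∀ r c → r < n → c < n → M′ r c ≡ Y v u r c
      M′≈ r c p q with c ℕ.≟ i | c ℕ.≟ j
      ... | yes refl | _        = trans (hi r p) (sym (Yi v u r))
      ... | no _     | yes refl = trans (hj r p) (sym (Yj v u r))
      ... | no x     | no y     = trans (hother r c p q x y) (sym (Yo v u r c x y))
      ≈M : ∀ r c → r < n → c < n → Y u v r c ≡ M r c
      ≈M r c p q with c ℕ.≟ i | c ℕ.≟ j
      ... | yes refl | _        = Yi u v r
      ... | no _     | yes refl = Yj u v r
      ... | no x     | no y     = Yo u v r c x y
      linʲ : ∀ a → G (Y a s) ≡ G (Y a u) + + 1 * G (Y a v)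
      linʲ a = lin j (+ 1) j<n
        (λ r c _ _ h → trans (≔-other _ j s r h) (sym (≔-other _ j u r h)) , trans (≔-other _ j s r h) (sym (≔-other _ j v r h)))
        (λ r _ → trans (Yj a s r) (sym (cong₂ (λ x y → x + + 1 * y) (Yj a u r) (Yj a v r))))
      swap-inner : ∀ a a′ b r c → c ≢ i → Y a b r c ≡ Y a′ b r c
      swap-inner a a′ b r c p with c ℕ.≟ j
      ... | yes refl = trans (Yj a b r) (sym (Yj a′ b r))
      ... | no y     = trans (Yo a b r c p y) (sym (Yo a′ b r c p y))
      linⁱ : ∀ b → G (Y s b) ≡ G (Y u b) + + 1 * G (Y v b)
      linⁱ b = lin i (+ 1) i<n (λ r c _ _ h → swap-inner s u b r c h , swap-inner s v b r c h)
        (λ r _ → trans (Yi s b r) (sym (cong₂ (λ x y → x + + 1 * y) (Yi u b r) (Yi v b r))))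
      diag : ∀ a → G (Y a a) ≡ + 0
      diag a = vanish _ (λ r _ → trans (Yi a a r) (sym (Yj a a r)))
      sum : (+ 0 + + 1 * G (Y v u)) + + 1 * (G (Y u v) + + 1 * + 0) ≡ + 0
      sum = trans (sym (trans (linʲ s) (cong₂ (λ x y → x + + 1 * y)
              (trans (linⁱ u) (cong (λ z → z + + 1 * G (Y v u)) (diag u)))
              (trans (linⁱ v) (cong (λ z → G (Y u v) + + 1 * z) (diag v)))))) (diag s)
      rearrange : ∀ x y → x ≡ ((+ 0 + + 1 * x) + + 1 * (y + + 1 * + 0)) + - y
      rearrange = solve-∀
      conclude : G (Y v u) ≡ - G (Y u v)
      conclude = trans (rearrange (G (Y v u)) (G (Y u v)))
        (trans (cong (λ z → z + - G (Y u v)) sum) (ℤₚ.+-identityˡ _))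

    -- Exchanging the right one of the two equal columns with its left neighbour costs only a sign
    -- and narrows the gap by one, down to the adjacent case.
    vanishing-gap : ∀ k i → i ℕ.+ suc k < n → Vanishing i (i ℕ.+ suc k)
    vanishing-gap zero    i b M h = adj M i (subst (_< n) i+1 b) (λ r p → trans (h r p) (cong (M r) i+1))
      where
      i+1 : i ℕ.+ 1 ≡ suc i
      i+1 = ℕₚ.+-comm i 1
    vanishing-gap (suc k) i b M h = ℤₚ.neg-injective {G M} {+ 0}
      (trans (sym (swap {M} {M′} j (suc j) (ℕₚ.<-trans (ℕₚ.n<1+n j) sj<n) sj<n (ℕₚ.<⇒≢ (ℕₚ.n<1+n j))
        (λ N e → adj N j sj<n e)
        (λ r _ → trans (≔-other _ (suc j) _ r (ℕₚ.<⇒≢ (ℕₚ.n<1+n j))) (≔-same M j _ r))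
        (λ r _ → ≔-same _ (suc j) _ r)
        (λ r c _ _ p q → trans (≔-other _ (suc j) _ r q) (≔-other M j _ r p))))
      (vanishing-gap k i (ℕₚ.<-trans (ℕₚ.n<1+n j) sj<n) M′
        (λ r p → trans (M′-i r) (trans (h r p) (trans (cong (M r) (ℕₚ.+-suc i (suc k)))
          (sym (trans (≔-other _ (suc j) _ r (ℕₚ.<⇒≢ (ℕₚ.n<1+n j))) (≔-same M j _ r))))))))
      where
      j : ℕ
      j = i ℕ.+ suc k
      sj<n : suc j < n
      sj<n = subst (_< n) (ℕₚ.+-suc i (suc k)) b
      M′ : Matrix
      M′ = (M [ j ]≔ (λ r → M r (suc j))) [ suc j ]≔ (λ r → M r j)
      i<j : i < j
      i<j = ℕₚ.m<m+n i (s≤s z≤n)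
      M′-i : ∀ r → M′ r i ≡ M r i
      M′-i r = trans (≔-other _ (suc j) _ r (ℕₚ.<⇒≢ (ℕₚ.<-trans i<j (ℕₚ.n<1+n j)))) (≔-other M j _ r (ℕₚ.<⇒≢ i<j))

    vanishing : ∀ i j → i < j → j < n → Vanishing i j
    vanishing i j i<j j<n = subst (Vanishing i) i+ (vanishing-gap (j ∸ suc i) i (subst (_< n) (sym i+) j<n))
      where
      i+ : i ℕ.+ suc (j ∸ suc i) ≡ j
      i+ = trans (ℕₚ.+-suc i _) (ℕₚ.m+[n∸m]≡n i<j)

    add-column : ∀ {M U} i j a → i < j → j < n →
                 (∀ r c → r < n → c < n → c ≢ j → M r c ≡ U r c) →
                 (∀ r → r < n → M r j ≡ U r j + a * U r i) → G M ≡ G U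
    add-column {M} {U} i j a i<j j<n off on = trans
      (lin {M} {U} {V} j a j<n
        (λ r c p q h → off r c p q h , trans (off r c p q h) (sym (≔-other U j _ r h)))
        (λ r p → trans (on r p) (cong (λ z → U r j + a * z) (sym (≔-same U j _ r)))))
      (trans (cong (λ z → G U + a * z) (vanishing i j i<j j<n V
         (λ r _ → trans (≔-other U j _ r (ℕₚ.<⇒≢ i<j)) (sym (≔-same U j _ r)))))
        (trans (cong (_+_ (G U)) (ℤₚ.*-zeroʳ a)) (ℤₚ.+-identityʳ _)))
      where
      V : Matrix
      V = U [ j ]≔ (λ r → U r i)

  -- Uniqueness of alternating functions.

  rowDelete : ℕ → Matrix → Matrix
  rowDelete r M r′ c = M (punch r r′) (suc c)

  -- The universal factor between G M and G δ. What matters is that it does not mention G; it is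
  -- never compared with the row expansion directly, but identified with `det` in `alternating-det`
  -- by taking G to be `det`.
  columnExpansion : ℕ → Matrix → ℤ
  columnExpansion zero    M = + 1
  columnExpansion (suc n) M = Σ< (suc n) (λ r → M r 0 * (columnExpansion n (rowDelete r M) * sign r))

  -- The normal form reached once column 0 is the unit vector e_r and the rest of row r is cleared.
  -- As M varies, it turns an alternating function of size n + 1 into one of size n.
  border : ℕ → Matrix → Matrix
  border r M r′ zero    = δ r r′
  border r M r′ (suc c) with r′ ℕ.≟ r
  ... | yes _ = + 0
  ... | no _  = M (unpunch r r′) c

  border-alternating : ∀ {n G} → Alternating (suc n) G → ∀ r → r < suc n → Alternating n (λ M → G (border r M))
  border-alternating {n} {G} alt r r<n = record { ext = ext′ ; lin = lin′ ; adj = adj′ }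
    where
    open Alternating alt
    ext′ : ∀ {M M′} → (∀ r c → r < n → c < n → M r c ≡ M′ r c) → G (border r M) ≡ G (border r M′)
    ext′ {M} {M′} h = ext go
      where
      go : ∀ r′ c → r′ < suc n → c < suc n → border r M r′ c ≡ border r M′ r′ c
      go r′ zero    _ _ = refl
      go r′ (suc c) p (s≤s q) with r′ ℕ.≟ r
      ... | yes _ = refl
      ... | no x  = h (unpunch r r′) c (unpunch-< r r′ x r<n p) q
    lin′ : ∀ {M U V} c a → c < n →
           (∀ r c′ → r < n → c′ < n → c′ ≢ c → M r c′ ≡ U r c′ × M r c′ ≡ V r c′) →
           (∀ r → r < n → M r c ≡ U r c + a * V r c) →
           G (border r M) ≡ G (border r U) + a * G (border r V)
    lin′ {M} {U} {V} c a c<n off on = lin (suc c) a (s≤s c<n) off′ on′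
      where
      off′ : ∀ r′ c′ → r′ < suc n → c′ < suc n → c′ ≢ suc c →
             border r M r′ c′ ≡ border r U r′ c′ × border r M r′ c′ ≡ border r V r′ c′
      off′ r′ zero     _ _ _ = refl , refl
      off′ r′ (suc c′) p (s≤s q) h with r′ ℕ.≟ r
      ... | yes _ = refl , refl
      ... | no x  = off (unpunch r r′) c′ (unpunch-< r r′ x r<n p) q (λ e → h (cong suc e))
      on′ : ∀ r′ → r′ < suc n → border r M r′ (suc c) ≡ border r U r′ (suc c) + a * border r V r′ (suc c)
      on′ r′ p with r′ ℕ.≟ r
      ... | yes _ = sym (trans (ℤₚ.+-identityˡ _) (ℤₚ.*-zeroʳ a))
      ... | no x  = on (unpunch r r′) (unpunch-< r r′ x r<n p)
    adj′ : ∀ M c → suc c < n → (∀ r → r < n → M r c ≡ M r (suc c)) → G (border r M) ≡ + 0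
    adj′ M c c<n h = adj (border r M) (suc c) (s≤s c<n) go
      where
      go : ∀ r′ → r′ < suc n → border r M r′ (suc c) ≡ border r M r′ (suc (suc c))
      go r′ p with r′ ℕ.≟ r
      ... | yes _ = refl
      ... | no x  = h (unpunch r r′) (unpunch-< r r′ x r<n p)

  -- Subtracting M r (c + 1) times the column e_r from column c + 1 removes its entry in row r and
  -- touches no other row. `stage k` has done this for the first k of these columns.
  border-clear : ∀ {n G} → Alternating (suc n) G → ∀ r M → r < suc n →
                 G (M [ 0 ]≔ δ r) ≡ G (border r (rowDelete r M))
  border-clear {n} {G} alt r M r<n = trans (ext start) (trans (clear n ℕₚ.≤-refl) (ext finish))
    where
    open Alternating alt
    open AlternatingProperties alt
    stage : ℕ → Matrix
    stage k r′ zero = δ r r′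
    stage k r′ (suc c) with c ℕ.<? k
    ... | yes _ = M r′ (suc c) + - M r (suc c) * δ r r′
    ... | no _  = M r′ (suc c)
    stage-done : ∀ k r′ c → c < k → stage k r′ (suc c) ≡ M r′ (suc c) + - M r (suc c) * δ r r′
    stage-done k r′ c h with c ℕ.<? k
    ... | yes _ = refl
    ... | no x  = contradiction h x
    stage-todo : ∀ k r′ c → ¬ c < k → stage k r′ (suc c) ≡ M r′ (suc c)
    stage-todo k r′ c h with c ℕ.<? k
    ... | yes x = contradiction x h
    ... | no _  = refl
    start : ∀ r′ c → r′ < suc n → c < suc n → (M [ 0 ]≔ δ r) r′ c ≡ stage 0 r′ c
    start r′ zero    _ _ = ≔-same M 0 (δ r) r′
    start r′ (suc c) _ _ = trans (≔-other M 0 (δ r) r′ (λ ())) (sym (stage-todo 0 r′ c (λ ())))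
    finish : ∀ r′ c → r′ < suc n → c < suc n → stage n r′ c ≡ border r (rowDelete r M) r′ c
    finish r′ zero    _ _ = refl
    finish r′ (suc c) p (s≤s q) with r′ ℕ.≟ r
    ... | yes refl = trans (stage-done n r c q) (trans (cong (λ z → M r (suc c) + - M r (suc c) * z) (δ-diag r)) (cancels (M r (suc c))))
      where
      cancels : ∀ x → x + - x * + 1 ≡ + 0
      cancels = solve-∀
    ... | no x = trans (stage-done n r′ c q) (trans (cong (λ z → M r′ (suc c) + - M r (suc c) * z) (δ-off r r′ (λ e → x (sym e))))
                   (trans (drops (M r′ (suc c)) (M r (suc c))) (cong (λ z → M z (suc c)) (sym (punch-unpunch r r′ x)))))
      where
      drops : ∀ x y → x + - y * + 0 ≡ x
      drops = solve-∀
    step : ∀ k → k < n → G (stage k) ≡ G (stage (suc k))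
    step k k<n = add-column 0 (suc k) (M r (suc k)) (s≤s z≤n) (s≤s k<n) off on
      where
      off : ∀ r′ c → r′ < suc n → c < suc n → c ≢ suc k → stage k r′ c ≡ stage (suc k) r′ c
      off r′ zero    _ _ _ = refl
      off r′ (suc c) _ _ h with ℕₚ.<-cmp c k
      ... | tri< a _ _ = trans (stage-done k r′ c a) (sym (stage-done (suc k) r′ c (ℕₚ.m<n⇒m<1+n a)))
      ... | tri≈ _ a _ = contradiction (cong suc a) h
      ... | tri> ¬a _ a = trans (stage-todo k r′ c ¬a) (sym (stage-todo (suc k) r′ c (ℕₚ.≤⇒≯ a)))
      rearrange : ∀ x y d → x ≡ (x + - y * d) + y * d
      rearrange = solve-∀
      on : ∀ r′ → r′ < suc n → stage k r′ (suc k) ≡ stage (suc k) r′ (suc k) + M r (suc k) * δ r r′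
      on r′ _ = trans (stage-todo k r′ k (ℕₚ.<-irrefl refl)) (trans (rearrange (M r′ (suc k)) (M r (suc k)) (δ r r′))
        (cong (λ z → z + M r (suc k) * δ r r′) (sym (stage-done (suc k) r′ k ℕₚ.≤-refl))))
    clear : ∀ k → k ≤ n → G (stage 0) ≡ G (stage k)
    clear zero    _   = refl
    clear (suc k) k<n = trans (clear k (ℕₚ.<⇒≤ k<n)) (step k k<n)

  -- The bordered identity `P r` is the permutation matrix of a cycle on r + 1 indices. Exchanging
  -- columns 0 and r + 1 leads from `P r` to `P (suc r)`, so each step contributes one sign.
  border-δ : ∀ {n G} → Alternating (suc n) G → ∀ r → r < suc n → G (border r δ) ≡ sign r * G δ
  border-δ {n} {G} alt r r<n = trans (ext identity) (cycle r r<n)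
    where
    open Alternating alt
    open AlternatingProperties alt
    P : ℕ → Matrix
    P r r′ zero    = δ r r′
    P r r′ (suc c) = δ r′ (punch r c)
    identity : ∀ r′ c → r′ < suc n → c < suc n → border r δ r′ c ≡ P r r′ c
    identity r′ zero _ _ = refl
    identity r′ (suc c) _ _ with r′ ℕ.≟ r
    ... | yes refl = sym (δ-off r (punch r c) (λ e → punch-≢ r c (sym e)))
    ... | no x = δ-unpunch r r′ c x
      where
      δ-unpunch : ∀ r r′ c → r′ ≢ r → δ (unpunch r r′) c ≡ δ r′ (punch r c)
      δ-unpunch zero    zero     c h = contradiction refl h
      δ-unpunch zero    (suc r′) c h = refl
      δ-unpunch (suc r) zero    zero    h = refl
      δ-unpunch (suc r) zero    (suc c) h = refl
      δ-unpunch (suc r) (suc r′) zero    h = refl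
      δ-unpunch (suc r) (suc r′) (suc c) h = δ-unpunch r r′ c (λ e → h (cong suc e))
    punch-self : ∀ r → punch r r ≡ suc r
    punch-self zero    = refl
    punch-self (suc r) = cong suc (punch-self r)
    punch-suc-self : ∀ r → punch (suc r) r ≡ r
    punch-suc-self zero    = refl
    punch-suc-self (suc r) = cong suc (punch-suc-self r)
    cycle : ∀ r → r < suc n → G (P r) ≡ sign r * G δ
    cycle zero    _   = trans (ext first) (sym (ℤₚ.*-identityˡ _))
      where
      first : ∀ r′ c → r′ < suc n → c < suc n → P 0 r′ c ≡ δ r′ c
      first r′ zero    _ _ = δ-sym 0 r′
      first r′ (suc c) _ _ = refl
    cycle (suc r) r<n = trans
      (swap {P r} {P (suc r)} 0 (suc r) (s≤s z≤n) r<n (λ ()) (vanishing 0 (suc r) (s≤s z≤n) r<n)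
        (λ r′ _ → trans (δ-sym (suc r) r′) (cong (δ r′) (sym (punch-self r))))
        (λ r′ _ → trans (cong (δ r′) (punch-suc-self r)) (δ-sym r′ r))
        others)
      (trans (cong -_ (cycle r (ℕₚ.<-trans (ℕₚ.n<1+n r) r<n))) (ℤₚ.neg-distribˡ-* (sign r) (G δ)))
      where
      others : ∀ r′ c → r′ < suc n → c < suc n → c ≢ 0 → c ≢ suc r → P (suc r) r′ c ≡ P r r′ c
      others r′ zero    _ _ p _ = contradiction refl p
      others r′ (suc c) _ _ _ q with punch-adj r c
      ... | inj₁ (e , _) = contradiction (cong suc e) q
      ... | inj₂ e       = cong (δ r′) (sym e)

  -- Expand column 0; each term has a column e_r, so row r can be cleared and the rest is alternating in size n.
  alternating-expansion : ∀ n {G} → Alternating n G → ∀ M → G M ≡ columnExpansion n M * G δ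
  alternating-expansion zero    alt M = trans (Alternating.ext alt (λ _ _ ())) (sym (ℤₚ.*-identityˡ _))
  alternating-expansion (suc n) {G} alt M = trans
    (lin-Σ (suc n) (λ r → M [ 0 ]≔ δ r) 0 (λ r → M r 0) (s≤s z≤n)
      (λ k r c′ _ _ h → sym (≔-other M 0 (δ k) r h))
      (λ r p → trans (sym (Σ<-δ (suc n) (λ k → M k 0) r p))
        (Σ<-cong (suc n) (λ k _ → cong (M k 0 *_) (sym (≔-same M 0 (δ k) r))))))
    (trans (Σ<-cong (suc n) term) (Σ<-*ʳ (suc n) (λ r → M r 0 * (columnExpansion n (rowDelete r M) * sign r)) (G δ)))
    where
    open AlternatingProperties alt
    assoc : ∀ m d s g → m * (d * (s * g)) ≡ m * (d * s) * g
    assoc = solve-∀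
    term : ∀ r → r < suc n → M r 0 * G (M [ 0 ]≔ δ r) ≡ M r 0 * (columnExpansion n (rowDelete r M) * sign r) * G δ
    term r p = trans (cong (M r 0 *_) (trans (border-clear alt r M p)
                 (trans (alternating-expansion n (border-alternating alt r p) (rowDelete r M))
                   (cong (columnExpansion n (rowDelete r M) *_) (border-δ alt r p)))))
                 (assoc (M r 0) (columnExpansion n (rowDelete r M)) (sign r) (G δ))

  det-δ : ∀ n → det n δ ≡ + 1
  det-δ zero    = refl
  det-δ (suc n) = trans (Σ<-single (suc n) 0 (s≤s z≤n) off)
    (trans (ℤₚ.*-identityˡ _) (trans (ℤₚ.*-identityˡ _) (det-δ n)))
    where
    off : ∀ i → i < suc n → i ≢ 0 → sign i * (δ 0 i * det n (minor i δ)) ≡ + 0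
    off zero    _ h = contradiction refl h
    off (suc i) _ _ = ℤₚ.*-zeroʳ (sign (suc i))

  -- The expansion factor is common to all alternating functions, and `det` has value 1 at δ, so the
  -- factor is `det n M`.
  alternating-det : ∀ n {G} → Alternating n G → ∀ M → G M ≡ det n M * G δ
  alternating-det n {G} alt M = trans (alternating-expansion n alt M) (cong (_* G δ) (sym
    (trans (alternating-expansion n (det-alternating n) M)
      (trans (cong (columnExpansion n M *_) (det-δ n)) (ℤₚ.*-identityʳ (columnExpansion n M))))))

  matMul : ℕ → Matrix → Matrix → Matrix
  matMul n A B r c = Σ< n (λ k → A r k * B k c)

  matMul-alternating : ∀ n A → Alternating n (λ B → det n (matMul n A B))
  matMul-alternating n A = record
    { ext = λ h → det-resp n (λ r c _ c<n → Σ<-cong n (λ k k<n → cong (A r k *_) (h k c k<n c<n)))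
    ; lin = λ {M} {U} {V} c a c<n off on → det-lin n c a c<n
        (λ r c′ _ q h → Σ<-cong n (λ k k<n → cong (A r k *_) (proj₁ (off k c′ k<n q h)))
                      , Σ<-cong n (λ k k<n → cong (A r k *_) (proj₂ (off k c′ k<n q h))))
        (λ r _ → trans (Σ<-cong n (λ k k<n → trans (cong (A r k *_) (on k k<n)) (distrib (A r k) (U k c) a (V k c))))
                       (Σ<-lin n (λ k → A r k * U k c) a (λ k → A r k * V k c)))
    ; adj = λ M c c<n h → det-adj n (matMul n A M) c c<n
        (λ r _ → Σ<-cong n (λ k k<n → cong (A r k *_) (h k k<n)))
    }
    where
    distrib : ∀ x u a v → x * (u + a * v) ≡ x * u + a * (x * v)
    distrib = solve-∀

  -- With A fixed, the determinant of A B is alternating in the columns of B, and at B = δ it is the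
  -- determinant of A.
  det-mul : ∀ n A B → det n (matMul n A B) ≡ det n A * det n B
  det-mul n A B = trans (alternating-det n (matMul-alternating n A) B)
    (trans (cong (det n B *_) (det-resp n (λ r c _ c<n → Σ<-δ n (A r) c c<n))) (ℤₚ.*-comm (det n B) (det n A)))

  det-upper-triangular : ∀ n M a → (∀ r c → r < n → c < r → M r c ≡ + 0) →
                         (∀ i → i < n → M i i ≡ a) → det n M ≡ a ^ n
  det-upper-triangular zero    M a _  _    = refl
  det-upper-triangular (suc n) M a tri diag = trans (Σ<-single (suc n) 0 (s≤s z≤n) off)
    (trans (ℤₚ.*-identityˡ _) (cong₂ _*_ (diag 0 (s≤s z≤n))
      (det-upper-triangular n (minor 0 M) a (λ r c p q → tri (suc r) (suc c) (s≤s p) (s≤s q))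
        (λ i p → diag (suc i) (s≤s p)))))
    where
    column : ∀ i n → i < suc n → i ≢ 0 → (∀ r → r < n → M (suc r) 0 ≡ + 0) → det n (minor i M) ≡ + 0
    column zero    n       _        h _ = contradiction refl h
    column (suc i) zero    (s≤s ()) _ _
    column (suc i) (suc n) _        _ z =
      AlternatingProperties.zero-column (det-alternating (suc n)) (minor (suc i) M) 0 (s≤s z≤n) z
    off : ∀ i → i < suc n → i ≢ 0 → sign i * (M 0 i * det n (minor i M)) ≡ + 0
    off i p h = trans (cong (λ z → sign i * (M 0 i * z)) (column i n p h (λ r q → tri (suc r) 0 (s≤s q) (s≤s z≤n))))
      (trans (cong (sign i *_) (ℤₚ.*-zeroʳ (M 0 i))) (ℤₚ.*-zeroʳ (sign i)))

  det-identity-block : ∀ e d M → (∀ r c → r < e → c < e ℕ.+ d → M r c ≡ δ r c) →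
                       det (e ℕ.+ d) M ≡ det d (λ r c → M (e ℕ.+ r) (e ℕ.+ c))
  det-identity-block zero    d M h = refl
  det-identity-block (suc e) d M h = trans (Σ<-single (suc (e ℕ.+ d)) 0 (s≤s z≤n) off)
    (trans (ℤₚ.*-identityˡ _) (trans (cong (_* det (e ℕ.+ d) (minor 0 M)) (h 0 0 (s≤s z≤n) (s≤s z≤n)))
      (trans (ℤₚ.*-identityˡ _) (det-identity-block e d (minor 0 M) (λ r c p q → h (suc r) (suc c) (s≤s p) (s≤s q))))))
    where
    off : ∀ i → i < suc (e ℕ.+ d) → i ≢ 0 → sign i * (M 0 i * det (e ℕ.+ d) (minor i M)) ≡ + 0
    off zero    _ x = contradiction refl x
    off (suc i) p _ = trans (cong (λ z → sign (suc i) * (z * det (e ℕ.+ d) (minor (suc i) M))) (h 0 (suc i) (s≤s z≤n) p))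
                            (ℤₚ.*-zeroʳ (sign (suc i)))

  -- Checkerboard matrices.

  double : ℕ → ℕ
  double zero    = zero
  double (suc n) = suc (suc (double n))

  half : ℕ → ℕ
  half zero          = zero
  half (suc zero)    = zero
  half (suc (suc n)) = suc (half n)

  odd : ℕ → Bool
  odd zero          = false
  odd (suc zero)    = true
  odd (suc (suc n)) = odd n

  -- The n-th number of the given parity, inverse to the pair `odd`, `half`. All of these peel off
  -- two successors at a time, so they reduce against each other by computation.
  pos : Bool → ℕ → ℕ
  pos false n = double n
  pos true  n = suc (double n)

  pos-odd-half : ∀ n → pos (odd n) (half n) ≡ n
  pos-odd-half zero          = refl
  pos-odd-half (suc zero)    = refl
  pos-odd-half (suc (suc n)) with odd n | pos-odd-half n
  ... | false | e = cong (λ z → suc (suc z)) e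
  ... | true  | e = cong (λ z → suc (suc z)) e

  odd-pos : ∀ s n → odd (pos s n) ≡ s
  odd-pos false zero    = refl
  odd-pos true  zero    = refl
  odd-pos false (suc n) = odd-pos false n
  odd-pos true  (suc n) = odd-pos true n

  half-pos : ∀ s n → half (pos s n) ≡ n
  half-pos false zero    = refl
  half-pos true  zero    = refl
  half-pos false (suc n) = cong suc (half-pos false n)
  half-pos true  (suc n) = cong suc (half-pos true n)

  half-< : ∀ r n → r < double n → half r < n
  half-< zero          (suc n) _             = s≤s z≤n
  half-< (suc zero)    (suc n) _             = s≤s z≤n
  half-< (suc (suc r)) (suc n) (s≤s (s≤s p)) = s≤s (half-< r n p)

  pos-< : ∀ s i n → i < n → pos s i < double n
  pos-< false zero    (suc n) _       = s≤s z≤n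
  pos-< true  zero    (suc n) _       = s≤s (s≤s z≤n)
  pos-< false (suc i) (suc n) (s≤s p) = s≤s (s≤s (pos-< false i n p))
  pos-< true  (suc i) (suc n) (s≤s p) = s≤s (s≤s (pos-< true i n p))

  pos-mono : ∀ s i j → i < j → pos s i < pos s j
  pos-mono false zero    (suc j) _       = s≤s z≤n
  pos-mono true  zero    (suc j) _       = s≤s (s≤s z≤n)
  pos-mono false (suc i) (suc j) (s≤s p) = s≤s (s≤s (pos-mono false i j p))
  pos-mono true  (suc i) (suc j) (s≤s p) = s≤s (s≤s (pos-mono true i j p))

  pick : Bool → Bool → ℤ → ℤ → ℤ
  pick true  true  x y = x
  pick false false x y = y
  pick true  false x y = + 0
  pick false true  x y = + 0

  is : Bool → Bool → Bool
  is true  b = b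
  is false b = not b

  is-refl : ∀ s → is s s ≡ true
  is-refl true  = refl
  is-refl false = refl

  is-true : ∀ s b → is s b ≡ true → b ≡ s
  is-true true  true  _ = refl
  is-true false false _ = refl

  -- The checkerboard matrix with A on the rows and columns of parity s and B on the others.
  weave : Bool → Matrix → Matrix → Matrix
  weave s A B r c = pick (is s (odd r)) (is s (odd c)) (A (half r) (half c)) (B (half r) (half c))

  -- Each column of A fills the positions of one column of the weave, with zeros between them.
  -- Neighbouring columns of A land two apart, which is why equal columns are handled by `vanishing`
  -- instead of `adj`.
  weave-alternating : ∀ n s B → Alternating n (λ A → det (double n) (weave s A B))
  weave-alternating n s B = record { ext = ext′ ; lin = lin′ ; adj = adj′ }
    where
    open Alternating (det-alternating (double n))
    open AlternatingProperties (det-alternating (double n))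
    ext′ : ∀ {M M′} → (∀ r c → r < n → c < n → M r c ≡ M′ r c) →
           det (double n) (weave s M B) ≡ det (double n) (weave s M′ B)
    ext′ h = ext (λ r c p q → cong (λ z → pick (is s (odd r)) (is s (odd c)) z (B (half r) (half c)))
                   (h (half r) (half c) (half-< r n p) (half-< c n q)))
    pick-off : ∀ a b x x′ y → (b ≡ true → x ≡ x′) → pick a b x y ≡ pick a b x′ y
    pick-off true  true  x x′ y h = h refl
    pick-off true  false x x′ y h = refl
    pick-off false true  x x′ y h = refl
    pick-off false false x x′ y h = refl
    pick-lin : ∀ a x u t v y → x ≡ u + t * v → pick a true x y ≡ pick a true u y + t * pick a true v y
    pick-lin true  x u t v y e = e
    pick-lin false x u t v y e = sym (trans (ℤₚ.+-identityˡ _) (ℤₚ.*-zeroʳ t))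
    at-pos : ∀ M r i → weave s M B r (pos s i) ≡ pick (is s (odd r)) true (M (half r) i) (B (half r) i)
    at-pos M r i = trans (cong₂ (λ b h → pick (is s (odd r)) (is s b) (M (half r) h) (B (half r) h)) (odd-pos s i) (half-pos s i))
                         (cong (λ b → pick (is s (odd r)) b (M (half r) i) (B (half r) i)) (is-refl s))
    lin′ : ∀ {M U V} c a → c < n →
           (∀ r c′ → r < n → c′ < n → c′ ≢ c → M r c′ ≡ U r c′ × M r c′ ≡ V r c′) →
           (∀ r → r < n → M r c ≡ U r c + a * V r c) →
           det (double n) (weave s M B) ≡ det (double n) (weave s U B) + a * det (double n) (weave s V B)
    lin′ {M} {U} {V} c a c<n off on = lin (pos s c) a (pos-< s c n c<n) off′ on′
      where
      class : ∀ c′ → c′ ≢ pos s c → is s (odd c′) ≡ true → half c′ ≢ c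
      class c′ h e f = h (trans (sym (pos-odd-half c′)) (cong₂ pos (is-true s (odd c′) e) f))
      off′ : ∀ r c′ → r < double n → c′ < double n → c′ ≢ pos s c →
             weave s M B r c′ ≡ weave s U B r c′ × weave s M B r c′ ≡ weave s V B r c′
      off′ r c′ p q h =
          pick-off (is s (odd r)) (is s (odd c′)) _ _ _
            (λ e → proj₁ (off (half r) (half c′) (half-< r n p) (half-< c′ n q) (class c′ h e)))
        , pick-off (is s (odd r)) (is s (odd c′)) _ _ _
            (λ e → proj₂ (off (half r) (half c′) (half-< r n p) (half-< c′ n q) (class c′ h e)))
      on′ : ∀ r → r < double n → weave s M B r (pos s c) ≡ weave s U B r (pos s c) + a * weave s V B r (pos s c)
      on′ r p = trans (at-pos M r c) (trans
        (pick-lin (is s (odd r)) (M (half r) c) (U (half r) c) a (V (half r) c) (B (half r) c) (on (half r) (half-< r n p)))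
        (sym (cong₂ (λ x y → x + a * y) (at-pos U r c) (at-pos V r c))))
    pick-true : ∀ a x y y′ → pick a true x y ≡ pick a true x y′
    pick-true true  x y y′ = refl
    pick-true false x y y′ = refl
    adj′ : ∀ M c → suc c < n → (∀ r → r < n → M r c ≡ M r (suc c)) → det (double n) (weave s M B) ≡ + 0
    adj′ M c c<n h = vanishing (pos s c) (pos s (suc c)) (pos-mono s c (suc c) ℕₚ.≤-refl) (pos-< s (suc c) n c<n)
      (weave s M B) (λ r p → trans (at-pos M r c) (trans
        (trans (cong (λ z → pick (is s (odd r)) true z (B (half r) c)) (h (half r) (half-< r n p)))
          (pick-true (is s (odd r)) (M (half r) (suc c)) (B (half r) c) (B (half r) (suc c))))
        (sym (at-pos M r (suc c)))))

  weave-swap : ∀ A B r c → weave true A B r c ≡ weave false B A r c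
  weave-swap A B r c with odd r | odd c
  ... | true  | true  = refl
  ... | true  | false = refl
  ... | false | true  = refl
  ... | false | false = refl

  weave-δ : ∀ r c → weave false δ δ r c ≡ δ r c
  weave-δ zero          zero          = refl
  weave-δ zero          (suc zero)    = refl
  weave-δ (suc zero)    zero          = refl
  weave-δ (suc zero)    (suc zero)    = refl
  weave-δ zero          (suc (suc c)) with odd c
  ... | true  = refl
  ... | false = refl
  weave-δ (suc zero)    (suc (suc c)) with odd c
  ... | true  = refl
  ... | false = refl
  weave-δ (suc (suc r)) zero          with odd r
  ... | true  = refl
  ... | false = refl
  weave-δ (suc (suc r)) (suc zero)    with odd r
  ... | true  = refl
  ... | false = refl
  weave-δ (suc (suc r)) (suc (suc c)) = weave-δ r c

  -- Uniqueness is used twice: in A with B fixed, and then, at A = δ, in B. `weave-swap` exchanges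
  -- the parities so that one lemma serves both.
  det-weave : ∀ n A B → det (double n) (weave false A B) ≡ det n A * det n B
  det-weave n A B = trans (alternating-det n (weave-alternating n false B) A) (cong (det n A *_)
    (trans (det-resp (double n) (λ r c _ _ → sym (weave-swap B δ r c)))
    (trans (alternating-det n (weave-alternating n true δ) B)
    (trans (cong (det n B *_) (trans (det-resp (double n) (λ r c _ _ → trans (weave-swap δ δ r c) (weave-δ r c))) (det-δ (double n))))
           (ℤₚ.*-identityʳ _)))))

  det-checkerboard : ∀ n M → (∀ r c → odd r ≢ odd c → M r c ≡ + 0) →
                     det (double n) M ≡ det n (λ r c → M (pos false r) (pos false c)) * det n (λ r c → M (pos true r) (pos true c))
  det-checkerboard n M h = trans (det-resp (double n) (λ r c _ _ → entry r c)) (det-weave n _ _)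
    where
    entry : ∀ r c → M r c ≡ weave false (λ r c → M (pos false r) (pos false c)) (λ r c → M (pos true r) (pos true c)) r c
    entry r c with odd r | odd c | pos-odd-half r | pos-odd-half c | h r c
    ... | false | false | e | f | _ = cong₂ M (sym e) (sym f)
    ... | true  | true  | e | f | _ = cong₂ M (sym e) (sym f)
    ... | false | true  | e | f | k = k (λ ())
    ... | true  | false | e | f | k = k (λ ())

-- The ring ℤ[x] on coefficient lists, and cancellation of monic factors.

module Polynomials where

  open import Data.Nat as ℕ using (ℕ; zero; suc; _≤_; _<_; z≤n; s≤s)
  import Data.Nat.Properties as ℕₚ
  open import Data.Integer as ℤ using (+_; _+_; _*_; -_)
  import Data.Integer.Properties as ℤₚ
  open import Data.Integer.Tactic.RingSolver using (solve-∀)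
  open import Data.List using ([]; _∷_)
  open import Data.Product using (_,_)
  open import Relation.Binary.PropositionalEquality
  open import Algebra.Bundles using (CommutativeRing)
  open import Level using (0ℓ)
  open ZX using (coeff; _⊕_; scale; _⊗_; negP; constP; oneP)

  -- A record, so that the polynomials can be inferred from the type of an equality.
  record _≋_ (p q : ℤ[x]) : Set where
    constructor coeffwise
    field coeff-≡ : p ≈ˣ q
  open _≋_ public

  infix 4 _≋_

  ≋-refl : ∀ {p} → p ≋ p
  ≋-refl = coeffwise λ _ → refl

  ≋-sym : ∀ {p q} → p ≋ q → q ≋ p
  ≋-sym e = coeffwise λ i → sym (coeff-≡ e i)

  ≋-trans : ∀ {p q r} → p ≋ q → q ≋ r → p ≋ r
  ≋-trans e f = coeffwise λ i → trans (coeff-≡ e i) (coeff-≡ f i)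

  coeff-⊕ : ∀ p q i → coeff (p ⊕ q) i ≡ coeff p i + coeff q i
  coeff-⊕ []      q       i       = sym (ℤₚ.+-identityˡ _)
  coeff-⊕ (a ∷ p) []      i       = sym (ℤₚ.+-identityʳ _)
  coeff-⊕ (a ∷ p) (b ∷ q) zero    = refl
  coeff-⊕ (a ∷ p) (b ∷ q) (suc i) = coeff-⊕ p q i

  coeff-scale : ∀ a p i → coeff (scale a p) i ≡ a * coeff p i
  coeff-scale a []      i       = sym (ℤₚ.*-zeroʳ a)
  coeff-scale a (b ∷ p) zero    = refl
  coeff-scale a (b ∷ p) (suc i) = coeff-scale a p i

  coeff-neg : ∀ p i → coeff (negP p) i ≡ - coeff p i
  coeff-neg []      i       = refl
  coeff-neg (a ∷ p) zero    = refl
  coeff-neg (a ∷ p) (suc i) = coeff-neg p i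

  ∷-cong : ∀ {a b p q} → a ≡ b → p ≋ q → (a ∷ p) ≋ (b ∷ q)
  ∷-cong e f = coeffwise λ { zero → e ; (suc i) → coeff-≡ f i }

  ∷-head : ∀ {a b p q} → (a ∷ p) ≋ (b ∷ q) → a ≡ b
  ∷-head e = coeff-≡ e 0

  ∷-tail : ∀ {a b p q} → (a ∷ p) ≋ (b ∷ q) → p ≋ q
  ∷-tail e = coeffwise λ i → coeff-≡ e (suc i)

  ⊕-cong : ∀ {p p′ q q′} → p ≋ p′ → q ≋ q′ → p ⊕ q ≋ p′ ⊕ q′
  ⊕-cong {p} {p′} {q} {q′} e f = coeffwise λ i → trans (coeff-⊕ p q i)
    (trans (cong₂ _+_ (coeff-≡ e i) (coeff-≡ f i)) (sym (coeff-⊕ p′ q′ i)))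

  ⊕-comm : ∀ p q → p ⊕ q ≋ q ⊕ p
  ⊕-comm p q = coeffwise λ i → trans (coeff-⊕ p q i) (trans (ℤₚ.+-comm (coeff p i) (coeff q i)) (sym (coeff-⊕ q p i)))

  ⊕-assoc : ∀ p q r → (p ⊕ q) ⊕ r ≋ p ⊕ (q ⊕ r)
  ⊕-assoc p q r = coeffwise λ i → trans (coeff-⊕ (p ⊕ q) r i) (trans (cong (λ z → z + coeff r i) (coeff-⊕ p q i))
    (trans (ℤₚ.+-assoc (coeff p i) (coeff q i) (coeff r i))
    (sym (trans (coeff-⊕ p (q ⊕ r) i) (cong (_+_ (coeff p i)) (coeff-⊕ q r i))))))

  ⊕-identityʳ : ∀ p → p ⊕ [] ≋ p
  ⊕-identityʳ p = coeffwise λ i → trans (coeff-⊕ p [] i) (ℤₚ.+-identityʳ (coeff p i))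

  ⊕-inverseʳ : ∀ p → p ⊕ negP p ≋ []
  ⊕-inverseʳ p = coeffwise λ i → trans (coeff-⊕ p (negP p) i)
    (trans (cong (_+_ (coeff p i)) (coeff-neg p i)) (ℤₚ.+-inverseʳ (coeff p i)))

  neg-cong : ∀ {p q} → p ≋ q → negP p ≋ negP q
  neg-cong {p} {q} e = coeffwise λ i → trans (coeff-neg p i) (trans (cong -_ (coeff-≡ e i)) (sym (coeff-neg q i)))

  scale-cong : ∀ a {p q} → p ≋ q → scale a p ≋ scale a q
  scale-cong a {p} {q} e = coeffwise λ i → trans (coeff-scale a p i) (trans (cong (a *_) (coeff-≡ e i)) (sym (coeff-scale a q i)))

  scale-⊕ : ∀ a p q → scale a (p ⊕ q) ≋ scale a p ⊕ scale a q
  scale-⊕ a p q = coeffwise λ i → trans (coeff-scale a (p ⊕ q) i) (trans (cong (a *_) (coeff-⊕ p q i))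
    (trans (ℤₚ.*-distribˡ-+ a (coeff p i) (coeff q i))
    (sym (trans (coeff-⊕ (scale a p) (scale a q) i) (cong₂ _+_ (coeff-scale a p i) (coeff-scale a q i))))))

  scale-scale : ∀ a b p → scale a (scale b p) ≋ scale (a * b) p
  scale-scale a b p = coeffwise λ i → trans (coeff-scale a (scale b p) i) (trans (cong (a *_) (coeff-scale b p i))
    (trans (sym (ℤₚ.*-assoc a b (coeff p i))) (sym (coeff-scale (a * b) p i))))

  scale-1 : ∀ p → scale (+ 1) p ≋ p
  scale-1 p = coeffwise λ i → trans (coeff-scale (+ 1) p i) (ℤₚ.*-identityˡ _)

  scale-0 : ∀ p → scale (+ 0) p ≋ []
  scale-0 p = coeffwise λ i → coeff-scale (+ 0) p i

  0∷[] : (+ 0 ∷ []) ≋ []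
  0∷[] = coeffwise λ { zero → refl ; (suc i) → refl }

  ⊕-medial : ∀ p q r s → (p ⊕ q) ⊕ (r ⊕ s) ≋ (p ⊕ r) ⊕ (q ⊕ s)
  ⊕-medial p q r s = coeffwise λ i → trans (expand p q r s i)
    (trans (medial (coeff p i) (coeff q i) (coeff r i) (coeff s i)) (sym (expand p r q s i)))
    where
    medial : ∀ a b c d → (a + b) + (c + d) ≡ (a + c) + (b + d)
    medial = solve-∀
    expand : ∀ p q r s i → coeff ((p ⊕ q) ⊕ (r ⊕ s)) i ≡ (coeff p i + coeff q i) + (coeff r i + coeff s i)
    expand p q r s i = trans (coeff-⊕ (p ⊕ q) (r ⊕ s) i) (cong₂ _+_ (coeff-⊕ p q i) (coeff-⊕ r s i))

  ⊗-congˡ : ∀ p {q q′} → q ≋ q′ → p ⊗ q ≋ p ⊗ q′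
  ⊗-congˡ []      e = ≋-refl
  ⊗-congˡ (a ∷ p) e = ⊕-cong (scale-cong a e) (∷-cong refl (⊗-congˡ p e))

  ⊗-zeroʳ : ∀ p → p ⊗ [] ≋ []
  ⊗-zeroʳ []      = ≋-refl
  ⊗-zeroʳ (a ∷ p) = ≋-trans (∷-cong refl (⊗-zeroʳ p)) 0∷[]

  -- The defining recursion of `⊗` transposed to its right factor, after which commutativity is a
  -- single induction.
  ⊗-∷ : ∀ p b q → p ⊗ (b ∷ q) ≋ scale b p ⊕ (+ 0 ∷ (p ⊗ q))
  ⊗-∷ []      b q = ≋-sym 0∷[]
  ⊗-∷ (a ∷ p) b q = ∷-cong (cong (λ z → z + + 0) (ℤₚ.*-comm a b))
    (≋-trans (⊕-cong {scale a q} ≋-refl (⊗-∷ p b q))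
    (≋-trans (≋-sym (⊕-assoc (scale a q) (scale b p) (+ 0 ∷ (p ⊗ q))))
    (≋-trans (⊕-cong (⊕-comm (scale a q) (scale b p)) ≋-refl)
    (⊕-assoc (scale b p) (scale a q) (+ 0 ∷ (p ⊗ q))))))

  ⊗-comm : ∀ p q → p ⊗ q ≋ q ⊗ p
  ⊗-comm []      q = ≋-sym (⊗-zeroʳ q)
  ⊗-comm (a ∷ p) q = ≋-trans (⊕-cong {scale a q} ≋-refl (∷-cong refl (⊗-comm p q))) (≋-sym (⊗-∷ q a p))

  ⊗-cong : ∀ {p p′ q q′} → p ≋ p′ → q ≋ q′ → p ⊗ q ≋ p′ ⊗ q′
  ⊗-cong {p} {p′} {q} {q′} e f = ≋-trans (⊗-congˡ p f) (≋-trans (⊗-comm p q′)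
    (≋-trans (⊗-congˡ q′ e) (⊗-comm q′ p′)))

  ⊗-distribˡ : ∀ p q r → p ⊗ (q ⊕ r) ≋ (p ⊗ q) ⊕ (p ⊗ r)
  ⊗-distribˡ []      q r = ≋-refl
  ⊗-distribˡ (a ∷ p) q r = ≋-trans (⊕-cong (scale-⊕ a q r) (∷-cong {+ 0} refl (⊗-distribˡ p q r)))
    (⊕-medial (scale a q) (scale a r) (+ 0 ∷ (p ⊗ q)) (+ 0 ∷ (p ⊗ r)))

  ⊗-distribʳ : ∀ p q r → (q ⊕ r) ⊗ p ≋ (q ⊗ p) ⊕ (r ⊗ p)
  ⊗-distribʳ p q r = ≋-trans (⊗-comm (q ⊕ r) p) (≋-trans (⊗-distribˡ p q r) (⊕-cong (⊗-comm p q) (⊗-comm p r)))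

  scale-⊗ : ∀ a p q → scale a p ⊗ q ≋ scale a (p ⊗ q)
  scale-⊗ a []      q = ≋-refl
  scale-⊗ a (b ∷ p) q = ≋-trans (⊕-cong (≋-sym (scale-scale a b q)) (∷-cong (sym (ℤₚ.*-zeroʳ a)) (scale-⊗ a p q)))
    (≋-sym (scale-⊕ a (scale b q) (+ 0 ∷ (p ⊗ q))))

  0∷-⊗ : ∀ p q → (+ 0 ∷ p) ⊗ q ≋ + 0 ∷ (p ⊗ q)
  0∷-⊗ p q = ⊕-cong (scale-0 q) ≋-refl

  ⊗-assoc : ∀ p q r → (p ⊗ q) ⊗ r ≋ p ⊗ (q ⊗ r)
  ⊗-assoc []      q r = ≋-refl
  ⊗-assoc (a ∷ p) q r = ≋-trans (⊗-distribʳ r (scale a q) (+ 0 ∷ (p ⊗ q)))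
    (⊕-cong (scale-⊗ a q r) (≋-trans (0∷-⊗ (p ⊗ q) r) (∷-cong refl (⊗-assoc p q r))))

  constP-⊗ : ∀ a p → constP a ⊗ p ≋ scale a p
  constP-⊗ a p = ≋-trans (⊕-cong {scale a p} ≋-refl 0∷[]) (⊕-identityʳ (scale a p))

  ⊗-identityˡ : ∀ p → oneP ⊗ p ≋ p
  ⊗-identityˡ p = ≋-trans (constP-⊗ (+ 1) p) (scale-1 p)

  ⊗-identityʳ : ∀ p → p ⊗ oneP ≋ p
  ⊗-identityʳ p = ≋-trans (⊗-comm p oneP) (⊗-identityˡ p)

  polynomialRing : CommutativeRing 0ℓ 0ℓ
  polynomialRing = record
    { Carrier = ℤ[x]
    ; _≈_ = _≋_
    ; _+_ = _⊕_
    ; _*_ = _⊗_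
    ; -_ = negP
    ; 0# = []
    ; 1# = oneP
    ; isCommutativeRing = record
      { isRing = record
        { +-isAbelianGroup = record
          { isGroup = record
            { isMonoid = record
              { isSemigroup = record
                { isMagma = record
                  { isEquivalence = record { refl = ≋-refl ; sym = ≋-sym ; trans = ≋-trans }
                  ; ∙-cong = ⊕-cong }
                ; assoc = ⊕-assoc }
              ; identity = (λ p → ≋-refl) , ⊕-identityʳ }
            ; inverse = (λ p → ≋-trans (⊕-comm (negP p) p) (⊕-inverseʳ p)) , ⊕-inverseʳ
            ; ⁻¹-cong = neg-cong }
          ; comm = ⊕-comm }
        ; *-cong = ⊗-cong
        ; *-assoc = ⊗-assoc
        ; *-identity = ⊗-identityˡ , ⊗-identityʳ
        ; distrib = ⊗-distribˡ , ⊗-distribʳ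
        }
      ; *-comm = ⊗-comm
      }
    }

  -- Degree is expressed through coefficients because lists equal under `≋` may differ by trailing
  -- zeros.
  record Monic (d : ℕ) (p : ℤ[x]) : Set where
    field
      leading : coeff p d ≡ + 1
      above   : ∀ i → d < i → coeff p i ≡ + 0
  open Monic public

  Monic-resp : ∀ {d p q} → p ≋ q → Monic d p → Monic d q
  Monic-resp e m = record { leading = trans (sym (coeff-≡ e _)) (leading m)
                          ; above = λ i h → trans (sym (coeff-≡ e i)) (above m i h) }

  oneP-monic : Monic 0 oneP
  oneP-monic = record { leading = refl ; above = λ { (suc i) _ → refl } }

  coeff-∷⊗ : ∀ a p q i → coeff ((a ∷ p) ⊗ q) (suc i) ≡ a * coeff q (suc i) + coeff (p ⊗ q) i
  coeff-∷⊗ a p q i = trans (coeff-⊕ (scale a q) (+ 0 ∷ (p ⊗ q)) (suc i)) (cong (λ z → z + coeff (p ⊗ q) i) (coeff-scale a q (suc i)))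

  coeff-∷⊗-0 : ∀ a p q → coeff ((a ∷ p) ⊗ q) 0 ≡ a * coeff q 0
  coeff-∷⊗-0 a p q = trans (coeff-⊕ (scale a q) (+ 0 ∷ (p ⊗ q)) 0)
    (trans (ℤₚ.+-identityʳ _) (coeff-scale a q 0))

  coeff-⊗-0 : ∀ p q → coeff (p ⊗ q) 0 ≡ coeff p 0 * coeff q 0
  coeff-⊗-0 []      q = refl
  coeff-⊗-0 (a ∷ p) q = coeff-∷⊗-0 a p q

  zero-⊗ : ∀ p q → (∀ i → coeff p i ≡ + 0) → ∀ i → coeff (p ⊗ q) i ≡ + 0
  zero-⊗ p q h i = coeff-≡ {p ⊗ q} {[]} (⊗-cong {p} {[]} (coeffwise h) (≋-refl {q})) i

  top-coeff : ∀ {d q} → Monic d q → ∀ p k → (∀ i → k < i → coeff p i ≡ + 0) → coeff (p ⊗ q) (k ℕ.+ d) ≡ coeff p k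
  top-coeff {d} {q} m [] k h = refl
  top-coeff {d} {q} m (a ∷ p) zero h = trans (head d) (trans (cong (a *_) (leading m)) (ℤₚ.*-identityʳ a))
    where
    head : ∀ d → coeff ((a ∷ p) ⊗ q) d ≡ a * coeff q d
    head zero    = coeff-∷⊗-0 a p q
    head (suc d) = trans (coeff-∷⊗ a p q d) (trans (cong (_+_ (a * coeff q (suc d)))
                     (zero-⊗ p q (λ i → h (suc i) (s≤s z≤n)) d)) (ℤₚ.+-identityʳ _))
  top-coeff {d} {q} m (a ∷ p) (suc k) h = trans (coeff-∷⊗ a p q (k ℕ.+ d))
    (trans (cong₂ _+_ (trans (cong (a *_) (above m _ (s≤s (ℕₚ.m≤n+m d k)))) (ℤₚ.*-zeroʳ a))
                      (top-coeff m p k (λ i l → h (suc i) (s≤s l)))) (ℤₚ.+-identityˡ _))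

  degree-⊗ : ∀ {d q} → Monic d q → ∀ p k → (∀ i → k ≤ i → coeff p i ≡ + 0) → ∀ i → k ℕ.+ d ≤ i → coeff (p ⊗ q) i ≡ + 0
  degree-⊗ m [] k h i l = refl
  degree-⊗ {d} {q} m (a ∷ p) zero h i l = zero-⊗ (a ∷ p) q (λ j → h j z≤n) i
  degree-⊗ {d} {q} m (a ∷ p) (suc k) h (suc i) (s≤s l) = trans (coeff-∷⊗ a p q i)
    (trans (cong₂ _+_ (trans (cong (a *_) (above m _ (s≤s (ℕₚ.≤-trans (ℕₚ.m≤n+m d k) l)))) (ℤₚ.*-zeroʳ a))
                      (degree-⊗ m p k (λ i l → h (suc i) (s≤s l)) i l)) refl)

  -- A monic factor takes away exactly its own degree. The coefficients of p are stripped from the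
  -- low end: in the product, a times q reaches no index above d. Under bound 0 the tail vanishes
  -- first, and then a is the coefficient of x^d in the product.
  degree-quotient : ∀ {d q} → Monic d q → ∀ p k → (∀ i → k ℕ.+ d ≤ i → coeff (p ⊗ q) i ≡ + 0) → ∀ i → k ≤ i → coeff p i ≡ + 0
  degree-quotient m [] k h i l = refl
  degree-quotient {d} {q} m (a ∷ p) zero h i l = all i
    where
    tail : ∀ i → coeff p i ≡ + 0
    tail i = degree-quotient m p zero (λ j l → trans (sym (trans (cong (λ z → a * z + coeff (p ⊗ q) j) (above m (suc j) (s≤s l)))
               (trans (cong (λ z → z + coeff (p ⊗ q) j) (ℤₚ.*-zeroʳ a)) (ℤₚ.+-identityˡ _))))
               (trans (sym (coeff-∷⊗ a p q j)) (h (suc j) (ℕₚ.m≤n⇒m≤1+n l)))) i z≤n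
    all : ∀ i → coeff (a ∷ p) i ≡ + 0
    all zero    = trans (sym (top-coeff m (a ∷ p) 0 (λ { (suc i) _ → tail i }))) (h d ℕₚ.≤-refl)
    all (suc i) = tail i
  degree-quotient {d} {q} m (a ∷ p) (suc k) h (suc i) (s≤s l) =
    degree-quotient m p k (λ j l → trans (sym (trans (cong (λ z → a * z + coeff (p ⊗ q) j)
               (above m (suc j) (s≤s (ℕₚ.≤-trans (ℕₚ.m≤n+m d k) l))))
               (trans (cong (λ z → z + coeff (p ⊗ q) j) (ℤₚ.*-zeroʳ a)) (ℤₚ.+-identityˡ _))))
               (trans (sym (coeff-∷⊗ a p q j)) (h (suc j) (s≤s l)))) i l

  Monic-⊗ : ∀ {d e p q} → Monic d p → Monic e q → Monic (d ℕ.+ e) (p ⊗ q)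
  Monic-⊗ {d} {e} {p} {q} m n = record
    { leading = trans (top-coeff n p d (above m)) (leading m)
    ; above = λ i l → degree-⊗ n p (suc d) (above m) i l
    }

  Monic-quotient : ∀ {d e p q} → Monic e q → Monic (d ℕ.+ e) (p ⊗ q) → Monic d p
  Monic-quotient {d} {e} {p} {q} n mn = record
    { leading = trans (sym (top-coeff n p d high)) (leading mn)
    ; above = high
    }
    where
    high : ∀ i → d < i → coeff p i ≡ + 0
    high = degree-quotient n p (suc d) (λ i l → above mn i l)

  -- The bound 0 in `degree-quotient`, applied to (p - r) q = 0. Division by a power of y or by some
  -- F_g is always carried out in this form.
  Monic-cancelʳ : ∀ {d q} → Monic d q → ∀ p r → p ⊗ q ≋ r ⊗ q → p ≋ r
  Monic-cancelʳ {d} {q} m p r e = coeffwise λ i → ℤₚ.i-j≡0⇒i≡j (coeff p i) (coeff r i)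
      (trans (sym (trans (coeff-⊕ p (negP r) i) (cong (_+_ (coeff p i)) (coeff-neg r i))))
             (degree-quotient m (p ⊕ negP r) 0 (λ i _ → coeff-≡ zero-product i) i z≤n))
    where
    open import Algebra.Properties.Ring (CommutativeRing.ring polynomialRing) using (-‿distribˡ-*)
    zero-product : (p ⊕ negP r) ⊗ q ≋ []
    zero-product = ≋-trans (⊗-distribʳ q p (negP r)) (≋-trans (⊕-cong e (≋-sym (-‿distribˡ-* r q)))
      (⊕-inverseʳ (r ⊗ q)))

-- From the resultant over ℤ[y] to an integer determinant.

module Homogenisation where

  open Determinants
  open Polynomials
  open import Data.Nat as ℕ using (ℕ; zero; suc; _≤_; _<_; z≤n; s≤s; _∸_; _<ᵇ_; _≤ᵇ_)
  import Data.Nat.Properties as ℕₚ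
  open import Data.Integer as ℤ using (ℤ; +_; _+_; _*_; -_)
  import Data.Integer.Properties as ℤₚ
  open import Data.Integer.Tactic.RingSolver using (solve-∀)
  open import Data.Bool using (true; false; if_then_else_; _∧_; T)
  open import Data.Fin as Fin using (Fin; zero; suc; toℕ; punchIn)
  import Data.Fin.Properties as Finₚ
  open import Data.List using ([]; _∷_; map; foldr; tabulate; applyUpTo; filter)
  open import Data.Unit using (tt)
  open import Relation.Nullary using (¬_; yes; no; Dec)
  open import Relation.Nullary.Negation using (contradiction)
  open import Relation.Binary.PropositionalEquality
  open import Algebra.Bundles using (CommutativeMonoid; CommutativeRing)
  open import Function using (_∘_; id)
  open ZX using (coeff; _⊕_; scale; _⊗_; negP; oneP; zeroP; monomial)

  -- Sums and products over divisors are written over the whole range i < n, with the neutral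
  -- element put by `select` at the indices left out. Ranges can then be lengthened, exchanged and
  -- split by a condition. It is used for ℕ under addition and multiplication and for ℤ[x] under
  -- `⊗`.
  module RangeFold {c ℓ} (M : CommutativeMonoid c ℓ) where
    open CommutativeMonoid M
      renaming (refl to ≈-refl; sym to ≈-sym; trans to ≈-trans)
    open import Algebra.Properties.CommutativeSemigroup commutativeSemigroup using (interchange; x∙yz≈y∙xz)

    fold< : ℕ → (ℕ → Carrier) → Carrier
    fold< zero    f = ε
    fold< (suc n) f = f 0 ∙ fold< n (f ∘ suc)

    fold<-cong : ∀ n {f g} → (∀ i → i < n → f i ≈ g i) → fold< n f ≈ fold< n g
    fold<-cong zero    h = ≈-refl
    fold<-cong (suc n) h = ∙-cong (h 0 (s≤s z≤n)) (fold<-cong n (λ i p → h (suc i) (s≤s p)))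

    fold<-ε : ∀ n {f} → (∀ i → i < n → f i ≈ ε) → fold< n f ≈ ε
    fold<-ε zero    h = ≈-refl
    fold<-ε (suc n) h = ≈-trans (∙-cong (h 0 (s≤s z≤n)) (fold<-ε n (λ i p → h (suc i) (s≤s p)))) (identityˡ ε)

    fold<-∙ : ∀ n f g → fold< n (λ i → f i ∙ g i) ≈ fold< n f ∙ fold< n g
    fold<-∙ zero    f g = ≈-sym (identityˡ ε)
    fold<-∙ (suc n) f g = ≈-trans (∙-cong ≈-refl (fold<-∙ n (f ∘ suc) (g ∘ suc))) (interchange _ _ _ _)

    fold<-split : ∀ m n f → fold< (m ℕ.+ n) f ≈ fold< m f ∙ fold< n (λ i → f (m ℕ.+ i))
    fold<-split zero    n f = ≈-sym (identityˡ _)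
    fold<-split (suc m) n f = ≈-trans (∙-cong ≈-refl (fold<-split m n (f ∘ suc))) (≈-sym (assoc _ _ _))

    fold<-punch : ∀ n j f → j < suc n → fold< (suc n) f ≈ f j ∙ fold< n (f ∘ punch j)
    fold<-punch n       zero    f _       = ≈-refl
    fold<-punch zero    (suc j) f (s≤s ())
    fold<-punch (suc n) (suc j) f (s≤s p) = ≈-trans (∙-cong ≈-refl (fold<-punch n j (f ∘ suc) p)) (x∙yz≈y∙xz _ _ _)

    fold<-single : ∀ n j {f} → j < n → (∀ i → i < n → i ≢ j → f i ≈ ε) → fold< n f ≈ f j
    fold<-single (suc n) zero    _ h = ≈-trans (∙-cong ≈-refl (fold<-ε n (λ i p → h (suc i) (s≤s p) (λ ())))) (identityʳ _)
    fold<-single (suc n) (suc j) (s≤s p) h = ≈-trans (∙-cong (h 0 (s≤s z≤n) (λ ()))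
      (fold<-single n j p (λ i q x → h (suc i) (s≤s q) (λ e → x (ℕₚ.suc-injective e))))) (identityˡ _)

    fold<-swap : ∀ m n (f : ℕ → ℕ → Carrier) →
                 fold< m (λ i → fold< n (f i)) ≈ fold< n (λ j → fold< m (λ i → f i j))
    fold<-swap zero    n f = ≈-sym (fold<-ε n (λ _ _ → ≈-refl))
    fold<-swap (suc m) n f = ≈-trans (∙-cong ≈-refl (fold<-swap m n (f ∘ suc))) (≈-sym (fold<-∙ n (f 0) _))

    fold<-truncate : ∀ {m n} f → m ≤ n → (∀ i → m ≤ i → f i ≈ ε) → fold< n f ≈ fold< m f
    fold<-truncate {m} {n} f m≤n h = ≈-trans (reflexive (cong (λ k → fold< k f) (sym (ℕₚ.m+[n∸m]≡n m≤n))))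
      (≈-trans (fold<-split m (n ∸ m) f)
      (≈-trans (∙-cong ≈-refl (fold<-ε (n ∸ m) (λ i _ → h (m ℕ.+ i) (ℕₚ.m≤m+n m i)))) (identityʳ _)))

    select : {P : Set} → Dec P → Carrier → Carrier
    select (yes _) a = a
    select (no _)  a = ε

    select-yes : {P : Set} (P? : Dec P) {a : Carrier} → P → select P? a ≈ a
    select-yes (yes _) p = ≈-refl
    select-yes (no ¬p) p = contradiction p ¬p

    select-no : {P : Set} (P? : Dec P) {a : Carrier} → ¬ P → select P? a ≈ ε
    select-no (yes p) ¬p = contradiction p ¬p
    select-no (no _)  ¬p = ≈-refl

    select-trivial : {P : Set} (P? : Dec P) {a : Carrier} → (P → a ≈ ε) → select P? a ≈ ε
    select-trivial (yes p) h = h p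
    select-trivial (no _)  h = ≈-refl

    select-split : {P Q R : Set} (P? : Dec P) (Q? : Dec Q) (R? : Dec R) {a : Carrier} →
                   (Q → P) → (R → P) → (P → ¬ Q → R) → (R → ¬ Q) → select P? a ≈ select Q? a ∙ select R? a
    select-split P? (yes q) R? Q⇒P R⇒P rest excl = ≈-trans (select-yes P? (Q⇒P q))
      (≈-sym (≈-trans (∙-cong ≈-refl (select-no R? (λ r → excl r q))) (identityʳ _)))
    select-split P? (no ¬q) (yes r) Q⇒P R⇒P rest excl = ≈-trans (select-yes P? (R⇒P r)) (≈-sym (identityˡ _))
    select-split P? (no ¬q) (no ¬r) Q⇒P R⇒P rest excl = ≈-trans (select-no P? (λ p → ¬r (rest p ¬q))) (≈-sym (identityˡ _))

    -- The passage from the filtered lists of the definitions. The function g starts as the identity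
    -- and absorbs a successor at each step of the induction.
    foldr-filter : {P : ℕ → Set} (P? : ∀ s → Dec (P s)) (h g : ℕ → ℕ) (t : ℕ → Carrier) (n : ℕ) →
      foldr _∙_ ε (map t (filter P? (map h (applyUpTo g n)))) ≈ fold< n (λ i → select (P? (h (g i))) (t (h (g i))))
    foldr-filter P? h g t zero    = ≈-refl
    foldr-filter P? h g t (suc n) with P? (h (g 0))
    ... | yes _ = ∙-cong ≈-refl (foldr-filter P? h (g ∘ suc) t n)
    ... | no _  = ≈-trans (foldr-filter P? h (g ∘ suc) t n) (≈-sym (identityˡ _))

  module Sumℕ = RangeFold ℕₚ.+-0-commutativeMonoid

  monomial-0 : ∀ k → monomial (+ 0) k ≋ []
  monomial-0 zero    = 0∷[]
  monomial-0 (suc k) = ≋-trans (∷-cong refl (monomial-0 k)) 0∷[]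

  monomial-+ : ∀ a b k → monomial a k ⊕ monomial b k ≋ monomial (a + b) k
  monomial-+ a b zero    = ≋-refl
  monomial-+ a b (suc k) = ∷-cong refl (monomial-+ a b k)

  monomial-neg : ∀ a k → negP (monomial a k) ≋ monomial (- a) k
  monomial-neg a zero    = ≋-refl
  monomial-neg a (suc k) = ∷-cong refl (monomial-neg a k)

  scale-monomial : ∀ a b k → scale a (monomial b k) ≋ monomial (a * b) k
  scale-monomial a b zero    = ≋-refl
  scale-monomial a b (suc k) = ∷-cong (ℤₚ.*-zeroʳ a) (scale-monomial a b k)

  monomial-⊗ : ∀ a j b k → monomial a j ⊗ monomial b k ≋ monomial (a * b) (j ℕ.+ k)
  monomial-⊗ a zero    b k = ≋-trans (constP-⊗ a (monomial b k)) (scale-monomial a b k)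
  monomial-⊗ a (suc j) b k = ≋-trans (0∷-⊗ (monomial a j) (monomial b k)) (∷-cong refl (monomial-⊗ a j b k))

  monomial-monic : ∀ k → Monic k (monomial (+ 1) k)
  monomial-monic zero    = oneP-monic
  monomial-monic (suc k) = record
    { leading = leading (monomial-monic k)
    ; above = λ { (suc i) (s≤s l) → above (monomial-monic k) i l } }

  y^ : ℕ → ℤ[y]
  y^ = monomial (+ 1)

  foldr-monomial : ∀ {A : Set} s w k (t : A → ℤ[y]) (g : Fin k → A) (h : ℕ → ℤ) →
    (∀ i → y^ s ⊗ t (g i) ≋ monomial (h (toℕ i)) w) →
    y^ s ⊗ foldr _⊕_ [] (map t (tabulate g)) ≋ monomial (Σ< k h) w
  foldr-monomial s w zero    t g h e = ≋-trans (⊗-zeroʳ (y^ s)) (≋-sym (monomial-0 w))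
  foldr-monomial s w (suc k) t g h e = ≋-trans (⊗-distribˡ (y^ s) (t (g zero)) (foldr _⊕_ [] (map t (tabulate (g ∘ suc)))))
    (≋-trans (⊕-cong (e zero) (foldr-monomial s w k t (g ∘ suc) (h ∘ suc) (λ i → e (suc i))))
    (monomial-+ (h 0) (Σ< k (h ∘ suc)) w))

  toℕ-punchIn : ∀ {n} (j : Fin (suc n)) c → toℕ (punchIn j c) ≡ punch (toℕ j) (toℕ c)
  toℕ-punchIn zero    c       = refl
  toℕ-punchIn (suc j) zero    = refl
  toℕ-punchIn (suc j) (suc c) = cong suc (toℕ-punchIn j c)

  signed-monomial : ∀ s w j t x → y^ s ⊗ t ≋ monomial x w →
    y^ s ⊗ (if DetY.isEven j then t else negP t) ≋ monomial (sign j * x) w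
  signed-monomial s w zero          t x e = subst (λ z → y^ s ⊗ t ≋ monomial z w) (sym (ℤₚ.*-identityˡ x)) e
  signed-monomial s w (suc zero)    t x e = ≋-trans (≋-sym (-‿distribʳ-* (y^ s) t)) (≋-trans (neg-cong e)
    (subst (λ z → negP (monomial x w) ≋ monomial z w) (sym (ℤₚ.-1*i≡-i x)) (monomial-neg x w)))
    where open import Algebra.Properties.Ring (CommutativeRing.ring polynomialRing) using (-‿distribʳ-*)
  signed-monomial s w (suc (suc j)) t x e = subst (λ z → y^ s ⊗ (if DetY.isEven j then t else negP t) ≋ monomial (z * x) w)
    (sym (ℤₚ.neg-involutive (sign j))) (signed-monomial s w j t x e)

  -- The power v r is multiplied onto row r and every entry of column c then has degree u c. A
  -- product of entries meets each column once, so all terms of the expansion have the same degree,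
  -- the sum of u.
  det-homogeneous : ∀ n (M : Fin n → Fin n → ℤ[y]) (A : Matrix) (u v : ℕ → ℕ) →
    (∀ r c → y^ (v (toℕ r)) ⊗ M r c ≋ monomial (A (toℕ r) (toℕ c)) (u (toℕ c))) →
    y^ (Sumℕ.fold< n v) ⊗ DetY.det n M ≋ monomial (det n A) (Sumℕ.fold< n u)
  det-homogeneous zero    M A u v h = ⊗-identityˡ oneP
  det-homogeneous (suc n) M A u v h = foldr-monomial (Sumℕ.fold< (suc n) v) (Sumℕ.fold< (suc n) u) (suc n) _ id
    (λ j → sign j * (A 0 j * det n (minor j A))) term
    where
    open import Algebra.Properties.CommutativeSemigroup (CommutativeRing.*-commutativeSemigroup polynomialRing) using (interchange)
    term : ∀ j → y^ (Sumℕ.fold< (suc n) v) ⊗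
      (let t = M zero j ⊗ DetY.det n (λ r c → M (suc r) (punchIn j c)) in if DetY.isEven (toℕ j) then t else negP t)
      ≋ monomial (sign (toℕ j) * (A 0 (toℕ j) * det n (minor (toℕ j) A))) (Sumℕ.fold< (suc n) u)
    term j = signed-monomial (Sumℕ.fold< (suc n) v) (Sumℕ.fold< (suc n) u) (toℕ j) (M zero j ⊗ D) _
      (≋-trans (⊗-cong (≋-sym (monomial-⊗ (+ 1) (v 0) (+ 1) (Sumℕ.fold< n (v ∘ suc)))) (≋-refl {M zero j ⊗ D}))
      (≋-trans (interchange (y^ (v 0)) (y^ (Sumℕ.fold< n (v ∘ suc))) (M zero j) D)
      (≋-trans (⊗-cong (h zero j) ih)
      (subst (λ z → monomial (A 0 (toℕ j)) (u (toℕ j)) ⊗ monomial (det n (minor (toℕ j) A)) (Sumℕ.fold< n (u ∘ punch (toℕ j)))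
                    ≋ monomial (A 0 (toℕ j) * det n (minor (toℕ j) A)) z)
        (sym (Sumℕ.fold<-punch n (toℕ j) u (Finₚ.toℕ<n j)))
        (monomial-⊗ (A 0 (toℕ j)) (u (toℕ j)) (det n (minor (toℕ j) A)) (Sumℕ.fold< n (u ∘ punch (toℕ j))))))))
      where
      D : ℤ[y]
      D = DetY.det n (λ r c → M (suc r) (punchIn j c))
      ih : y^ (Sumℕ.fold< n (v ∘ suc)) ⊗ D ≋ monomial (det n (minor (toℕ j) A)) (Sumℕ.fold< n (u ∘ punch (toℕ j)))
      ih = det-homogeneous n _ (minor (toℕ j) A) (u ∘ punch (toℕ j)) (v ∘ suc)
        (λ r c → subst (λ z → y^ (v (suc (toℕ r))) ⊗ M (suc r) (punchIn j c) ≋ monomial (A (suc (toℕ r)) z) (u z))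
                   (toℕ-punchIn j c) (h (suc r) (punchIn j c)))

  band : ℕ → ℤ[x] → Matrix
  band d p r c = if (r ≤ᵇ c) ∧ ((c ∸ r) ≤ᵇ d) then coeff p (d ∸ (c ∸ r)) else + 0

  sylvester : ℕ → ℤ[x] → ℕ → ℤ[x] → Matrix
  sylvester d f e g r c = if r <ᵇ e then band d f r c else band e g (r ∸ e) c

  coeff-applyUpTo : ∀ n (t : ℕ → ℤ[y]) (g : ℕ → ℕ) k → k < n → ZYX.coeff (map t (applyUpTo g n)) k ≡ t (g k)
  coeff-applyUpTo (suc n) t g zero    _       = refl
  coeff-applyUpTo (suc n) t g (suc k) (s≤s p) = coeff-applyUpTo n t (g ∘ suc) k p

  coeff-homogenize : ∀ d p k → k ≤ d → ZYX.coeff (homogenize d p) (d ∸ k) ≡ monomial (coeff p (d ∸ k)) k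
  coeff-homogenize d p k k≤d = trans
    (coeff-applyUpTo (suc d) (λ i → monomial (coeff p i) (d ∸ i)) id (d ∸ k) (s≤s (ℕₚ.m∸n≤m d k)))
    (cong (monomial (coeff p (d ∸ k))) (ℕₚ.m∸[m∸n]≡n k≤d))

  -- Homogenization puts y^(c - r) on the entry in row r and column c of a band, so the factor y^r
  -- leaves y^c, which does not depend on the row.
  homogeneous-entry : ∀ d p r c →
    y^ r ⊗ (if (r ≤ᵇ c) ∧ ((c ∸ r) ≤ᵇ d) then ZYX.coeff (homogenize d p) (d ∸ (c ∸ r)) else ZY.zeroP)
    ≋ monomial (band d p r c) c
  homogeneous-entry d p r c with r ≤ᵇ c in r≤c | (c ∸ r) ≤ᵇ d in c∸r≤d
  ... | false | _     = ≋-trans (⊗-zeroʳ (y^ r)) (≋-sym (monomial-0 c))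
  ... | true  | false = ≋-trans (⊗-zeroʳ (y^ r)) (≋-sym (monomial-0 c))
  ... | true  | true  = subst₂ (λ q k → y^ r ⊗ q ≋ monomial (coeff p (d ∸ (c ∸ r))) k)
      (sym (coeff-homogenize d p (c ∸ r) (ℕₚ.≤ᵇ⇒≤ _ _ (subst T (sym c∸r≤d) tt))))
      (ℕₚ.m+[n∸m]≡n (ℕₚ.≤ᵇ⇒≤ r c (subst T (sym r≤c) tt)))
      (subst (λ z → y^ r ⊗ monomial (coeff p (d ∸ (c ∸ r))) (c ∸ r) ≋ monomial z (r ℕ.+ (c ∸ r)))
        (ℤₚ.*-identityˡ _) (monomial-⊗ (+ 1) r (coeff p (d ∸ (c ∸ r))) (c ∸ r)))

  <ᵇ-true : ∀ {i e} → i < e → (i <ᵇ e) ≡ true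
  <ᵇ-true {i} {e} p with i <ᵇ e in eq
  ... | true  = refl
  ... | false = contradiction (ℕₚ.<⇒<ᵇ p) (subst (λ b → ¬ T b) (sym eq) (λ ()))

  <ᵇ-false : ∀ e i → (e ℕ.+ i <ᵇ e) ≡ false
  <ᵇ-false e i with (e ℕ.+ i) <ᵇ e in eq
  ... | false = refl
  ... | true  = contradiction (ℕₚ.m≤m+n e i) (ℕₚ.<⇒≱ (ℕₚ.<ᵇ⇒< _ _ (subst T (sym eq) tt)))

  rowWeight : ℕ → ℕ → ℕ
  rowWeight e r = if r <ᵇ e then r else r ∸ e

  -- The first e rows have weight equal to their index, the remaining d rows have e less. The
  -- difference is the exponent d e of y in the resultant.
  weight-sum : ∀ d e → Sumℕ.fold< (d ℕ.+ e) id ≡ Sumℕ.fold< (d ℕ.+ e) (rowWeight e) ℕ.+ d ℕ.* e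
  weight-sum d e = trans (cong (λ n → Sumℕ.fold< n id) (ℕₚ.+-comm d e))
    (trans (Sumℕ.fold<-split e d id)
    (trans (cong (Sumℕ.fold< e id ℕ.+_) (shifted d id))
    (trans (cong (Sumℕ.fold< e id ℕ.+_) (ℕₚ.+-comm (d ℕ.* e) _))
    (trans (sym (ℕₚ.+-assoc (Sumℕ.fold< e id) _ _))
    (cong (ℕ._+ d ℕ.* e) (sym (trans (cong (λ n → Sumℕ.fold< n (rowWeight e)) (ℕₚ.+-comm d e))
      (trans (Sumℕ.fold<-split e d (rowWeight e))
        (cong₂ ℕ._+_ (Sumℕ.fold<-cong e low) (Sumℕ.fold<-cong d (λ i _ → high i)))))))))))
    where
    open import Data.Nat.Tactic.RingSolver renaming (solve-∀ to ℕ-solve-∀)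
    arrange : ∀ e a s t → (e ℕ.+ a) ℕ.+ (s ℕ.+ t) ≡ (e ℕ.+ s) ℕ.+ (a ℕ.+ t)
    arrange = ℕ-solve-∀
    shifted : ∀ d f → Sumℕ.fold< d (λ i → e ℕ.+ f i) ≡ d ℕ.* e ℕ.+ Sumℕ.fold< d f
    shifted zero    f = refl
    shifted (suc d) f = trans (cong ((e ℕ.+ f 0) ℕ.+_) (shifted d (f ∘ suc))) (arrange e (f 0) (d ℕ.* e) _)
    low : ∀ i → i < e → rowWeight e i ≡ i
    low i p = cong (λ b → if b then i else i ∸ e) (<ᵇ-true p)
    high : ∀ i → rowWeight e (e ℕ.+ i) ≡ i
    high i = trans (cong (λ b → if b then e ℕ.+ i else e ℕ.+ i ∸ e) (<ᵇ-false e i)) (ℕₚ.m+n∸m≡n e i)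

  resultant-homogenize : ∀ d f e g →
    resultantₓ d (homogenize d f) e (homogenize e g) ≋ ZY.monomial (det (d ℕ.+ e) (sylvester d f e g)) (d ℕ.* e)
  resultant-homogenize d f e g = Monic-cancelʳ (monomial-monic S) R (monomial D (d ℕ.* e))
    (≋-trans (⊗-comm R (y^ S)) (≋-trans scaled
      (subst₂ (λ k x → monomial D k ≋ x) (sym (weight-sum d e)) refl
        (≋-trans (subst (λ z → monomial D (S ℕ.+ d ℕ.* e) ≋ monomial z (S ℕ.+ d ℕ.* e)) (sym (ℤₚ.*-identityˡ D)) ≋-refl)
        (≋-trans (≋-sym (monomial-⊗ (+ 1) S D (d ℕ.* e))) (⊗-comm (y^ S) (monomial D (d ℕ.* e))))))))
    where
    S : ℕ
    S = Sumℕ.fold< (d ℕ.+ e) (rowWeight e)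
    D : ℤ
    D = det (d ℕ.+ e) (sylvester d f e g)
    R : ℤ[y]
    R = resultantₓ d (homogenize d f) e (homogenize e g)
    entry : ∀ r c → y^ (rowWeight e r) ⊗ sylvesterEntry d (homogenize d f) e (homogenize e g) r c ≋ monomial (sylvester d f e g r c) c
    entry r c with r <ᵇ e
    ... | true  = homogeneous-entry d f r c
    ... | false = homogeneous-entry e g (r ∸ e) c
    scaled : y^ S ⊗ R ≋ monomial D (Sumℕ.fold< (d ℕ.+ e) id)
    scaled = det-homogeneous (d ℕ.+ e) _ (sylvester d f e g) id (rowWeight e) (λ r c → entry (toℕ r) (toℕ c))

-- The norm modulo a monic polynomial and its equality with the Sylvester determinant.

module Norms where

  open Determinants
  open Polynomials
  open Homogenisation
  open import Data.Nat as ℕ using (ℕ; zero; suc; _≤_; _<_; z≤n; s≤s; _∸_; _<ᵇ_; _≤ᵇ_)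
  import Data.Nat.Properties as ℕₚ
  import Data.Nat.Tactic.RingSolver as ℕ-Solver
  open import Data.Integer as ℤ using (ℤ; +_; _+_; _*_; -_; _^_)
  import Data.Integer.Properties as ℤₚ
  open import Data.Integer.Tactic.RingSolver using (solve-∀)
  open import Data.Bool using (true; false; if_then_else_; _∧_; T)
  open import Data.List using ([]; _∷_)
  open import Data.Unit using (tt)
  open import Data.Product using (_×_; _,_; ∃-syntax)
  open import Data.Sum using (_⊎_; inj₁; inj₂)
  open import Relation.Nullary.Negation using (contradiction)
  open import Relation.Binary.PropositionalEquality
  open ZX using (coeff; _⊕_; scale; _⊗_; constP)

  Σ<-reverse : ∀ n (f : Vector) → Σ< (suc n) f ≡ Σ< (suc n) (λ i → f (n ∸ i))
  Σ<-reverse zero    f = refl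
  Σ<-reverse (suc n) f = trans (Σ<-last (suc n) f) (trans (ℤₚ.+-comm (Σ< (suc n) f) (f (suc n)))
    (cong (_+_ (f (suc n))) (Σ<-reverse n f)))

  ≤ᵇ-true : ∀ {i e} → i ≤ e → (i ≤ᵇ e) ≡ true
  ≤ᵇ-true {zero}  _ = refl
  ≤ᵇ-true {suc i} p = <ᵇ-true p

  ≤ᵇ-false : ∀ {i e} → e < i → (i ≤ᵇ e) ≡ false
  ≤ᵇ-false {i} {e} p with i ≤ᵇ e in eq
  ... | false = refl
  ... | true  = contradiction (ℕₚ.≤ᵇ⇒≤ i e (subst T (sym eq) tt)) (ℕₚ.<⇒≱ p)

  band-left : ∀ d p r c → c < r → band d p r c ≡ + 0
  band-left d p r c h = cong (λ b → if b ∧ ((c ∸ r) ≤ᵇ d) then coeff p (d ∸ (c ∸ r)) else + 0) (≤ᵇ-false h)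

  band-inside : ∀ d p r k → k ≤ d → band d p r (r ℕ.+ k) ≡ coeff p (d ∸ k)
  band-inside d p r k h = trans
    (cong (λ b → if b ∧ ((r ℕ.+ k ∸ r) ≤ᵇ d) then coeff p (d ∸ (r ℕ.+ k ∸ r)) else + 0) (≤ᵇ-true (ℕₚ.m≤m+n r k)))
    (trans (cong (λ z → if z ≤ᵇ d then coeff p (d ∸ z) else + 0) (ℕₚ.m+n∸m≡n r k))
      (cong (λ b → if b then coeff p (d ∸ k) else + 0) (≤ᵇ-true h)))

  band-right : ∀ d p r k → d < k → band d p r (r ℕ.+ k) ≡ + 0
  band-right d p r k h = trans
    (cong (λ b → if b ∧ ((r ℕ.+ k ∸ r) ≤ᵇ d) then coeff p (d ∸ (r ℕ.+ k ∸ r)) else + 0) (≤ᵇ-true (ℕₚ.m≤m+n r k)))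
    (trans (cong (λ z → if z ≤ᵇ d then coeff p (d ∸ z) else + 0) (ℕₚ.m+n∸m≡n r k))
      (cong (λ b → if b then coeff p (d ∸ k) else + 0) (≤ᵇ-false h)))

  -- Columns stand for descending powers of x. With r columns to the left of the band and s to its
  -- right, the row reads as x^s p, so the coefficient of x^i in p meets K at i + s.
  Σ<-band : ∀ t p r s (K : Vector) →
    Σ< (r ℕ.+ (suc t ℕ.+ s)) (λ k → band t p r k * K (r ℕ.+ (t ℕ.+ s) ∸ k)) ≡ Σ< (suc t) (λ i → coeff p i * K (i ℕ.+ s))
  Σ<-band t p r s K = trans (Σ<-split r (suc t ℕ.+ s) _)
    (trans (cong₂ _+_ (Σ<-zero r (λ i l → cong (_* K (r ℕ.+ (t ℕ.+ s) ∸ i)) (band-left t p r i l))) (Σ<-split (suc t) s (λ k → band t p r (r ℕ.+ k) * K (r ℕ.+ (t ℕ.+ s) ∸ (r ℕ.+ k)))))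
    (trans (ℤₚ.+-identityˡ _)
    (trans (cong₂ _+_ (Σ<-cong (suc t) {g = λ i → coeff p (t ∸ i) * K (t ∸ i ℕ.+ s)} middle) (Σ<-zero s right))
    (trans (ℤₚ.+-identityʳ _) (sym (Σ<-reverse t (λ i → coeff p i * K (i ℕ.+ s))))))))
    where
    middle : ∀ i → i < suc t → band t p r (r ℕ.+ i) * K (r ℕ.+ (t ℕ.+ s) ∸ (r ℕ.+ i)) ≡ coeff p (t ∸ i) * K (t ∸ i ℕ.+ s)
    middle i (s≤s l) = cong₂ (λ x k → x * K k) (band-inside t p r i l)
      (trans (ℕₚ.[m+n]∸[m+o]≡n∸o r (t ℕ.+ s) i) (ℕₚ.+-∸-comm s l))
    right : ∀ i → i < s → band t p r (r ℕ.+ (suc t ℕ.+ i)) * K (r ℕ.+ (t ℕ.+ s) ∸ (r ℕ.+ (suc t ℕ.+ i))) ≡ + 0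
    right i _ = cong (_* K (r ℕ.+ (t ℕ.+ s) ∸ (r ℕ.+ (suc t ℕ.+ i)))) (band-right t p r (suc t ℕ.+ i) (s≤s (ℕₚ.m≤m+n t i)))

  split-index : ∀ e d c → c < e ℕ.+ d → c < e ⊎ (∃[ j ] (j < d × c ≡ e ℕ.+ j))
  split-index zero    d c       p       = inj₂ (c , p , refl)
  split-index (suc e) d zero    p       = inj₁ (s≤s z≤n)
  split-index (suc e) d (suc c) (s≤s p) with split-index e d c p
  ... | inj₁ l           = inj₁ (s≤s l)
  ... | inj₂ (j , l , q) = inj₂ (j , l , cong suc q)

  -- Arithmetic modulo a monic polynomial f of degree d = suc d′.
  module Modulo (d′ : ℕ) (f : ℤ[x]) (f-monic : Monic (suc d′) f) where

    d : ℕ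
    d = suc d′

    shiftUp : Vector → Vector
    shiftUp v zero    = + 0
    shiftUp v (suc j) = v j

    -- κ i j is the coefficient of x^j in the remainder of x^i modulo f, for j < d.
    κ : ℕ → Vector
    κ zero    j = δ 0 j
    κ (suc i) j = shiftUp (κ i) j + - κ i d′ * coeff f j

    κ-δ : ∀ i j → i < d → j < d → κ i j ≡ δ i j
    κ-δ zero    j _       _   = refl
    κ-δ (suc i) j (s≤s p) q = trans (cong₂ (λ x y → x + - y * coeff f j) (shifted j q)
        (trans (κ-δ i d′ (ℕₚ.m<n⇒m<1+n p) ℕₚ.≤-refl) (δ-off i d′ (ℕₚ.<⇒≢ p)))) (ℤₚ.+-identityʳ _)
      where
      shifted : ∀ j → j < d → shiftUp (κ i) j ≡ δ (suc i) j
      shifted zero    _ = refl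
      shifted (suc j) q = κ-δ i j (ℕₚ.m<n⇒m<1+n p) (ℕₚ.<-trans (ℕₚ.n<1+n j) q)

    -- The polynomial x^m f has remainder 0. For m = 0 the leading term x^d reduces to minus the
    -- lower part of f; the step applies the reduction rule to every term and uses the hypothesis in
    -- columns j - 1 and d - 1.
    κ-relation : ∀ m j → j < d → Σ< (suc d) (λ l → coeff f l * κ (l ℕ.+ m) j) ≡ + 0
    κ-relation zero j q = trans (Σ<-last d (λ l → coeff f l * κ (l ℕ.+ 0) j)) (trans (cong₂ _+_ low high) (cancel (coeff f j)))
      where
      cancel : ∀ x → x + - x ≡ + 0
      cancel = solve-∀
      low : Σ< d (λ l → coeff f l * κ (l ℕ.+ 0) j) ≡ coeff f j
      low = trans (Σ<-cong d (λ l p → cong (coeff f l *_) (trans (cong (λ z → κ z j) (ℕₚ.+-identityʳ l)) (κ-δ l j p q))))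
                  (Σ<-δ d (coeff f) j q)
      top : ∀ j → j < d → shiftUp (κ d′) j ≡ + 0
      top zero    _ = refl
      top (suc j) (s≤s p) = trans (κ-δ d′ j ℕₚ.≤-refl (ℕₚ.m<n⇒m<1+n p)) (δ-off d′ j (λ e → ℕₚ.<⇒≢ p (sym e)))
      simplify : ∀ x → + 1 * (+ 0 + - + 1 * x) ≡ - x
      simplify = solve-∀
      high : coeff f d * κ (d ℕ.+ 0) j ≡ - coeff f j
      high = trans (cong₂ (λ x i → x * κ i j) (leading f-monic) (ℕₚ.+-identityʳ d))
        (trans (cong₂ (λ x y → + 1 * (x + - y * coeff f j)) (top j q)
           (trans (κ-δ d′ d′ ℕₚ.≤-refl ℕₚ.≤-refl) (δ-diag d′)))
         (simplify (coeff f j)))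
    κ-relation (suc m) j q = trans
      (Σ<-cong (suc d) (λ l _ → trans (cong (λ i → coeff f l * κ i j) (ℕₚ.+-suc l m))
         (distrib (coeff f l) (shiftUp (κ (l ℕ.+ m)) j) (κ (l ℕ.+ m) d′) (coeff f j))))
      (trans (Σ<-lin (suc d) (λ l → coeff f l * shiftUp (κ (l ℕ.+ m)) j) (- coeff f j) (λ l → coeff f l * κ (l ℕ.+ m) d′))
      (trans (cong₂ (λ x y → x + - coeff f j * y) (shifted j q) (κ-relation m d′ ℕₚ.≤-refl))
      (trans (ℤₚ.+-identityˡ _) (ℤₚ.*-zeroʳ (- coeff f j)))))
      where
      distrib : ∀ a b c e → a * (b + - c * e) ≡ a * b + - e * (a * c)
      distrib = solve-∀
      shifted : ∀ j → j < d → Σ< (suc d) (λ l → coeff f l * shiftUp (κ (l ℕ.+ m)) j) ≡ + 0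
      shifted zero    _ = Σ<-zero (suc d) (λ l _ → ℤₚ.*-zeroʳ (coeff f l))
      shifted (suc j) q = κ-relation m j (ℕₚ.<-trans (ℕₚ.n<1+n j) q)

    -- Reducing x^a before multiplying by x^m does not change the remainder. The induction hands one
    -- factor x from a over to m; the multiple of f subtracted when x^a is reduced is accounted for
    -- by `κ-relation`.
    κ-* : ∀ a m j → j < d → Σ< d (λ l → κ a l * κ (l ℕ.+ m) j) ≡ κ (a ℕ.+ m) j
    κ-* zero m j q = trans (Σ<-cong d (λ l _ → trans (ℤₚ.*-comm (δ 0 l) (κ (l ℕ.+ m) j)) (cong (κ (l ℕ.+ m) j *_) (δ-sym 0 l))))
      (Σ<-δ d (λ l → κ (l ℕ.+ m) j) 0 (s≤s z≤n))
    κ-* (suc a) m j q = trans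
      (Σ<-cong d (λ l _ → distrib (shiftUp (κ a) l) (κ a d′) (coeff f l) (κ (l ℕ.+ m) j)))
      (trans (Σ<-lin d (λ l → shiftUp (κ a) l * κ (l ℕ.+ m) j) (- κ a d′) (λ l → coeff f l * κ (l ℕ.+ m) j))
      (trans (cong₂ (λ x y → x + - κ a d′ * y) shifted reduce)
      (trans (rearrange (Σ< d′ (λ l → κ a l * κ (l ℕ.+ suc m) j)) (κ a d′) (κ (d ℕ.+ m) j))
      (trans (cong (λ i → Σ< d′ (λ l → κ a l * κ (l ℕ.+ suc m) j) + κ a d′ * κ i j) (sym (ℕₚ.+-suc d′ m)))
      (trans (sym (Σ<-last d′ (λ l → κ a l * κ (l ℕ.+ suc m) j)))
      (trans (κ-* a (suc m) j q) (cong (λ i → κ i j) (ℕₚ.+-suc a m))))))))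
      where
      distrib : ∀ a b c e → (a + - b * c) * e ≡ a * e + - b * (c * e)
      distrib = solve-∀
      rearrange : ∀ s a b → s + - a * (- b) ≡ s + a * b
      rearrange = solve-∀
      shifted : Σ< d (λ l → shiftUp (κ a) l * κ (l ℕ.+ m) j) ≡ Σ< d′ (λ l → κ a l * κ (l ℕ.+ suc m) j)
      shifted = trans (ℤₚ.+-identityˡ _) (Σ<-cong d′ (λ l _ → cong (λ i → κ a l * κ i j) (sym (ℕₚ.+-suc l m))))
      reduce : Σ< d (λ l → coeff f l * κ (l ℕ.+ m) j) ≡ - κ (d ℕ.+ m) j
      reduce = trans (solve-for (Σ< d (λ l → coeff f l * κ (l ℕ.+ m) j)) (κ (d ℕ.+ m) j))
        (trans (cong (λ z → z + - κ (d ℕ.+ m) j) (trans (cong (_+_ (Σ< d (λ l → coeff f l * κ (l ℕ.+ m) j)))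
                 (trans (sym (ℤₚ.*-identityˡ _)) (cong (_* κ (d ℕ.+ m) j) (sym (leading f-monic)))))
               (trans (sym (Σ<-last d (λ l → coeff f l * κ (l ℕ.+ m) j))) (κ-relation m j q))))
          (ℤₚ.+-identityˡ _))
        where
        solve-for : ∀ s k → s ≡ (s + k) + - k
        solve-for = solve-∀

    -- rem p i j is the coefficient of x^j in the remainder of x^i p modulo f.
    rem : ℤ[x] → Matrix
    rem []      i j = + 0
    rem (a ∷ p) i j = a * κ i j + rem p (suc i) j

    rem-cong : ∀ {p q} → p ≋ q → ∀ i j → rem p i j ≡ rem q i j
    rem-cong {[]}    {[]}    e i j = refl
    rem-cong {[]}    {b ∷ q} e i j = trans (sym (ℤₚ.+-identityʳ (+ 0)))
      (cong₂ (λ x y → x * κ i j + y) (coeff-≡ e 0) (rem-cong {[]} {q} (coeffwise λ k → coeff-≡ e (suc k)) (suc i) j))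
    rem-cong {a ∷ p} {[]}    e i j = trans
      (cong₂ (λ x y → x * κ i j + y) (coeff-≡ e 0) (rem-cong {p} {[]} (coeffwise λ k → coeff-≡ e (suc k)) (suc i) j)) refl
    rem-cong {a ∷ p} {b ∷ q} e i j = cong₂ (λ x y → x * κ i j + y) (∷-head e) (rem-cong (∷-tail e) (suc i) j)

    rem-⊕ : ∀ p q i j → rem (p ⊕ q) i j ≡ rem p i j + rem q i j
    rem-⊕ []      q       i j = sym (ℤₚ.+-identityˡ _)
    rem-⊕ (a ∷ p) []      i j = sym (ℤₚ.+-identityʳ _)
    rem-⊕ (a ∷ p) (b ∷ q) i j = trans (cong (_+_ ((a + b) * κ i j)) (rem-⊕ p q (suc i) j))
                                      (arrange a b (κ i j) (rem p (suc i) j) (rem q (suc i) j))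
      where
      arrange : ∀ a b k s t → (a + b) * k + (s + t) ≡ (a * k + s) + (b * k + t)
      arrange = solve-∀

    rem-scale : ∀ a p i j → rem (scale a p) i j ≡ a * rem p i j
    rem-scale a []      i j = sym (ℤₚ.*-zeroʳ a)
    rem-scale a (b ∷ p) i j = trans (cong (_+_ (a * b * κ i j)) (rem-scale a p (suc i) j)) (arrange a b (κ i j) (rem p (suc i) j))
      where
      arrange : ∀ a b k s → a * b * k + a * s ≡ a * (b * k + s)
      arrange = solve-∀

    -- `κ-*` extended linearly from powers of x to an arbitrary q: the power x^i may be reduced
    -- first.
    rem-shift : ∀ q i m j → j < d → Σ< d (λ l → κ i l * rem q (l ℕ.+ m) j) ≡ rem q (i ℕ.+ m) j
    rem-shift []      i m j p = Σ<-zero d (λ l _ → ℤₚ.*-zeroʳ (κ i l))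
    rem-shift (a ∷ q) i m j p = trans (Σ<-cong d (λ l _ → arrange (κ i l) a (κ (l ℕ.+ m) j) (rem q (suc (l ℕ.+ m)) j)))
      (trans (Σ<-lin d (λ l → κ i l * rem q (suc (l ℕ.+ m)) j) a (λ l → κ i l * κ (l ℕ.+ m) j))
      (trans (ℤₚ.+-comm (Σ< d (λ l → κ i l * rem q (suc (l ℕ.+ m)) j)) _)
      (cong₂ (λ x y → a * x + y) (κ-* i m j p)
        (trans (Σ<-cong d (λ l _ → cong (λ k → κ i l * rem q k j) (sym (ℕₚ.+-suc l m))))
          (trans (rem-shift q i (suc m) j p) (cong (λ k → rem q k j) (ℕₚ.+-suc i m)))))))
      where
      arrange : ∀ k a s t → k * (a * s + t) ≡ k * t + a * (k * s)
      arrange = solve-∀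

    rem-⊗ : ∀ p q i j → j < d → rem (p ⊗ q) i j ≡ Σ< d (λ l → rem p i l * rem q l j)
    rem-⊗ []      q i j h = sym (Σ<-zero d (λ l _ → refl))
    rem-⊗ (a ∷ p) q i j h = trans (rem-⊕ (scale a q) (+ 0 ∷ (p ⊗ q)) i j)
      (trans (cong₂ _+_ (rem-scale a q i j) (ℤₚ.+-identityˡ (rem (p ⊗ q) (suc i) j)))
      (trans (ℤₚ.+-comm (a * rem q i j) _)
      (trans (cong₂ (λ x y → x + a * y) (rem-⊗ p q (suc i) j h)
        (sym (trans (Σ<-cong d (λ l _ → cong (λ k → κ i l * rem q k j) (sym (ℕₚ.+-identityʳ l))))
          (trans (rem-shift q i 0 j h) (cong (λ k → rem q k j) (ℕₚ.+-identityʳ i))))))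
      (trans (sym (Σ<-lin d (λ l → rem p (suc i) l * rem q l j) a (λ l → κ i l * rem q l j)))
      (Σ<-cong d (λ l _ → arrange (rem p (suc i) l) (rem q l j) a (κ i l)))))))
      where
      arrange : ∀ s t a k → s * t + a * (k * t) ≡ (a * k + s) * t
      arrange = solve-∀

    rem-Σ< : ∀ n p i j → (∀ k → n ≤ k → coeff p k ≡ + 0) → Σ< n (λ k → coeff p k * κ (k ℕ.+ i) j) ≡ rem p i j
    rem-Σ< zero    p       i j h = rem-cong {[]} {p} (coeffwise λ k → sym (h k z≤n)) i j
    rem-Σ< (suc n) []      i j h = Σ<-zero (suc n) (λ _ _ → refl)
    rem-Σ< (suc n) (a ∷ p) i j h = cong (_+_ (a * κ i j)) (trans
      (Σ<-cong n (λ k _ → cong (λ z → coeff p k * κ z j) (sym (ℕₚ.+-suc k i))))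
      (rem-Σ< n p (suc i) j (λ k l → h (suc k) (s≤s l))))

    rem-modulus : ∀ i j → j < d → rem f i j ≡ + 0
    rem-modulus i j h = trans (sym (rem-Σ< (suc d) f i j (above f-monic))) (κ-relation i j h)

    -- The basis is ordered x^(d-1), …, 1 to match the columns of the Sylvester matrix.
    multiplication : ℤ[x] → Matrix
    multiplication p r c = rem p (d′ ∸ r) (d′ ∸ c)

    norm : ℤ[x] → ℤ
    norm p = det d (multiplication p)

    d′∸-< : ∀ c → d′ ∸ c < d
    d′∸-< c = s≤s (ℕₚ.m∸n≤m d′ c)

    norm-cong : ∀ {p q} → p ≋ q → norm p ≡ norm q
    norm-cong e = det-resp d (λ r c _ _ → rem-cong e (d′ ∸ r) (d′ ∸ c))

    norm-⊗ : ∀ p q → norm (p ⊗ q) ≡ norm p * norm q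
    norm-⊗ p q = trans (det-resp d (λ r c _ _ → trans (rem-⊗ p q (d′ ∸ r) (d′ ∸ c) (d′∸-< c))
        (Σ<-reverse d′ (λ l → rem p (d′ ∸ r) l * rem q l (d′ ∸ c)))))
      (det-mul d (multiplication p) (multiplication q))

    norm-mod : ∀ p q → norm ((p ⊗ f) ⊕ q) ≡ norm q
    norm-mod p q = det-resp d {multiplication ((p ⊗ f) ⊕ q)} {multiplication q} (λ r c _ _ → trans (rem-⊕ (p ⊗ f) q (d′ ∸ r) (d′ ∸ c))
      (trans (cong (λ z → z + rem q (d′ ∸ r) (d′ ∸ c)) (trans (rem-⊗ p f (d′ ∸ r) (d′ ∸ c) (d′∸-< c))
        (Σ<-zero d (λ l _ → trans (cong (rem p (d′ ∸ r) l *_) (rem-modulus l (d′ ∸ c) (d′∸-< c))) (ℤₚ.*-zeroʳ (rem p (d′ ∸ r) l))))))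
       (ℤₚ.+-identityˡ (rem q (d′ ∸ r) (d′ ∸ c)))))

    norm-const : ∀ a → norm (constP a) ≡ a ^ d
    norm-const a = det-upper-triangular d (multiplication (constP a)) a
      (λ r c p q → trans (entry r c) (trans (cong (a *_) (δ-off (d′ ∸ r) (d′ ∸ c)
         (λ e → ℕₚ.<⇒≢ q (sym (ℕₚ.∸-cancelˡ-≡ (ℕₚ.≤-pred p) (ℕₚ.≤-trans (ℕₚ.<⇒≤ q) (ℕₚ.≤-pred p)) e))))) (ℤₚ.*-zeroʳ a)))
      (λ i p → trans (entry i i) (trans (cong (a *_) (δ-diag (d′ ∸ i))) (ℤₚ.*-identityʳ a)))
      where
      entry : ∀ r c → multiplication (constP a) r c ≡ a * δ (d′ ∸ r) (d′ ∸ c)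
      entry r c = trans (ℤₚ.+-identityʳ _) (cong (a *_) (κ-δ (d′ ∸ r) (d′ ∸ c) (d′∸-< r) (d′∸-< c)))

    module _ (e : ℕ) (g : ℤ[x]) (g-degree : ∀ k → e < k → coeff g k ≡ + 0) where

      private
        S : Matrix
        S = sylvester d f e g

        S-upper : ∀ r c → r < e → S r c ≡ band d f r c
        S-upper r c p = cong (λ b → if b then band d f r c else band e g (r ∸ e) c) (<ᵇ-true p)

        S-lower : ∀ r c → S (e ℕ.+ r) c ≡ band e g r c
        S-lower r c = trans (cong (λ b → if b then band d f (e ℕ.+ r) c else band e g (e ℕ.+ r ∸ e) c) (<ᵇ-false e r))
                            (cong (λ z → band e g z c) (ℕₚ.m+n∸m≡n e r))

        -- S·B = U·L: B reduces the columns modulo f, B and U are unitriangular, and L is the identity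
        -- on its first e rows with the multiplication matrix of g in its lower right corner.
        B U L : Matrix
        B k c = if c <ᵇ e then δ k c else κ (d′ ℕ.+ e ∸ k) (d′ ∸ (c ∸ e))
        U r k = if r <ᵇ e then (if k <ᵇ e then S r k else + 0) else δ r k
        L k c = if k <ᵇ e then δ k c else (if c <ᵇ e then S k c else multiplication g (k ∸ e) (c ∸ e))

        B-left : ∀ k c → c < e → B k c ≡ δ k c
        B-left k c p = cong (λ b → if b then δ k c else κ (d′ ℕ.+ e ∸ k) (d′ ∸ (c ∸ e))) (<ᵇ-true p)

        B-right : ∀ k j → B k (e ℕ.+ j) ≡ κ (d′ ℕ.+ e ∸ k) (d′ ∸ j)
        B-right k j = trans
          (cong (λ b → if b then δ k (e ℕ.+ j) else κ (d′ ℕ.+ e ∸ k) (d′ ∸ (e ℕ.+ j ∸ e))) (<ᵇ-false e j))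
          (cong (λ z → κ (d′ ℕ.+ e ∸ k) (d′ ∸ z)) (ℕₚ.m+n∸m≡n e j))

        B-corner : ∀ i j → B (e ℕ.+ i) (e ℕ.+ j) ≡ δ (d′ ∸ i) (d′ ∸ j)
        B-corner i j = trans (B-right (e ℕ.+ i) j) (trans
          (cong (λ z → κ z (d′ ∸ j)) (trans (cong (_∸ (e ℕ.+ i)) (ℕₚ.+-comm d′ e)) (ℕₚ.[m+n]∸[m+o]≡n∸o e d′ i)))
          (κ-δ (d′ ∸ i) (d′ ∸ j) (d′∸-< i) (d′∸-< j)))

        det-B : det (e ℕ.+ d) B ≡ + 1
        det-B = trans (det-upper-triangular (e ℕ.+ d) B (+ 1) tri diag) (ℤₚ.^-zeroˡ (e ℕ.+ d))
          where
          tri : ∀ r c → r < e ℕ.+ d → c < r → B r c ≡ + 0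
          tri r c p q with split-index e d c (ℕₚ.<-trans q p)
          ... | inj₁ c<e = trans (B-left r c c<e) (δ-off r c (λ x → ℕₚ.<⇒≢ q (sym x)))
          ... | inj₂ (j , j<d , refl) with split-index e d r p
          ...   | inj₁ r<e = contradiction (ℕₚ.<-trans q r<e) (ℕₚ.≤⇒≯ (ℕₚ.m≤m+n e j))
          ...   | inj₂ (i , i<d , refl) = trans (B-corner i j) (δ-off (d′ ∸ i) (d′ ∸ j)
                  (λ x → ℕₚ.<⇒≢ q (cong (e ℕ.+_) (sym (ℕₚ.∸-cancelˡ-≡ (ℕₚ.≤-pred i<d) (ℕₚ.≤-pred j<d) x)))))
          diag : ∀ i → i < e ℕ.+ d → B i i ≡ + 1
          diag i p with split-index e d i p
          ... | inj₁ i<e            = trans (B-left i i i<e) (δ-diag i)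
          ... | inj₂ (j , _ , refl) = trans (B-corner j j) (δ-diag (d′ ∸ j))

        U-upper : ∀ r k → r < e → U r k ≡ (if k <ᵇ e then S r k else + 0)
        U-upper r k p = cong (λ b → if b then (if k <ᵇ e then S r k else + 0) else δ r k) (<ᵇ-true p)

        U-left : ∀ r k → r < e → k < e → U r k ≡ S r k
        U-left r k p q = trans (U-upper r k p) (cong (λ b → if b then S r k else + 0) (<ᵇ-true q))

        U-right : ∀ r j → r < e → U r (e ℕ.+ j) ≡ + 0
        U-right r j p = trans (U-upper r (e ℕ.+ j) p) (cong (λ b → if b then S r (e ℕ.+ j) else + 0) (<ᵇ-false e j))

        U-lower : ∀ r k → U (e ℕ.+ r) k ≡ δ (e ℕ.+ r) k
        U-lower r k = cong (λ b → if b then (if k <ᵇ e then S (e ℕ.+ r) k else + 0) else δ (e ℕ.+ r) k) (<ᵇ-false e r)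

        det-U : det (e ℕ.+ d) U ≡ + 1
        det-U = trans (det-upper-triangular (e ℕ.+ d) U (+ 1) tri diag) (ℤₚ.^-zeroˡ (e ℕ.+ d))
          where
          tri : ∀ r c → r < e ℕ.+ d → c < r → U r c ≡ + 0
          tri r c p q with split-index e d r p
          ... | inj₁ r<e = trans (U-left r c r<e (ℕₚ.<-trans q r<e)) (trans (S-upper r c r<e) (band-left d f r c q))
          ... | inj₂ (i , _ , refl) = trans (U-lower i c) (δ-off (e ℕ.+ i) c (λ x → ℕₚ.<⇒≢ q (sym x)))
          diag : ∀ i → i < e ℕ.+ d → U i i ≡ + 1
          diag i p with split-index e d i p
          ... | inj₁ i<e = trans (U-left i i i<e i<e) (trans (S-upper i i i<e)
                  (trans (cong (band d f i) (sym (ℕₚ.+-identityʳ i))) (trans (band-inside d f i 0 z≤n) (leading f-monic))))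
          ... | inj₂ (j , _ , refl) = trans (U-lower j (e ℕ.+ j)) (δ-diag (e ℕ.+ j))

        L-upper : ∀ k c → k < e → L k c ≡ δ k c
        L-upper k c p = cong (λ b → if b then δ k c else (if c <ᵇ e then S k c else multiplication g (k ∸ e) (c ∸ e))) (<ᵇ-true p)

        L-lower : ∀ i c → L (e ℕ.+ i) c ≡ (if c <ᵇ e then S (e ℕ.+ i) c else multiplication g i (c ∸ e))
        L-lower i c = trans
          (cong (λ b → if b then δ (e ℕ.+ i) c else (if c <ᵇ e then S (e ℕ.+ i) c else multiplication g (e ℕ.+ i ∸ e) (c ∸ e))) (<ᵇ-false e i))
          (cong (λ z → if c <ᵇ e then S (e ℕ.+ i) c else multiplication g z (c ∸ e)) (ℕₚ.m+n∸m≡n e i))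

        L-left : ∀ i c → c < e → L (e ℕ.+ i) c ≡ S (e ℕ.+ i) c
        L-left i c p = trans (L-lower i c) (cong (λ b → if b then S (e ℕ.+ i) c else multiplication g i (c ∸ e)) (<ᵇ-true p))

        L-corner : ∀ i j → L (e ℕ.+ i) (e ℕ.+ j) ≡ multiplication g i j
        L-corner i j = trans (L-lower i (e ℕ.+ j)) (trans
          (cong (λ b → if b then S (e ℕ.+ i) (e ℕ.+ j) else multiplication g i (e ℕ.+ j ∸ e)) (<ᵇ-false e j))
          (cong (multiplication g i) (ℕₚ.m+n∸m≡n e j)))

        det-L : det (e ℕ.+ d) L ≡ norm g
        det-L = trans (det-identity-block e d L (λ r c p _ → L-upper r c p)) (det-resp d (λ r c _ _ → L-corner r c))

        arith₁ : ∀ d′ r s → r ℕ.+ (suc (suc d′) ℕ.+ s) ≡ (suc r ℕ.+ s) ℕ.+ suc d′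
        arith₁ = ℕ-Solver.solve-∀
        arith₂ : ∀ d′ r s → r ℕ.+ (suc d′ ℕ.+ s) ≡ d′ ℕ.+ (suc r ℕ.+ s)
        arith₂ = ℕ-Solver.solve-∀
        arith₃ : ∀ i s e → i ℕ.+ (suc e ℕ.+ s) ≡ e ℕ.+ suc (i ℕ.+ s)
        arith₃ = ℕ-Solver.solve-∀
        arith₄ : ∀ i s e → i ℕ.+ (e ℕ.+ s) ≡ i ℕ.+ s ℕ.+ e
        arith₄ = ℕ-Solver.solve-∀

        -- Row r of the upper band reads as x^s f with s = e - 1 - r, and the matrix B replaces it
        -- by its remainder, which is 0.
        upper-row : ∀ r J → r < e → J < d → Σ< (e ℕ.+ d) (λ k → S r k * κ (d′ ℕ.+ e ∸ k) J) ≡ + 0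
        upper-row r J r<e J<d = trans (Σ<-cong (e ℕ.+ d) (λ k _ → cong (_* κ (d′ ℕ.+ e ∸ k) J) (S-upper r k r<e)))
          (trans (cong₂ (λ n t → Σ< n (λ k → band d f r k * κ (t ∸ k) J))
                   (trans (cong (ℕ._+ d) (sym e≡)) (sym (arith₁ d′ r s)))
                   (trans (cong (d′ ℕ.+_) (sym e≡)) (sym (arith₂ d′ r s))))
          (trans (Σ<-band d f r s (λ i → κ i J)) (κ-relation s J J<d)))
          where
          s : ℕ
          s = e ∸ suc r
          e≡ : suc r ℕ.+ s ≡ e
          e≡ = ℕₚ.m+[n∸m]≡n r<e

        -- Row i of the lower band reads as x^(d′ - i) g, so its reduction is row i of the
        -- multiplication matrix of g.
        lower-row : ∀ i J → i < d → Σ< (e ℕ.+ d) (λ k → S (e ℕ.+ i) k * κ (d′ ℕ.+ e ∸ k) J) ≡ rem g (d′ ∸ i) J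
        lower-row i J (s≤s i≤d′) = trans (Σ<-cong (e ℕ.+ d) (λ k _ → cong (_* κ (d′ ℕ.+ e ∸ k) J) (S-lower i k)))
          (trans (cong₂ (λ n t → Σ< n (λ k → band e g i k * κ (t ∸ k) J))
                   (trans (cong (λ z → e ℕ.+ suc z) (sym d≡)) (sym (arith₃ i s e)))
                   (trans (cong (ℕ._+ e) (sym d≡)) (sym (arith₄ i s e))))
          (trans (Σ<-band e g i s (λ i → κ i J)) (rem-Σ< (suc e) g s J g-degree)))
          where
          s : ℕ
          s = d′ ∸ i
          d≡ : i ℕ.+ s ≡ d′
          d≡ = ℕₚ.m+[n∸m]≡n i≤d′

        factorisation : ∀ r c → r < e ℕ.+ d → c < e ℕ.+ d → matMul (e ℕ.+ d) S B r c ≡ matMul (e ℕ.+ d) U L r c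
        factorisation r c p q with split-index e d r p | split-index e d c q
        ... | inj₁ r<e | inj₁ c<e =
          trans (trans (Σ<-cong (e ℕ.+ d) (λ k _ → cong (S r k *_) (B-left k c c<e))) (Σ<-δ (e ℕ.+ d) (S r) c q))
          (sym (trans (Σ<-split e d _) (trans (cong₂ _+_
            (trans (Σ<-cong e (λ k k<e → cong₂ _*_ (U-left r k r<e k<e) (L-upper k c k<e))) (Σ<-δ e (S r) c c<e))
            (Σ<-zero d (λ j _ → cong (_* L (e ℕ.+ j) c) (U-right r j r<e)))) (ℤₚ.+-identityʳ _))))
        ... | inj₁ r<e | inj₂ (j , _ , refl) =
          trans (trans (Σ<-cong (e ℕ.+ d) (λ k _ → cong (S r k *_) (B-right k j))) (upper-row r (d′ ∸ j) r<e (d′∸-< j)))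
          (sym (trans (Σ<-split e d _) (cong₂ _+_
            (Σ<-zero e (λ k k<e → trans (cong (U r k *_) (trans (L-upper k (e ℕ.+ j) k<e)
               (δ-off k (e ℕ.+ j) (ℕₚ.<⇒≢ (ℕₚ.<-≤-trans k<e (ℕₚ.m≤m+n e j)))))) (ℤₚ.*-zeroʳ (U r k))))
            (Σ<-zero d (λ i _ → cong (_* L (e ℕ.+ i) (e ℕ.+ j)) (U-right r i r<e))))))
        ... | inj₂ (i , i<d , refl) | split = trans (left split) (sym
          (trans (Σ<-cong (e ℕ.+ d) (λ k _ → trans (cong (_* L k c) (trans (U-lower i k) (δ-sym (e ℕ.+ i) k))) (ℤₚ.*-comm (δ k (e ℕ.+ i)) (L k c))))
          (Σ<-δ (e ℕ.+ d) (λ k → L k c) (e ℕ.+ i) p)))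
          where
          left : c < e ⊎ (∃[ j ] (j < d × c ≡ e ℕ.+ j)) → matMul (e ℕ.+ d) S B (e ℕ.+ i) c ≡ L (e ℕ.+ i) c
          left (inj₁ c<e) = trans (Σ<-cong (e ℕ.+ d) (λ k _ → cong (S (e ℕ.+ i) k *_) (B-left k c c<e)))
            (trans (Σ<-δ (e ℕ.+ d) (S (e ℕ.+ i)) c q) (sym (L-left i c c<e)))
          left (inj₂ (j , _ , refl)) = trans (Σ<-cong (e ℕ.+ d) (λ k _ → cong (S (e ℕ.+ i) k *_) (B-right k j)))
            (trans (lower-row i (d′ ∸ j) i<d) (sym (L-corner i j)))

      det-sylvester : det (d ℕ.+ e) (sylvester d f e g) ≡ norm g
      det-sylvester = trans (cong (λ n → det n S) (ℕₚ.+-comm d e))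
        (trans (sym (trans (cong (det (e ℕ.+ d) S *_) det-B) (ℤₚ.*-identityʳ _)))
        (trans (sym (det-mul (e ℕ.+ d) S B))
        (trans (det-resp (e ℕ.+ d) factorisation)
        (trans (det-mul (e ℕ.+ d) U L)
        (trans (cong₂ _*_ det-U det-L) (ℤₚ.*-identityˡ _))))))

-- Divisibility and congruences for Fibonacci elements of a commutative ring.

module FibonacciIdentities where

  open import Data.Nat as ℕ using (ℕ; zero; suc)
  import Data.Nat.Properties as ℕₚ
  open import Data.Nat.GCD using (gcd; gcd[m,n]≡0⇒m≡0; module Bézout; gcd-GCD)
  open import Data.Product using (_,_; ∃-syntax)
  open import Relation.Nullary.Negation using (contradiction)
  import Relation.Binary.PropositionalEquality as ≡
  open ≡ using (_≡_; _≢_)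
  open import Algebra.Bundles using (CommutativeRing)

  module Fibonacci {c ℓ} (R : CommutativeRing c ℓ) (x : CommutativeRing.Carrier R) where
    open CommutativeRing R
    open import Relation.Binary.Reasoning.Setoid setoid

    open import Algebra.Solver.Ring.NaturalCoefficients.Default commutativeSemiring using (solve; _:+_; _:*_; _:=_)

    f : ℕ → Carrier
    f zero          = 0#
    f (suc zero)    = 1#
    f (suc (suc n)) = x * f (suc n) + f n

    f-resp : ∀ {m n} → m ≡ n → f m ≈ f n
    f-resp e = reflexive (≡.cong f e)

    f-+ : ∀ a b → f (a ℕ.+ suc b) ≈ f (suc a) * f (suc b) + f a * f b
    f-+ zero          b = sym (trans (+-cong (*-identityˡ _) (zeroˡ _)) (+-identityʳ _))
    f-+ (suc zero)    b = sym (+-cong (*-congʳ (trans (+-identityʳ _) (*-identityʳ x))) (*-identityˡ _))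
    f-+ (suc (suc a)) b = trans (+-cong (*-congˡ (f-+ (suc a) b)) (f-+ a b))
                                (expand x (f (suc (suc a))) (f (suc a)) (f a) (f (suc b)) (f b))
      where
      expand : ∀ x p q r s t → x * (p * s + q * t) + (q * s + r * t) ≈ (x * p + q) * s + (x * q + r) * t
      expand = solve 6 (λ x p q r s t → x :* (p :* s :+ q :* t) :+ (q :* s :+ r :* t) := (x :* p :+ q) :* s :+ (x :* q :+ r) :* t) refl

    Comaximal : Carrier → Carrier → Set _
    Comaximal a b = ∃[ u ] ∃[ v ] (u * a + v * b ≈ 1#)

    cancel-neg : ∀ v w → (v + - w) + w ≈ v
    cancel-neg v w = trans (+-assoc v (- w) w) (trans (+-congˡ (-‿inverseˡ w)) (+-identityʳ v))

    -- One Euclidean step: f(n) = f(n + 2) - x f(n + 1) is substituted into the previous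
    -- combination.
    f-comaximal : ∀ n → Comaximal (f n) (f (suc n))
    f-comaximal zero    = 0# , 1# , trans (+-cong (zeroˡ 0#) (*-identityˡ 1#)) (+-identityˡ 1#)
    f-comaximal (suc n) with f-comaximal n
    ... | u , v , e = v + - (u * x) , u , (begin
      (v + - (u * x)) * f (suc n) + u * (x * f (suc n) + f n) ≈⟨ collect (v + - (u * x)) u x (f (suc n)) (f n) ⟩
      u * f n + ((v + - (u * x)) + u * x) * f (suc n)         ≈⟨ +-congˡ (*-congʳ (cancel-neg v (u * x))) ⟩
      u * f n + v * f (suc n)                                 ≈⟨ e ⟩
      1#                                                      ∎)
      where
      collect : ∀ w u x p q → w * p + u * (x * p + q) ≈ u * q + (w + u * x) * p
      collect = solve 5 (λ w u x p q → w :* p :+ u :* (x :* p :+ q) := u :* q :+ (w :+ u :* x) :* p) refl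

    -- The quotient of f(k d) by f(d), with d = d′ + 1, built without division by the recursion that
    -- the addition formula supplies.
    quotient : ℕ → ℕ → Carrier
    quotient d′ zero    = 0#
    quotient d′ (suc k) = f (suc (k ℕ.* suc d′)) + quotient d′ k * f d′

    f-* : ∀ d′ k → f (k ℕ.* suc d′) ≈ quotient d′ k * f (suc d′)
    f-* d′ zero    = sym (zeroˡ _)
    f-* d′ (suc k) = begin
      f (suc d′ ℕ.+ k ℕ.* suc d′)                                                    ≈⟨ f-resp (ℕₚ.+-comm (suc d′) (k ℕ.* suc d′)) ⟩
      f (k ℕ.* suc d′ ℕ.+ suc d′)                                                    ≈⟨ f-+ (k ℕ.* suc d′) d′ ⟩
      f (suc (k ℕ.* suc d′)) * f (suc d′) + f (k ℕ.* suc d′) * f d′                  ≈⟨ +-congˡ (*-congʳ (f-* d′ k)) ⟩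
      f (suc (k ℕ.* suc d′)) * f (suc d′) + quotient d′ k * f (suc d′) * f d′        ≈⟨ collect (f (suc (k ℕ.* suc d′))) (f (suc d′)) (quotient d′ k) (f d′) ⟩
      (f (suc (k ℕ.* suc d′)) + quotient d′ k * f d′) * f (suc d′)                   ∎
      where
      collect : ∀ a b c e → a * b + c * b * e ≈ (a + c * e) * b
      collect = solve 4 (λ a b c e → a :* b :+ c :* b :* e := (a :+ c :* e) :* b) refl

    ν : ℕ → Carrier
    ν zero    = 0#
    ν (suc k) = 1# + ν k

    infixr 8 _^^_
    _^^_ : Carrier → ℕ → Carrier
    q ^^ zero  = 1#
    q ^^ suc k = q ^^ k * q

    -- Let d = d′ + 1. Modulo f(d) the addition formula for kd + (d + 1) loses its second term, and
    -- f(d + 1) = x f(d) + f(d - 1) becomes f(d - 1); each step therefore multiplies by f(d - 1).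
    f-suc-mod : ∀ d′ k → ∃[ h ] (f (suc (k ℕ.* suc d′)) ≈ f d′ ^^ k + h * f (suc d′))
    f-suc-mod d′ zero    = 0# , sym (trans (+-congˡ (zeroˡ _)) (+-identityʳ _))
    f-suc-mod d′ (suc k) with f-suc-mod d′ k
    ... | h , e = _ , (begin
      f (suc (suc d′ ℕ.+ k ℕ.* suc d′))                                       ≈⟨ f-resp (ℕₚ.+-comm (suc (suc d′)) (k ℕ.* suc d′)) ⟩
      f (k ℕ.* suc d′ ℕ.+ suc (suc d′))                                       ≈⟨ f-+ (k ℕ.* suc d′) (suc d′) ⟩
      f (suc (k ℕ.* suc d′)) * f (suc (suc d′)) + f (k ℕ.* suc d′) * f (suc d′) ≈⟨ +-congʳ (*-cong e (twoStep d′)) ⟩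
      (f d′ ^^ k + h * f (suc d′)) * (x * f (suc d′) + f d′) + f (k ℕ.* suc d′) * f (suc d′)
        ≈⟨ collect (f d′ ^^ k) h (f (suc d′)) x (f d′) (f (k ℕ.* suc d′)) ⟩
      f d′ ^^ k * f d′ + (f d′ ^^ k * x + h * (x * f (suc d′) + f d′) + f (k ℕ.* suc d′)) * f (suc d′) ∎)
      where
      twoStep : ∀ n → f (suc (suc n)) ≈ x * f (suc n) + f n
      twoStep n = refl
      collect : ∀ a h p x q r → (a + h * p) * (x * p + q) + r * p ≈ a * q + (a * x + h * (x * p + q) + r) * p
      collect = solve 6 (λ a h p x q r → (a :+ h :* p) :* (x :* p :+ q) :+ r :* p := a :* q :+ (a :* x :+ h :* (x :* p :+ q) :+ r) :* p) refl

    -- In the recursion for `quotient` the new summand and the old quotient times f(d′) are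
    -- multiples of the same power of f(d′), with coefficients 1 and k + 1, which is where the
    -- integer factor arises.
    quotient-mod : ∀ d′ k → ∃[ h ] (quotient d′ (suc k) ≈ h * f (suc d′) + ν (suc k) * f d′ ^^ k)
    quotient-mod d′ zero    = 0# , (begin
      1# + 0# * f d′                    ≈⟨ +-congˡ (zeroˡ _) ⟩
      1# + 0#                           ≈⟨ *-identityʳ _ ⟨
      (1# + 0#) * 1#                    ≈⟨ +-identityˡ _ ⟨
      0# + (1# + 0#) * 1#               ≈⟨ +-congʳ (zeroˡ _) ⟨
      0# * f (suc d′) + (1# + 0#) * 1#  ∎)
    quotient-mod d′ (suc k) with quotient-mod d′ k | f-suc-mod d′ (suc k)
    ... | h , e | h′ , e′ = _ , (begin
      f (suc (suc k ℕ.* suc d′)) + quotient d′ (suc k) * f d′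
        ≈⟨ +-cong e′ (*-congʳ e) ⟩
      (f d′ ^^ k * f d′ + h′ * f (suc d′)) + (h * f (suc d′) + ν (suc k) * f d′ ^^ k) * f d′
        ≈⟨ collect (f d′ ^^ k) (f d′) h′ (f (suc d′)) h (ν (suc k)) ⟩
      (h′ + h * f d′) * f (suc d′) + (f d′ ^^ k * f d′ + ν (suc k) * (f d′ ^^ k * f d′))
        ≈⟨ +-congˡ (trans (+-congʳ (sym (*-identityˡ _))) (sym (distribʳ _ 1# (ν (suc k))))) ⟩
      (h′ + h * f d′) * f (suc d′) + (1# + ν (suc k)) * (f d′ ^^ k * f d′) ∎)
      where
      collect : ∀ a q h′ p h n → (a * q + h′ * p) + (h * p + n * a) * q ≈ (h′ + h * q) * p + (a * q + n * (a * q))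
      collect = solve 6 (λ a q h′ p h n → (a :* q :+ h′ :* p) :+ (h :* p :+ n :* a) :* q := (h′ :+ h :* q) :* p :+ (a :* q :+ n :* (a :* q))) refl

    -- In w * f(yn) + v * f(d + yn) the coefficient w is corrected by - v f(d-1), the other term of the addition formula.
    f-bézout : ∀ d n′ m′ x y → d ≢ 0 → d ℕ.+ y ℕ.* suc n′ ≡ x ℕ.* suc m′ →
               ∃[ a ] ∃[ b ] (a * f (suc m′) + b * f (suc n′) ≈ f d)
    f-bézout zero     n′ m′ x y h e = contradiction ≡.refl h
    f-bézout (suc d′) n′ m′ x y h e with f-comaximal (y ℕ.* suc n′)
    ... | u , v , one = v * quotient m′ x , w * quotient n′ y , (begin
      v * quotient m′ x * f (suc m′) + w * quotient n′ y * f (suc n′)     ≈⟨ +-cong (*-assoc _ _ _) (*-assoc _ _ _) ⟩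
      v * (quotient m′ x * f (suc m′)) + w * (quotient n′ y * f (suc n′)) ≈⟨ +-cong (*-congˡ (f-* m′ x)) (*-congˡ (f-* n′ y)) ⟨
      v * f (x ℕ.* suc m′) + w * Y                                        ≈⟨ +-congʳ (*-congˡ (f-resp (≡.trans (≡.sym e) (ℕₚ.+-comm (suc d′) (y ℕ.* suc n′))))) ⟩
      v * f (y ℕ.* suc n′ ℕ.+ suc d′) + w * Y                             ≈⟨ +-congʳ (*-congˡ (f-+ (y ℕ.* suc n′) d′)) ⟩
      v * (S * f (suc d′) + Y * f d′) + w * Y                             ≈⟨ collect v S (f (suc d′)) Y (f d′) w ⟩
      (w + v * f d′) * Y + v * S * f (suc d′)                             ≈⟨ +-congʳ (*-congʳ (cancel-neg (u * f (suc d′)) (v * f d′))) ⟩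
      u * f (suc d′) * Y + v * S * f (suc d′)                             ≈⟨ collect′ u (f (suc d′)) Y v S ⟩
      (u * Y + v * S) * f (suc d′)                                        ≈⟨ *-congʳ one ⟩
      1# * f (suc d′)                                                     ≈⟨ *-identityˡ _ ⟩
      f (suc d′)                                                          ∎)
      where
      Y S w : Carrier
      Y = f (y ℕ.* suc n′)
      S = f (suc (y ℕ.* suc n′))
      w = u * f (suc d′) + - (v * f d′)
      collect : ∀ v s d y e w → v * (s * d + y * e) + w * y ≈ (w + v * e) * y + v * s * d
      collect = solve 6 (λ v s d y e w → v :* (s :* d :+ y :* e) :+ w :* y := (w :+ v :* e) :* y :+ v :* s :* d) refl
      collect′ : ∀ u d y v s → u * d * y + v * s * d ≈ (u * y + v * s) * d
      collect′ = solve 5 (λ u d y v s → u :* d :* y :+ v :* s :* d := (u :* y :+ v :* s) :* d) refl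

    -- Bézout's identity in ℕ comes with the gcd added on one side or on the other; the second form
    -- is the first with the two indices exchanged.
    f-gcd : ∀ m′ n′ → ∃[ a ] ∃[ b ] (a * f (suc m′) + b * f (suc n′) ≈ f (gcd (suc m′) (suc n′)))
    f-gcd m′ n′ with Bézout.identity (gcd-GCD (suc m′) (suc n′))
    ... | Bézout.Identity.+- x y e = f-bézout (gcd (suc m′) (suc n′)) n′ m′ x y gcd≢0 e
      where
      gcd≢0 : gcd (suc m′) (suc n′) ≢ 0
      gcd≢0 h with gcd[m,n]≡0⇒m≡0 {suc m′} {suc n′} h
      ... | ()
    ... | Bézout.Identity.-+ x y e with f-bézout (gcd (suc m′) (suc n′)) m′ n′ y x gcd≢0 e
      where
      gcd≢0 : gcd (suc m′) (suc n′) ≢ 0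
      gcd≢0 h with gcd[m,n]≡0⇒m≡0 {suc m′} {suc n′} h
      ... | ()
    ... | a , b , e′ = b , a , trans (+-comm _ _) e′

-- The divisor sum of Euler's function.

module TotientSum where

  open Homogenisation
  open import Data.Nat as ℕ using (ℕ; zero; suc; _≤_; _<_; s≤s; _+_; _*_)
  open import Data.Nat.Properties as ℕₚ using ()
  open import Data.Nat.GCD using (gcd; gcd[m,n]∣m; gcd[m,n]∣n; c*gcd[m,n]≡gcd[cm,cn]; gcd-zeroˡ)
  open import Data.Nat.Divisibility using (_∣_; _∣?_; divides; ∣m+n∣m⇒∣n; n∣m*n; ∣⇒≤)
  open import Data.List using (List; []; _∷_; map; foldr; upTo; filter; length)
  open import Relation.Nullary using (yes; no; Dec)
  open import Relation.Nullary.Negation using (contradiction)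
  open import Relation.Binary.PropositionalEquality
  open import Function using (id)
  open Sumℕ

  length-foldr : ∀ (xs : List ℕ) → length xs ≡ foldr _+_ 0 (map (λ _ → 1) xs)
  length-foldr []       = refl
  length-foldr (x ∷ xs) = cong suc (length-foldr xs)

  φ-fold : ∀ n → φ n ≡ fold< n (λ i → select (gcd (suc i) n ℕ.≟ 1) 1)
  φ-fold n = trans (length-foldr (filter (λ s → gcd s n ℕ.≟ 1) (map suc (upTo n))))
                   (foldr-filter (λ s → gcd s n ℕ.≟ 1) suc id (λ _ → 1) n)

  fold<-ones : ∀ n → fold< n (λ _ → 1) ≡ n
  fold<-ones zero    = refl
  fold<-ones (suc n) = cong suc (fold<-ones n)

  -- Index i stands for the number i + 1, so the multiples of g = g′ + 1 sit at the indices k g +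
  -- g′.
  fold<-multiples : ∀ g′ d f → (∀ k r → r < g′ → f (k * suc g′ + r) ≡ 0) →
                    fold< (d * suc g′) f ≡ fold< d (λ k → f (k * suc g′ + g′))
  fold<-multiples g′ zero    f h = refl
  fold<-multiples g′ (suc d) f h = trans (fold<-split (suc g′) (d * suc g′) f)
    (cong₂ _+_
      (fold<-single (suc g′) g′ ℕₚ.≤-refl (λ i p x → h 0 i (ℕₚ.≤∧≢⇒< (ℕₚ.≤-pred p) x)))
      (trans (fold<-multiples g′ d (λ i → f (suc g′ + i))
          (λ k r p → trans (cong f (sym (ℕₚ.+-assoc (suc g′) (k * suc g′) r))) (h (suc k) r p)))
        (fold<-cong d (λ k _ → cong f (sym (ℕₚ.+-assoc (suc g′) (k * suc g′) g′))))))

  select-≡ : {P Q : Set} (P? : Dec P) (Q? : Dec Q) {a : ℕ} → (P → Q) → (Q → P) → select P? a ≡ select Q? a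
  select-≡ (yes p) Q? P⇒Q Q⇒P = sym (select-yes Q? (P⇒Q p))
  select-≡ (no ¬p) Q? P⇒Q Q⇒P = sym (select-no Q? (λ q → ¬p (Q⇒P q)))

  -- With n = d g, the condition d · gcd(s, n) = n says gcd(s, n) = g; then s = g t, and gcd(g t, g
  -- d) = g gcd(t, d) turns it into gcd(t, d) = 1.
  count-gcd : ∀ g′ d′ → let n = suc d′ * suc g′ in
              fold< n (λ i → select (suc d′ * gcd (suc i) n ℕ.≟ n) 1) ≡ φ (suc d′)
  count-gcd g′ d′ = trans (fold<-multiples g′ d hit vanish)
    (trans (fold<-cong d {λ k → hit (k * g + g′)} {λ k → select (gcd (suc k) d ℕ.≟ 1) 1} (λ k _ → select-≡
        (d * gcd (suc (k * g + g′)) n ℕ.≟ n) (gcd (suc k) d ℕ.≟ 1) (to k) (from k)))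
      (sym (φ-fold d)))
    where
    g d n : ℕ
    g = suc g′
    d = suc d′
    n = d * g
    hit : ℕ → ℕ
    hit i = select (d * gcd (suc i) n ℕ.≟ n) 1
    gcd≡g : ∀ i → d * gcd i n ≡ n → gcd i n ≡ g
    gcd≡g i = ℕₚ.*-cancelˡ-≡ (gcd i n) g d
    vanish : ∀ k r → r < g′ → hit (k * g + r) ≡ 0
    vanish k r r<g′ = select-no (d * gcd (suc (k * g + r)) n ℕ.≟ n) (λ e → ℕₚ.<⇒≱ (s≤s r<g′)
      (∣⇒≤ (∣m+n∣m⇒∣n (subst₂ _∣_ (gcd≡g (suc (k * g + r)) e) (sym (ℕₚ.+-suc (k * g) r)) (gcd[m,n]∣m (suc (k * g + r)) n)) (n∣m*n k))))
    multiple : ∀ k → gcd (suc (k * g + g′)) n ≡ g * gcd (suc k) d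
    multiple k = trans (cong₂ gcd (trans (sym (ℕₚ.+-suc (k * g) g′)) (trans (ℕₚ.+-comm (k * g) g) (ℕₚ.*-comm (suc k) g)))
                                  (ℕₚ.*-comm d g))
                       (sym (c*gcd[m,n]≡gcd[cm,cn] g (suc k) d))
    to : ∀ k → d * gcd (suc (k * g + g′)) n ≡ n → gcd (suc k) d ≡ 1
    to k e = ℕₚ.*-cancelˡ-≡ (gcd (suc k) d) 1 g
      (trans (sym (multiple k)) (trans (gcd≡g (suc (k * g + g′)) e) (sym (ℕₚ.*-identityʳ g))))
    from : ∀ k → gcd (suc k) d ≡ 1 → d * gcd (suc (k * g + g′)) n ≡ n
    from k e = cong (d *_) (trans (multiple k) (trans (cong (g *_) e) (ℕₚ.*-identityʳ g)))

  -- Sort s ≤ n by d = n / gcd(s, n).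
  totient-sum : ∀ n → 1 ≤ n → fold< n (λ i → select (suc i ∣? n) (φ (suc i))) ≡ n
  totient-sum n 1≤n = sym (trans (sym (fold<-ones n))
    (trans (fold<-cong n {λ _ → 1} {λ i → fold< n (hit i)} (λ i _ → sym (unique i)))
    (trans (fold<-swap n n hit)
    (fold<-cong n {λ j → fold< n (λ i → hit i j)} {λ j → select (suc j ∣? n) (φ (suc j))} (λ j _ → inner j)))))
    where
    hit : ℕ → ℕ → ℕ
    hit i j = select (suc j * gcd (suc i) n ℕ.≟ n) 1
    n≢0 : n ≢ 0
    n≢0 e = ℕₚ.<⇒≢ 1≤n (sym e)
    unique : ∀ i → fold< n (λ j → select (suc j * gcd (suc i) n ℕ.≟ n) 1) ≡ 1
    unique i with gcd (suc i) n | gcd[m,n]∣n (suc i) n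
    ... | g     | divides zero    e = contradiction e n≢0
    ... | zero  | divides (suc c) e = contradiction (trans e (ℕₚ.*-zeroʳ (suc c))) n≢0
    ... | suc g | divides (suc c) e = trans
      (fold<-single n c (subst (suc c ≤_) (sym e) (ℕₚ.m≤m*n (suc c) (suc g)))
        (λ j _ j≢c → select-no (suc j * suc g ℕ.≟ n) (λ e′ → j≢c
          (ℕₚ.suc-injective (ℕₚ.*-cancelʳ-≡ (suc j) (suc c) (suc g) (trans e′ e))))))
      (select-yes (suc c * suc g ℕ.≟ n) (sym e))
    inner : ∀ j → fold< n (λ i → select (suc j * gcd (suc i) n ℕ.≟ n) 1) ≡ select (suc j ∣? n) (φ (suc j))
    inner j with suc j ∣? n
    ... | no ¬d = fold<-ε n (λ i _ → select-no (suc j * gcd (suc i) n ℕ.≟ n)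
                    (λ e → ¬d (divides (gcd (suc i) n) (trans (sym e) (ℕₚ.*-comm (suc j) _)))))
    ... | yes (divides zero e) = contradiction e n≢0
    ... | yes (divides (suc g′) e) = trans
      (cong (λ z → fold< z (λ i → select (suc j * gcd (suc i) z ℕ.≟ z) 1)) (trans e (ℕₚ.*-comm (suc g′) (suc j))))
      (count-gcd g′ j)

  -- The number 1 is always counted. The successor form supplies the d′ that the arithmetic modulo
  -- Ψ_m is built on.
  φ-positive : ∀ n → 1 ≤ n → φ n ≡ suc (ℕ.pred (φ n))
  φ-positive (suc n) _ = sym (ℕₚ.suc-pred (φ (suc n)) {{ℕ.>-nonZero (subst (1 ≤_) (sym (φ-fold (suc n)))
    (ℕₚ.m≤n⇒m≤n+o _ (ℕₚ.≤-reflexive (sym (select-yes (gcd 1 (suc n) ℕ.≟ 1) {1} (gcd-zeroˡ (suc n)))))))}})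

-- Even and odd polynomials, and Sylvester matrices of even polynomials.

module Parities where

  open Determinants
  open Polynomials
  open Homogenisation
  open import Data.Nat as ℕ using (ℕ; zero; suc; _≤_; s≤s; _∸_; _<ᵇ_; _≤ᵇ_)
  import Data.Nat.Properties as ℕₚ
  open import Data.Integer as ℤ using (+_; -[1+_]; _+_; _*_; -_; ∣_∣)
  import Data.Integer.Properties as ℤₚ
  open import Data.Bool using (true; false; if_then_else_; not; T; _xor_)
  open import Data.List using ([]; _∷_)
  open import Data.Unit using (tt)
  open import Data.Product using (_×_; _,_; ∃-syntax)
  open import Data.Sum using (_⊎_; inj₁; inj₂)
  open import Relation.Nullary.Negation using (contradiction)
  open import Relation.Binary.PropositionalEquality
  open import Algebra.Bundles using (CommutativeRing)
  open ZX using (coeff; _⊕_; scale; _⊗_; negP; oneP; X)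
  open import Algebra.Properties.Ring (CommutativeRing.ring polynomialRing)

    using (-‿distribˡ-*; -‿distribʳ-*; -‿involutive; -‿+-comm)

  -- reflect p is p(-x).
  reflect : ℤ[x] → ℤ[x]
  reflect []      = []
  reflect (a ∷ p) = a ∷ negP (reflect p)

  coeff-reflect : ∀ p i → coeff (reflect p) i ≡ sign i * coeff p i
  coeff-reflect []      i       = sym (ℤₚ.*-zeroʳ (sign i))
  coeff-reflect (a ∷ p) zero    = sym (ℤₚ.*-identityˡ a)
  coeff-reflect (a ∷ p) (suc i) = trans (coeff-neg (reflect p) i) (trans (cong -_ (coeff-reflect p i))
                                    (ℤₚ.neg-distribˡ-* (sign i) (coeff p i)))

  reflect-cong : ∀ {p q} → p ≋ q → reflect p ≋ reflect q
  reflect-cong {p} {q} e = coeffwise λ i → trans (coeff-reflect p i)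
    (trans (cong (sign i *_) (coeff-≡ e i)) (sym (coeff-reflect q i)))

  reflect-⊕ : ∀ p q → reflect (p ⊕ q) ≋ reflect p ⊕ reflect q
  reflect-⊕ p q = coeffwise λ i → trans (coeff-reflect (p ⊕ q) i) (trans (cong (sign i *_) (coeff-⊕ p q i))
    (trans (ℤₚ.*-distribˡ-+ (sign i) (coeff p i) (coeff q i))
    (sym (trans (coeff-⊕ (reflect p) (reflect q) i) (cong₂ _+_ (coeff-reflect p i) (coeff-reflect q i))))))

  reflect-scale : ∀ a p → reflect (scale a p) ≋ scale a (reflect p)
  reflect-scale a p = coeffwise λ i → trans (coeff-reflect (scale a p) i) (trans (cong (sign i *_) (coeff-scale a p i))
    (trans (trans (sym (ℤₚ.*-assoc (sign i) a (coeff p i))) (trans (cong (_* coeff p i) (ℤₚ.*-comm (sign i) a)) (ℤₚ.*-assoc a (sign i) (coeff p i))))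
    (sym (trans (coeff-scale a (reflect p) i) (cong (a *_) (coeff-reflect p i))))))

  reflect-⊗ : ∀ p q → reflect (p ⊗ q) ≋ reflect p ⊗ reflect q
  reflect-⊗ []      q = ≋-refl
  reflect-⊗ (a ∷ p) q = ≋-trans (reflect-⊕ (scale a q) (+ 0 ∷ (p ⊗ q))) (⊕-cong (reflect-scale a q)
    (∷-cong refl (≋-trans (neg-cong (reflect-⊗ p q)) (-‿distribˡ-* (reflect p) (reflect q)))))

  Even Odd : ℤ[x] → Set
  Even p = reflect p ≋ p
  Odd  p = reflect p ≋ negP p

  Even-⊗ : ∀ {p q} → Even p → Even q → Even (p ⊗ q)
  Even-⊗ {p} {q} e f = ≋-trans (reflect-⊗ p q) (⊗-cong e f)

  neg-⊗-neg : ∀ p q → negP p ⊗ negP q ≋ p ⊗ q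
  neg-⊗-neg p q = ≋-trans (≋-sym (-‿distribˡ-* p (negP q)))
    (≋-trans (neg-cong (≋-sym (-‿distribʳ-* p q))) (-‿involutive (p ⊗ q)))

  Parity : ℤ[x] → Set
  Parity p = Even p ⊎ Odd p

  Parity-resp : ∀ {p q} → p ≋ q → Parity p → Parity q
  Parity-resp e (inj₁ h) = inj₁ (≋-trans (reflect-cong (≋-sym e)) (≋-trans h e))
  Parity-resp e (inj₂ h) = inj₂ (≋-trans (reflect-cong (≋-sym e)) (≋-trans h (neg-cong e)))

  Parity-one : Parity oneP
  Parity-one = inj₁ ≋-refl

  Parity-⊗ : ∀ {p q} → Parity p → Parity q → Parity (p ⊗ q)
  Parity-⊗ {p} {q} (inj₁ e) (inj₁ f) = inj₁ (Even-⊗ {p} {q} e f)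
  Parity-⊗ {p} {q} (inj₁ e) (inj₂ f) = inj₂ (≋-trans (reflect-⊗ p q) (≋-trans (⊗-cong e f) (≋-sym (-‿distribʳ-* p q))))
  Parity-⊗ {p} {q} (inj₂ e) (inj₁ f) = inj₂ (≋-trans (reflect-⊗ p q) (≋-trans (⊗-cong e f) (≋-sym (-‿distribˡ-* p q))))
  Parity-⊗ {p} {q} (inj₂ e) (inj₂ f) = inj₁ (≋-trans (reflect-⊗ p q) (≋-trans (⊗-cong e f) (neg-⊗-neg p q)))

  -- Reflection is multiplicative, so `reflect p` times q is p q up to sign, and the monic q can be
  -- cancelled.
  Parity-quotient : ∀ {d p q} → Monic d q → Parity q → Parity (p ⊗ q) → Parity p
  Parity-quotient {d} {p} {q} m (inj₁ f) (inj₁ h) = inj₁ (Monic-cancelʳ m (reflect p) p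
    (≋-trans (⊗-cong (≋-refl {reflect p}) (≋-sym f)) (≋-trans (≋-sym (reflect-⊗ p q)) h)))
  Parity-quotient {d} {p} {q} m (inj₁ f) (inj₂ h) = inj₂ (Monic-cancelʳ m (reflect p) (negP p)
    (≋-trans (⊗-cong (≋-refl {reflect p}) (≋-sym f)) (≋-trans (≋-sym (reflect-⊗ p q)) (≋-trans h (-‿distribˡ-* p q)))))
  Parity-quotient {d} {p} {q} m (inj₂ f) (inj₁ h) = inj₂ (Monic-cancelʳ m (reflect p) (negP p)
    (≋-trans (≋-sym (neg-⊗-neg (reflect p) q)) (≋-trans (⊗-cong (≋-refl {negP (reflect p)}) (≋-sym f))
     (≋-trans (≋-sym (-‿distribˡ-* (reflect p) (reflect q))) (≋-trans (neg-cong (≋-trans (≋-sym (reflect-⊗ p q)) h)) (-‿distribˡ-* p q))))))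
  Parity-quotient {d} {p} {q} m (inj₂ f) (inj₂ h) = inj₁ (Monic-cancelʳ m (reflect p) p
    (≋-trans (≋-sym (neg-⊗-neg (reflect p) q)) (≋-trans (⊗-cong (≋-refl {negP (reflect p)}) (≋-sym f))
     (≋-trans (≋-sym (-‿distribˡ-* (reflect p) (reflect q))) (≋-trans (neg-cong (≋-trans (≋-sym (reflect-⊗ p q)) h)) (-‿involutive (p ⊗ q)))))))

  X-Odd : Odd X
  X-Odd = coeffwise λ { zero → refl ; (suc zero) → refl ; (suc (suc i)) → refl }

  -- Multiplication by x changes parity, so consecutive polynomials have opposite parities; the
  -- induction has to carry both.
  F-Parity : ∀ n → (Even (F n) × Odd (F (suc n))) ⊎ (Odd (F n) × Even (F (suc n)))
  -- F_0 = 0 is both even and odd; it is entered as odd because F_1 = 1 is even.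
  F-Parity zero    = inj₂ (≋-refl , ≋-refl)
  F-Parity (suc n) with F-Parity n
  ... | inj₁ (e , o) = inj₂ (o , ≋-trans (reflect-⊕ (X ⊗ F (suc n)) (F n)) (⊕-cong
          (≋-trans (reflect-⊗ X (F (suc n))) (≋-trans (⊗-cong X-Odd o) (neg-⊗-neg X (F (suc n))))) e))
  ... | inj₂ (o , e) = inj₁ (e , ≋-trans (reflect-⊕ (X ⊗ F (suc n)) (F n)) (≋-trans (⊕-cong
          (≋-trans (reflect-⊗ X (F (suc n))) (≋-trans (⊗-cong X-Odd e) (≋-sym (-‿distribˡ-* X (F (suc n)))))) o)
          (-‿+-comm (X ⊗ F (suc n)) (F n))))

  parity-F : ∀ n → Parity (F n)
  parity-F n with F-Parity n
  ... | inj₁ (e , _) = inj₁ e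
  ... | inj₂ (o , _) = inj₂ o

  sign-odd : ∀ i → sign i ≡ (if odd i then - + 1 else + 1)
  sign-odd zero          = refl
  sign-odd (suc zero)    = refl
  sign-odd (suc (suc i)) = trans (ℤₚ.neg-involutive (sign i)) (sign-odd i)

  self-negative : ∀ x → x ≡ - x → x ≡ + 0
  self-negative (+ zero)  e = refl
  self-negative (+ suc n) ()
  self-negative -[1+ n ]  ()

  Even-coeff : ∀ {p} → Even p → ∀ i → odd i ≡ true → coeff p i ≡ + 0
  Even-coeff {p} e i o = self-negative (coeff p i) (trans (sym (coeff-≡ e i)) (trans (coeff-reflect p i)
    (trans (cong (_* coeff p i) (trans (sign-odd i) (cong (λ b → if b then - + 1 else + 1) o))) (ℤₚ.-1*i≡-i (coeff p i)))))

  Odd-coeff-0 : ∀ {p} → Odd p → coeff p 0 ≡ + 0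
  Odd-coeff-0 {p} e = self-negative (coeff p 0) (trans (sym (ℤₚ.*-identityˡ (coeff p 0)))
    (trans (sym (coeff-reflect p 0)) (trans (coeff-≡ e 0) (coeff-neg p 0))))

  odd-suc : ∀ n → odd (suc n) ≡ not (odd n)
  odd-suc zero          = refl
  odd-suc (suc zero)    = refl
  odd-suc (suc (suc n)) = odd-suc n

  odd-+ : ∀ m n → odd (m ℕ.+ n) ≡ odd m xor odd n
  odd-+ zero          n = refl
  odd-+ (suc zero)    n = odd-suc n
  odd-+ (suc (suc m)) n = odd-+ m n

  -- Inside the band the entry is the coefficient of index i with i + c = 2h + r, so i is odd
  -- whenever r and c differ in parity.
  band-odd : ∀ h p r c → Even p → odd r ≢ odd c → band (double h) p r c ≡ + 0
  band-odd h p r c e r≢c with r ≤ᵇ c in r≤c | (c ∸ r) ≤ᵇ double h in c∸r≤d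
  ... | false | _     = refl
  ... | true  | false = refl
  ... | true  | true  = Even-coeff {p} e i (decide (odd i) (odd r) (odd c) r≢c
        (trans (sym (odd-+ i c)) (trans (cong odd balance) (trans (odd-+ (double h) r) (cong (_xor odd r) (odd-pos false h))))))
    where
    i : ℕ
    i = double h ∸ (c ∸ r)
    balance : i ℕ.+ c ≡ double h ℕ.+ r
    balance = trans (cong (i ℕ.+_) (sym (ℕₚ.m∸n+n≡m (ℕₚ.≤ᵇ⇒≤ r c (subst T (sym r≤c) tt)))))
      (trans (sym (ℕₚ.+-assoc i (c ∸ r) r)) (cong (ℕ._+ r) (ℕₚ.m∸n+n≡m (ℕₚ.≤ᵇ⇒≤ (c ∸ r) (double h) (subst T (sym c∸r≤d) tt)))))
    decide : ∀ i r c → r ≢ c → i xor c ≡ r → i ≡ true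
    decide true  r     c     h e = refl
    decide false r     c     h e = contradiction (sym e) h

  odd-∸ : ∀ r h → double h ≤ r → odd (r ∸ double h) ≡ odd r
  odd-∸ r             zero    _             = refl
  odd-∸ (suc (suc r)) (suc h) (s≤s (s≤s p)) = odd-∸ r h p
  odd-∸ (suc zero)    (suc h) (s≤s ())

  sylvester-odd : ∀ a b f g → Even f → Even g → ∀ r c → odd r ≢ odd c → sylvester (double a) f (double b) g r c ≡ + 0
  sylvester-odd a b f g ef eg r c h with r <ᵇ double b in r<e
  ... | true  = band-odd a f r c ef h
  ... | false = band-odd b g (r ∸ double b) c eg (λ e → h (trans (sym (odd-∸ r b
                  (ℕₚ.≮⇒≥ (λ l → subst T r<e (ℕₚ.<⇒<ᵇ l))))) e))

  band-shift : ∀ d p r c → band d p (suc r) (suc c) ≡ band d p r c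
  band-shift d p zero    c = refl
  band-shift d p (suc r) c = refl

  -- The bands meet at the even row 2b, so rows 2r and 2r + 1 lie in the same band, where entries
  -- are constant along diagonals. This makes the two blocks of the checkerboard equal.
  sylvester-shift : ∀ a f b g r c → sylvester a f (double b) g (suc (double r)) (suc c) ≡ sylvester a f (double b) g (double r) c
  sylvester-shift a f b g r c = trans (cong (λ z → if z then band a f (suc (double r)) (suc c) else band (double b) g (suc (double r) ∸ double b) (suc c)) (same r b)) rest
    where
    same : ∀ r b → (suc (double r) <ᵇ double b) ≡ (double r <ᵇ double b)
    same r       zero    = refl
    same zero    (suc b) = refl
    same (suc r) (suc b) = same r b
    rest : (if double r <ᵇ double b then band a f (suc (double r)) (suc c) else band (double b) g (suc (double r) ∸ double b) (suc c))
           ≡ sylvester a f (double b) g (double r) c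
    rest with double r <ᵇ double b in r<e
    ... | true  = band-shift a f (double r) c
    ... | false = trans (cong (λ z → band (double b) g z (suc c)) (ℕₚ.+-∸-assoc 1 {double r} {double b}
                    (ℕₚ.≮⇒≥ (λ l → subst T r<e (ℕₚ.<⇒<ᵇ l)))))
                  (band-shift (double b) g (double r ∸ double b) c)

  double-+ : ∀ a b → double a ℕ.+ double b ≡ double (a ℕ.+ b)
  double-+ zero    b = refl
  double-+ (suc a) b = cong (λ z → suc (suc z)) (double-+ a b)

  det-sylvester-even : ∀ a b f g → Even f → Even g →
    ∃[ D ] (det (double a ℕ.+ double b) (sylvester (double a) f (double b) g) ≡ D * D)
  det-sylvester-even a b f g ef eg = det n (λ r c → S (double r) (double c)) ,
    trans (cong (λ k → det k S) (double-+ a b))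
    (trans (det-checkerboard n S (sylvester-odd a b f g ef eg))
    (cong (det n (λ r c → S (double r) (double c)) *_)
      (det-resp n (λ r c _ _ → sylvester-shift (double a) f b g r (double c)))))
    where
    n : ℕ
    n = a ℕ.+ b
    S : Matrix
    S = sylvester (double a) f (double b) g

  square-∣∣ : ∀ x → x * x ≡ + ∣ x * x ∣
  square-∣∣ (+ zero)  = refl
  square-∣∣ (+ suc n) = refl
  square-∣∣ -[1+ n ]  = refl

-- Degrees, parities, constant terms and comaximality of the fibotomic polynomials.

module FibotomicPolynomials where

  open Determinants
  open Polynomials
  open Homogenisation
  open FibonacciIdentities
  open TotientSum
  open Parities
  open import Data.Nat as ℕ using (ℕ; zero; suc; _≤_; _<_; z≤n; s≤s)
  import Data.Nat.Properties as ℕₚ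
  open import Data.Nat.Induction using (<-rec)
  open import Data.Nat.GCD using (gcd; gcd[m,n]∣m; gcd[m,n]∣n)
  open import Data.Nat.Divisibility using (_∣_; _∣?_; divides; ∣⇒≤; ∣-trans; ∣-refl; 1∣_; _∤_)
  open import Data.Integer as ℤ using (ℤ; +_; -[1+_]; _+_; _*_; ∣_∣)
  import Data.Integer.Properties as ℤₚ
  open import Data.Bool using (true; false)
  open import Data.List using (_∷_)
  open import Data.Product using (_×_; _,_; ∃-syntax; proj₁; proj₂)
  open import Data.Sum using (inj₁; inj₂)
  open import Relation.Nullary using (yes; no; Dec; _×-dec_; ¬?)
  open import Relation.Nullary.Negation using (contradiction)
  open import Relation.Binary.PropositionalEquality
  open import Algebra.Bundles using (CommutativeRing)
  open import Function using (_∘_; id)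
  open ZX using (coeff; _⊕_; _⊗_; oneP; X)

  module ProductP = RangeFold (CommutativeRing.*-commutativeMonoid polynomialRing)

  product-monic : ∀ k (e : ℕ → ℕ) (g : ℕ → ℤ[x]) → (∀ i → i < k → Monic (e i) (g i)) →
                  Monic (Sumℕ.fold< k e) (ProductP.fold< k g)
  product-monic zero    e g h = oneP-monic
  product-monic (suc k) e g h = Monic-⊗ (h 0 (s≤s z≤n)) (product-monic k (e ∘ suc) (g ∘ suc) (λ i p → h (suc i) (s≤s p)))

  product-induction : (P : ℤ[x] → Set) → P oneP → (∀ {p q} → P p → P q → P (p ⊗ q)) →
                      ∀ k g → (∀ i → i < k → P (g i)) → P (ProductP.fold< k g)
  product-induction P one mul zero    g h = one
  product-induction P one mul (suc k) g h = mul (h 0 (s≤s z≤n)) (product-induction P one mul k (g ∘ suc) (λ i p → h (suc i) (s≤s p)))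

  X-⊗ : ∀ p → X ⊗ p ≋ + 0 ∷ p
  X-⊗ p = ≋-trans (0∷-⊗ oneP p) (∷-cong refl (⊗-identityˡ p))

  coeff-F-step-0 : ∀ n → coeff (F (suc (suc n))) 0 ≡ coeff (F n) 0
  coeff-F-step-0 n = trans (coeff-⊕ (X ⊗ F (suc n)) (F n) 0)
    (trans (cong (λ z → z + coeff (F n) 0) (coeff-≡ (X-⊗ (F (suc n))) 0)) (ℤₚ.+-identityˡ _))

  coeff-F-step : ∀ n i → coeff (F (suc (suc n))) (suc i) ≡ coeff (F (suc n)) i + coeff (F n) (suc i)
  coeff-F-step n i = trans (coeff-⊕ (X ⊗ F (suc n)) (F n) (suc i))
    (cong (λ z → z + coeff (F n) (suc i)) (coeff-≡ (X-⊗ (F (suc n))) (suc i)))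

  F-degree : ∀ n → (∀ i → n ≤ i → coeff (F n) i ≡ + 0) × Monic n (F (suc n))
  F-degree zero    = (λ i _ → refl) , oneP-monic
  F-degree (suc n) with F-degree n
  ... | low , m = (λ i l → above m i l) , record
    { leading = trans (coeff-F-step n n) (cong₂ _+_ (leading m) (low (suc n) (ℕₚ.n≤1+n n)))
    ; above = λ { (suc i) (s≤s l) → trans (coeff-F-step n i) (cong₂ _+_ (above m i l) (low (suc i) (ℕₚ.<⇒≤ (ℕₚ.m<n⇒m<1+n l)))) }
    }

  F-monic : ∀ n → Monic n (F (suc n))
  F-monic n = proj₂ (F-degree n)

  -- Modulo x², F_(2k) is k x and F_(2k+1) is 1. These coefficients decide the sign of Ψ_n(0).
  F-coeff-even : ∀ k → coeff (F (double k)) 0 ≡ + 0 × coeff (F (double k)) 1 ≡ + k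
                     × coeff (F (suc (double k))) 0 ≡ + 1 × coeff (F (suc (double k))) 1 ≡ + 0
  F-coeff-even zero    = refl , refl , refl , refl
  F-coeff-even (suc k) with F-coeff-even k
  ... | a , b , c , d = trans (coeff-F-step-0 (double k)) a , e , trans (coeff-F-step-0 (suc (double k))) c ,
      trans (coeff-F-step (suc (double k)) 0) (cong₂ _+_ (trans (coeff-F-step-0 (double k)) a) d)
    where
    e : coeff (F (double (suc k))) 1 ≡ + suc k
    e = trans (coeff-F-step (double k) 0) (cong₂ _+_ c b)

  module Fibₓ = Fibonacci polynomialRing X

  F≡f : ∀ n → F n ≡ Fibₓ.f n
  F≡f zero          = refl
  F≡f (suc zero)    = refl
  F≡f (suc (suc n)) = cong₂ (λ p q → (X ⊗ p) ⊕ q) (F≡f (suc n)) (F≡f n)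

  F-gcd : ∀ m e → ∃[ a ] ∃[ b ] ((a ⊗ F (suc m)) ⊕ (b ⊗ F (suc e)) ≋ F (gcd (suc m) (suc e)))
  F-gcd m e = proj₁ bezout , proj₁ (proj₂ bezout) ,
    subst₂ (λ u v → (proj₁ bezout ⊗ u) ⊕ (proj₁ (proj₂ bezout) ⊗ v) ≋ F (gcd (suc m) (suc e))) (sym (F≡f (suc m))) (sym (F≡f (suc e)))
      (subst (λ u → (proj₁ bezout ⊗ Fibₓ.f (suc m)) ⊕ (proj₁ (proj₂ bezout) ⊗ Fibₓ.f (suc e)) ≋ u) (sym (F≡f (gcd (suc m) (suc e))))
        (proj₂ (proj₂ bezout)))
    where
    bezout : ∃[ a ] ∃[ b ] ((a ⊗ Fibₓ.f (suc m)) ⊕ (b ⊗ Fibₓ.f (suc e)) ≋ Fibₓ.f (gcd (suc m) (suc e)))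
    bezout = Fibₓ.f-gcd m e

  Positive : ℤ → Set
  Positive x = ∃[ k ] (x ≡ + suc k)

  Positive-* : ∀ {x y} → Positive x → Positive y → Positive (x * y)
  Positive-* (a , refl) (b , refl) = b ℕ.+ a ℕ.* suc b , refl

  Positive-quotient : ∀ x {y} → Positive y → Positive (x * y) → Positive x
  Positive-quotient (+ zero)  (b , refl) (k , ())
  Positive-quotient (+ suc a) _          _        = a , refl
  Positive-quotient -[1+ a ]  (b , refl) (k , ())

  Positive₀ : ℤ[x] → Set
  Positive₀ p = Positive (coeff p 0)

  Parity-Even : ∀ p → Parity p → Positive₀ p → Even p
  Parity-Even p (inj₁ e) _       = e
  Parity-Even p (inj₂ o) (k , e) = contradiction (trans (sym e) (Odd-coeff-0 {p} o)) (λ ())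

  -- The leading coefficient 1 cannot sit at an odd index, where an even polynomial has coefficient
  -- 0.
  Even-degree : ∀ p d → Even p → Monic d p → d ≡ double (half d)
  Even-degree p d e m = go (odd d) refl
    where
    go : ∀ b → odd d ≡ b → d ≡ double (half d)
    go false o = trans (sym (pos-odd-half d)) (cong (λ b → pos b (half d)) o)
    go true  o = contradiction (trans (sym (leading m)) (Even-coeff {p} e d o)) (λ ())

  module Fibotomic (Ψ : ℕ → ℤ[x]) (fibotomic : IsFibotomic Ψ) where
    open IsFibotomic fibotomic
    open ProductP using (fold<; fold<-cong; fold<-single; fold<-∙; fold<-truncate; fold<-punch; select; select-yes; select-no; select-split)

    Ψ-one≋ : Ψ 1 ≋ oneP
    Ψ-one≋ = coeffwise Ψ-one

    F-product : ∀ n → 1 ≤ n → F n ≋ fold< n (λ i → select (suc i ∣? n) (Ψ (suc i)))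
    F-product n h = ≋-trans (coeffwise (F-prod n h)) (ProductP.foldr-filter (_∣? n) suc id Ψ n)

    new? : ∀ d n e → Dec (e ∣ n × e ∤ d)
    new? d n e = (e ∣? n) ×-dec ¬? (e ∣? d)

    -- F n / F d
    cofactor : ℕ → ℕ → ℤ[x]
    cofactor d n = fold< n (λ i → select (new? d n (suc i)) (Ψ (suc i)))

    >⇒∤ : ∀ {d i} → 1 ≤ d → d ≤ i → suc i ∤ d
    >⇒∤ {suc d} _ l h = ℕₚ.<⇒≱ (s≤s l) (∣⇒≤ h)

    F-cofactor : ∀ d n → 1 ≤ d → 1 ≤ n → d ∣ n → F n ≋ F d ⊗ cofactor d n
    F-cofactor d n 1≤d 1≤n d∣n = ≋-trans (F-product n 1≤n)
      (≋-trans (fold<-cong n (λ i _ → select-split (suc i ∣? n) (suc i ∣? d) (new? d n (suc i))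
         (λ e∣d → ∣-trans e∣d d∣n) proj₁ _,_ proj₂))
      (≋-trans (fold<-∙ n (λ i → select (suc i ∣? d) (Ψ (suc i))) (λ i → select (new? d n (suc i)) (Ψ (suc i))))
      (⊗-cong (≋-trans
          (fold<-truncate {d} {n} (λ i → select (suc i ∣? d) (Ψ (suc i))) (divisor≤ 1≤n d∣n) (λ i l → select-no (suc i ∣? d) (>⇒∤ 1≤d l)))
          (≋-sym (F-product d 1≤d)))
        (≋-refl {cofactor d n}))))
      where
      divisor≤ : ∀ {d n} → 1 ≤ n → d ∣ n → d ≤ n
      divisor≤ {n = suc n} _ h = ∣⇒≤ h

    Factor : ℤ[x] → ℤ[x] → Set
    Factor p q = ∃[ r ] (q ≋ r ⊗ p)

    fold<-factor : ∀ n (g : ℕ → ℤ[x]) j {p} → j < n → g j ≋ p → Factor p (fold< n g)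
    fold<-factor (suc n) g j {p} l e = fold< n (g ∘ punch j) , ≋-trans (fold<-punch n j g l)
      (≋-trans (⊗-comm (g j) (fold< n (g ∘ punch j))) (⊗-cong (≋-refl {fold< n (g ∘ punch j)}) e))

    Ψ-factor-F : ∀ m n → 1 ≤ m → 1 ≤ n → m ∣ n → Factor (Ψ m) (F n)
    Ψ-factor-F (suc m) (suc n) _ 1≤n h with fold<-factor (suc n) (λ i → select (suc i ∣? suc n) (Ψ (suc i))) m (∣⇒≤ h) (select-yes (suc m ∣? suc n) h)
    ... | r , e = r , ≋-trans (F-product (suc n) 1≤n) e

    Ψ-factor-cofactor : ∀ d n → suc n ∤ d → Factor (Ψ (suc n)) (cofactor d (suc n))
    Ψ-factor-cofactor d n h = fold<-factor (suc n) (λ i → select (new? d (suc n) (suc i)) (Ψ (suc i))) n ℕₚ.≤-refl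
      (select-yes (new? d (suc n) (suc n)) (∣-refl , h))

    -- Belongs to n + 1: the product of Ψ_e over the proper divisors e of n + 1.
    proper : ℕ → ℤ[x]
    proper n = fold< n (λ i → select (suc i ∣? suc n) (Ψ (suc i)))

    punch-below : ∀ j i → i < j → punch j i ≡ i
    punch-below (suc j) zero    _       = refl
    punch-below (suc j) (suc i) (s≤s p) = cong suc (punch-below j i p)

    fold<-last : ∀ n g → fold< (suc n) g ≋ g n ⊗ fold< n g
    fold<-last n g = ≋-trans (fold<-punch n n g ℕₚ.≤-refl) (⊗-cong (≋-refl {g n})
      (fold<-cong n (λ i p → subst (λ z → g z ≋ g i) (sym (punch-below n i p)) ≋-refl)))

    F-proper : ∀ n → F (suc n) ≋ Ψ (suc n) ⊗ proper n
    F-proper n = ≋-trans (F-product (suc n) (s≤s z≤n)) (≋-trans (fold<-last n (λ i → select (suc i ∣? suc n) (Ψ (suc i))))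
      (⊗-cong (select-yes (suc n ∣? suc n) ∣-refl) (≋-refl {proper n})))

    -- The true degree, which differs from φ at 1 only: φ(1) = 1, but Ψ_1 is the constant 1.
    degree : ℕ → ℕ
    degree (suc zero) = 0
    degree n          = φ n

    -- The divisor sum of φ at n + 1, lowered by one on both sides at the divisor 1, to match deg
    -- F_(n+1) = n.
    degree-sum : ∀ n → degree (suc n) ℕ.+ Sumℕ.fold< n (λ i → Sumℕ.select (suc i ∣? suc n) (degree (suc i))) ≡ n
    degree-sum zero    = refl
    degree-sum (suc n) = ℕₚ.suc-injective (trans (sym (ℕₚ.+-suc (φ N) _)) (trans (cong (φ N ℕ.+_) first)
        (trans (sym last) (totient-sum N (s≤s z≤n)))))
      where
      N : ℕ
      N = suc (suc n)
      term : (ℕ → ℕ) → ℕ → ℕ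
      term w i = Sumℕ.select (suc i ∣? N) (w (suc i))
      first : suc (Sumℕ.fold< (suc n) (term degree)) ≡ Sumℕ.fold< (suc n) (term φ)
      first = trans (cong (λ z → suc (z ℕ.+ Sumℕ.fold< n (term degree ∘ suc))) (Sumℕ.select-yes (1 ∣? N) (1∣ N)))
                    (cong (ℕ._+ Sumℕ.fold< n (term φ ∘ suc)) (sym (Sumℕ.select-yes (1 ∣? N) {1} (1∣ N))))
      last : Sumℕ.fold< N (term φ) ≡ φ N ℕ.+ Sumℕ.fold< (suc n) (term φ)
      last = trans (Sumℕ.fold<-punch (suc n) (suc n) (term φ) ℕₚ.≤-refl) (cong₂ ℕ._+_ (Sumℕ.select-yes (N ∣? N) ∣-refl)
        (Sumℕ.fold<-cong (suc n) (λ i p → cong (term φ) (punch-below (suc n) i p))))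

    select-monic : ∀ {P : Set} (P? : Dec P) {d p} → Monic d p → Monic (Sumℕ.select P? d) (select P? p)
    select-monic (yes _) m = m
    select-monic (no _)  m = oneP-monic

    -- By strong induction `proper n` is monic of known degree, and Ψ is the quotient of the monic F
    -- by it; `degree-sum` makes the degrees agree.
    Ψ-monic′ : ∀ n → Monic (degree (suc n)) (Ψ (suc n))
    Ψ-monic′ = <-rec _ λ n ih →
      let Q-monic = product-monic n (λ i → Sumℕ.select (suc i ∣? suc n) (degree (suc i))) (λ i → select (suc i ∣? suc n) (Ψ (suc i)))
                      (λ i p → select-monic (suc i ∣? suc n) (ih p))
      in Monic-quotient {degree (suc n)} {_} {Ψ (suc n)} {proper n} Q-monic
           (subst (λ k → Monic k (Ψ (suc n) ⊗ proper n)) (sym (degree-sum n)) (Monic-resp (F-proper n) (F-monic n)))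

    Ψ-monic : ∀ n → 2 ≤ n → Monic (φ n) (Ψ n)
    Ψ-monic (suc zero)    (s≤s ())
    Ψ-monic (suc (suc n)) _ = Ψ-monic′ (suc n)

    select-induction : (P : ℤ[x] → Set) → P oneP → ∀ {Q : Set} (Q? : Dec Q) {p} → (Q → P p) → P (select Q? p)
    select-induction P one (yes q) h = h q
    select-induction P one (no _)  h = one

    proper-monic : ∀ n → ∃[ k ] Monic k (proper n)
    proper-monic n = _ , product-monic n (λ i → Sumℕ.select (suc i ∣? suc n) (degree (suc i))) (λ i → select (suc i ∣? suc n) (Ψ (suc i)))
                      (λ i _ → select-monic (suc i ∣? suc n) (Ψ-monic′ i))

    Ψ-parity : ∀ n → Parity (Ψ (suc n))
    Ψ-parity = <-rec _ λ n ih → Parity-quotient {_} {Ψ (suc n)} {proper n} (proj₂ (proper-monic n))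
      (product-induction Parity Parity-one Parity-⊗ n (λ i → select (suc i ∣? suc n) (Ψ (suc i)))
        (λ i p → select-induction Parity Parity-one (suc i ∣? suc n) (λ _ → ih p)))
      (Parity-resp (F-proper n) (parity-F (suc n)))

    Positive₀-⊗ : ∀ {p q} → Positive₀ p → Positive₀ q → Positive₀ (p ⊗ q)
    Positive₀-⊗ {p} {q} a b = subst Positive (sym (coeff-⊗-0 p q)) (Positive-* a b)

    F₂≋X : F 2 ≋ X
    F₂≋X = ≋-trans (⊕-identityʳ (X ⊗ oneP)) (⊗-identityʳ X)

    even∣ : ∀ k → 2 ∣ double k
    even∣ zero    = divides 0 refl
    even∣ (suc k) with even∣ k
    ... | divides q e = divides (suc q) (cong (λ z → suc (suc z)) e)

    -- Ψ_2 = x has constant term 0, so it is removed first by dividing F_N by F_g with g = gcd(2,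
    -- N). The quotient has constant term N/2 or 1, and its factors Ψ_e all have e ≥ 3; those with e
    -- < N are positive at 0 by induction.
    Ψ-positive₊₃ : ∀ n → Positive₀ (Ψ (suc (suc (suc n))))
    Ψ-positive₊₃ = <-rec _ step
      where
      module _ (n : ℕ) (ih : ∀ {i} → i < n → Positive₀ (Ψ (suc (suc (suc i))))) where
        N : ℕ
        N = suc (suc (suc n))
        -- g is the gcd of 2 and N.
        descend : ∀ g → g < N → 1 ≤ g → (2 ∣ N → 2 ∣ g) → Positive₀ (cofactor g N) → Positive₀ (Ψ N)
        descend g g<N 1≤g 2∣ h = Positive-quotient (coeff (Ψ N) 0) (rest-positive)
          (subst Positive (trans (coeff-≡ split 0) (coeff-⊗-0 (Ψ N) rest)) h)
          where
          factors : ℕ → ℤ[x]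
          factors i = select (new? g N (suc i)) (Ψ (suc i))
          rest : ℤ[x]
          rest = fold< (suc (suc n)) factors
          split : cofactor g N ≋ Ψ N ⊗ rest
          split = ≋-trans (fold<-last (suc (suc n)) factors)
            (⊗-cong (select-yes (new? g N N) (∣-refl , >⇒∤ 1≤g (ℕₚ.≤-pred g<N))) (≋-refl {rest}))
          positive : ∀ i → i < suc (suc n) → suc i ∣ N × suc i ∤ g → Positive₀ (Ψ (suc i))
          positive zero          p             (_ , h) = contradiction (1∣ g) h
          positive (suc zero)    p             (a , h) = contradiction (2∣ a) h
          positive (suc (suc i)) (s≤s (s≤s p)) _       = ih p
          rest-positive : Positive₀ rest
          rest-positive = product-induction Positive₀ (0 , refl) (λ {p} {q} → Positive₀-⊗ {p} {q}) (suc (suc n)) factors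
            (λ i p → select-induction Positive₀ (0 , refl) (new? g N (suc i)) (positive i p))
        halves : ∀ b k → pos b k ≡ N → Positive₀ (Ψ N)
        -- Here F_g = x, so the constant term of the cofactor is the coefficient of x in F_N, namely
        -- N/2.
        halves false (suc k) e = descend 2 (s≤s (s≤s (s≤s z≤n))) (s≤s z≤n) (λ _ → ∣-refl)
          (k , trans (sym (coeff-≡ (X-⊗ (cofactor 2 N)) 1))
                (trans (coeff-≡ (⊗-cong (≋-sym F₂≋X) (≋-refl {cofactor 2 N})) 1)
                (trans (sym (coeff-≡ (F-cofactor 2 N (s≤s z≤n) (s≤s z≤n) (subst (2 ∣_) e (even∣ (suc k)))) 1))
                (trans (cong (λ z → coeff (F z) 1) (sym e)) (proj₁ (proj₂ (F-coeff-even (suc k))))))))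
        halves true k e = descend 1 (s≤s (s≤s z≤n)) (s≤s z≤n)
          (λ 2∣N → contradiction (trans (sym (odd-pos true k)) (trans (cong odd e) (even-odd 2∣N))) (λ ()))
          (0 , trans (sym (coeff-≡ (⊗-identityˡ (cofactor 1 N)) 0))
                (trans (sym (coeff-≡ (F-cofactor 1 N (s≤s z≤n) (s≤s z≤n) (1∣ N)) 0))
                (trans (cong (λ z → coeff (F z) 0) (sym e)) (proj₁ (proj₂ (proj₂ (F-coeff-even k)))))))
          where
          even-odd : ∀ {n} → 2 ∣ n → odd n ≡ false
          even-odd (divides q refl) = go q
            where
            go : ∀ q → odd (q ℕ.* 2) ≡ false
            go zero    = refl
            go (suc q) = go q
        step : Positive₀ (Ψ N)
        step = halves (odd N) (half N) (pos-odd-half N)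

    Ψ-positive : ∀ n → 3 ≤ n → Positive₀ (Ψ n)
    Ψ-positive (suc (suc (suc n))) _ = Ψ-positive₊₃ n
    Ψ-positive (suc zero)       (s≤s ())
    Ψ-positive (suc (suc zero)) (s≤s (s≤s ()))

    Ψ-even : ∀ n → 3 ≤ n → Even (Ψ n)
    Ψ-even (suc (suc (suc n))) _ = Parity-Even (Ψ (suc (suc (suc n)))) (Ψ-parity (suc (suc n))) (Ψ-positive₊₃ n)
    Ψ-even (suc zero)       (s≤s ())
    Ψ-even (suc (suc zero)) (s≤s (s≤s ()))

    φ-even : ∀ n → 3 ≤ n → φ n ≡ double (half (φ n))
    φ-even n h = Even-degree (Ψ n) (φ n) (Ψ-even n h) (Ψ-monic n (ℕₚ.≤-trans (s≤s (s≤s z≤n)) h))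

    -- After division by F_g the two cofactors are comaximal. Ψ of the first index still divides its
    -- cofactor, since that index dividing g would make it divide the other index; the same holds
    -- with the roles exchanged.
    Ψ-comaximal-by : ∀ m e g → g ∣ suc m → g ∣ suc e →
                     (∃[ a ] ∃[ b ] ((a ⊗ F (suc m)) ⊕ (b ⊗ F (suc e)) ≋ F g)) →
                     suc m ∤ suc e → suc e ∤ suc m → Fibₓ.Comaximal (Ψ (suc m)) (Ψ (suc e))
    Ψ-comaximal-by m e zero    (divides q h) _ _ _ _ = contradiction (trans h (ℕₚ.*-zeroʳ q)) (λ ())
    Ψ-comaximal-by m e (suc g) g∣m g∣e (a , b , bezout) m∤e e∤m
      with Ψ-factor-cofactor (suc g) m (λ h → m∤e (∣-trans h g∣e)) | Ψ-factor-cofactor (suc g) e (λ h → e∤m (∣-trans h g∣m))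
    ... | r , er | s , es = a ⊗ r , b ⊗ s , ≋-trans
        (⊕-cong (≋-trans (⊗-assoc a r (Ψ (suc m))) (⊗-cong (≋-refl {a}) (≋-sym er)))
                (≋-trans (⊗-assoc b s (Ψ (suc e))) (⊗-cong (≋-refl {b}) (≋-sym es))))
        (Monic-cancelʳ (F-monic g) ((a ⊗ Qm) ⊕ (b ⊗ Qe)) oneP
          (≋-trans (⊗-distribʳ (F (suc g)) (a ⊗ Qm) (b ⊗ Qe))
          (≋-trans (⊕-cong (collect a Qm (F-cofactor (suc g) (suc m) (s≤s z≤n) (s≤s z≤n) g∣m))
                           (collect b Qe (F-cofactor (suc g) (suc e) (s≤s z≤n) (s≤s z≤n) g∣e)))
          (≋-trans bezout (≋-sym (⊗-identityˡ (F (suc g))))))))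
      where
      Qm Qe : ℤ[x]
      Qm = cofactor (suc g) (suc m)
      Qe = cofactor (suc g) (suc e)
      collect : ∀ a Q {G} → G ≋ F (suc g) ⊗ Q → (a ⊗ Q) ⊗ F (suc g) ≋ a ⊗ G
      collect a Q h = ≋-trans (⊗-assoc a Q (F (suc g))) (⊗-cong (≋-refl {a}) (≋-trans (⊗-comm Q (F (suc g))) (≋-sym h)))

    Ψ-comaximal : ∀ m e → 1 ≤ m → 1 ≤ e → m ∤ e → e ∤ m → Fibₓ.Comaximal (Ψ m) (Ψ e)
    Ψ-comaximal (suc m) (suc e) _ _ = Ψ-comaximal-by m e (gcd (suc m) (suc e)) (gcd[m,n]∣m (suc m) (suc e)) (gcd[m,n]∣n (suc m) (suc e)) (F-gcd m e)

-- Evaluation of the norms, their sign, and the resultant.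

module Resultants where

  open Determinants
  open Polynomials
  open Homogenisation
  open Norms
  open Parities
  open FibotomicPolynomials
  open import Data.Nat as ℕ using (ℕ; zero; suc; _≤_; _<_; z≤n; s≤s)
  import Data.Nat.Properties as ℕₚ
  open import Data.Nat.Induction using (<-rec)
  open import Data.Nat.Divisibility using (_∣_; _∣?_; divides; ∣⇒≤; ∣-trans; ∣-refl; 1∣_; _∤_; n∣m*n; m∣m*n; *-cancelʳ-∣; *-monoˡ-∣; ∣1⇒≡1; ∣n⇒∣m*n)
  open import Data.Nat.Primality using (Prime; prime⇒nonZero; prime⇒nonTrivial; prime⇒irreducible)
  open import Data.Nat.Primality.Factorisation using (factorise)
  open import Data.Nat.Coprimality using (Coprime; coprime-divisor)
  open import Data.Integer as ℤ using (ℤ; +_; _+_; _*_; ∣_∣)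
  import Data.Integer.Properties as ℤₚ
  open import Data.List using ([]; _∷_)
  open import Data.List.Relation.Unary.All using ([]; _∷_)
  open import Data.Product using (_×_; _,_; ∃-syntax; proj₁; proj₂)
  open import Data.Sum using (_⊎_; inj₁; inj₂)
  open import Relation.Nullary using (¬_; yes; no; Dec; _×-dec_; ¬?)
  open import Relation.Nullary.Negation using (contradiction)
  open import Relation.Binary.PropositionalEquality
  open import Function using (_∘_)
  open ZX using (coeff; _⊕_; _⊗_; constP; oneP; X; monomial)

  prime-divisor : ∀ k → 2 ≤ k → ∃[ p ] (Prime p × p ∣ k)
  prime-divisor (suc zero) (s≤s ())
  prime-divisor k@(suc (suc _)) _ with factorise k
  ... | record { factors = [] ; isFactorisation = () }
  ... | record { factors = p ∷ ps ; isFactorisation = e ; factorsPrime = pr ∷ _ } =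
    p , pr , subst (p ∣_) (sym e) (m∣m*n _)

  prime-power-part : ∀ {p} → Prime p → ∀ k → 1 ≤ k → ∃[ α ] ∃[ b ] (k ≡ p ℕ.^ α ℕ.* b × p ∤ b)
  prime-power-part {p} pr = <-rec _ step
    where
    p>1 : 1 < p
    p>1 = ℕ.nonTrivial⇒n>1 p {{prime⇒nonTrivial pr}}
    step : ∀ k → (∀ {i} → i < k → 1 ≤ i → ∃[ α ] ∃[ b ] (i ≡ p ℕ.^ α ℕ.* b × p ∤ b)) →
           1 ≤ k → ∃[ α ] ∃[ b ] (k ≡ p ℕ.^ α ℕ.* b × p ∤ b)
    step k ih 1≤k with p ∣? k
    ... | no p∤k = 0 , k , sym (ℕₚ.*-identityˡ k) , p∤k
    ... | yes (divides zero e) = contradiction (subst (1 ≤_) e 1≤k) (λ ())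
    ... | yes (divides q@(suc _) e) with ih (subst (q <_) (sym e) (ℕₚ.m<m*n q p p>1)) (s≤s z≤n)
    ...   | α , b , e′ , p∤b = suc α , b , trans e (trans (ℕₚ.*-comm q p) (trans (cong (p ℕ.*_) e′) (sym (ℕₚ.*-assoc p (p ℕ.^ α) b)))) , p∤b

  prime-power-coprime : ∀ {p b} → Prime p → p ∤ b → ∀ α → Coprime (p ℕ.^ α) b
  prime-power-coprime pr p∤b zero    (d∣1 , _) = ∣1⇒≡1 d∣1
  prime-power-coprime {p} {b} pr p∤b (suc α) {d} (d∣pᵅ , d∣b) =
    prime-power-coprime pr p∤b α (coprime-divisor {d} {p} {p ℕ.^ α} coprime d∣pᵅ , d∣b)
    where
    coprime : Coprime d p
    coprime (e∣d , e∣p) with prime⇒irreducible pr e∣p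
    ... | inj₁ e≡1 = e≡1
    ... | inj₂ refl = contradiction (∣-trans e∣d d∣b) p∤b

  -- Write p^(α+1) = c j. If p divides c, one factor p cancels and j divides p^α; otherwise c
  -- divides p^(α+1) and is coprime to it, so c = 1.
  prime-power-divisor : ∀ {p} → Prime p → ∀ α j → j ∣ p ℕ.^ suc α → ¬ (j ∣ p ℕ.^ α) → j ≡ p ℕ.^ suc α
  prime-power-divisor {p} pr α j (divides c e) j∤pᵅ with p ∣? c
  ... | no p∤c = trans (sym (ℕₚ.*-identityˡ j)) (trans (cong (ℕ._* j) (sym c≡1)) (sym e))
    where
    c≡1 : c ≡ 1
    c≡1 = prime-power-coprime pr p∤c (suc α) (divides j (trans e (ℕₚ.*-comm c j)) , ∣-refl)
  ... | yes (divides c′ e′) = contradiction (divides c′ (ℕₚ.*-cancelˡ-≡ (p ℕ.^ α) (c′ ℕ.* j) p {{prime⇒nonZero pr}}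
      (trans e (trans (cong (ℕ._* j) (trans e′ (ℕₚ.*-comm c′ p))) (ℕₚ.*-assoc p c′ j))))) j∤pᵅ

  abs-^ : ∀ a k → ∣ (+ a) ℤ.^ k ∣ ≡ a ℕ.^ k
  abs-^ a zero    = refl
  abs-^ a (suc k) = trans (ℤₚ.abs-* (+ a) ((+ a) ℤ.^ k)) (cong (a ℕ.*_) (abs-^ a k))

  positive-^ : ∀ k n → (+ suc k) ℤ.^ n ≡ + ∣ (+ suc k) ℤ.^ n ∣
  positive-^ k n = trans (pow n) (cong +_ (sym (abs-^ (suc k) n)))
    where
    pow : ∀ n → (+ suc k) ℤ.^ n ≡ + (suc k ℕ.^ n)
    pow zero    = refl
    pow (suc n) = trans (cong (+ suc k *_) (pow n)) (sym (ℤₚ.pos-* (suc k) (suc k ℕ.^ n)))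

  module Productℕ = RangeFold ℕₚ.*-1-commutativeMonoid

  ν≋constP : ∀ k → Fibₓ.ν k ≋ constP (+ k)
  ν≋constP zero    = ≋-sym 0∷[]
  ν≋constP (suc k) = ⊕-cong {oneP} ≋-refl (ν≋constP k)

  module Weight (Ψ : ℕ → ℤ[x]) (fibotomic : IsFibotomic Ψ) (m : ℕ) (2≤m : 2 ≤ m) (d′ : ℕ) (φ-suc : φ m ≡ suc d′) where
    open Fibotomic Ψ fibotomic

    open Modulo d′ (Ψ m) (subst (λ k → Monic k (Ψ m)) φ-suc (Ψ-monic m 2≤m))

    1≤m : 1 ≤ m
    1≤m = ℕₚ.<⇒≤ 2≤m

    instance
      m-nonZero : ℕ.NonZero m
      m-nonZero = ℕ.>-nonZero 1≤m

    -- |Res(Ψ m, p)|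
    weight : ℤ[x] → ℕ
    weight p = ∣ norm p ∣

    weight-cong : ∀ {p q} → p ≋ q → weight p ≡ weight q
    weight-cong e = cong ∣_∣ (norm-cong e)

    weight-⊗ : ∀ p q → weight (p ⊗ q) ≡ weight p ℕ.* weight q
    weight-⊗ p q = trans (cong ∣_∣ (norm-⊗ p q)) (ℤₚ.abs-* (norm p) (norm q))

    weight-mod : ∀ p q → weight ((p ⊗ Ψ m) ⊕ q) ≡ weight q
    weight-mod p q = cong ∣_∣ (norm-mod p q)

    weight-const : ∀ a → weight (constP (+ a)) ≡ a ℕ.^ d
    weight-const a = trans (cong ∣_∣ (norm-const (+ a))) (abs-^ a d)

    weight-one : weight oneP ≡ 1
    weight-one = trans (weight-const 1) (ℕₚ.^-zeroˡ d)

    -- Modulo Ψ_m the relation reads v p = 1, so two natural numbers have product 1.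
    weight-unit : ∀ {p} → Fibₓ.Comaximal (Ψ m) p → weight p ≡ 1
    weight-unit {p} (u , v , e) = ℕₚ.m*n≡1⇒n≡1 (weight v) (weight p)
      (trans (sym (weight-⊗ v p)) (trans (sym (weight-mod u (v ⊗ p))) (trans (weight-cong e) weight-one)))

    weight-select : ∀ {P : Set} (P? : Dec P) p → weight (ProductP.select P? p) ≡ Productℕ.select P? (weight p)
    weight-select (yes _) p = refl
    weight-select (no _)  p = weight-one

    weight-fold : ∀ k g → weight (ProductP.fold< k g) ≡ Productℕ.fold< k (weight ∘ g)
    weight-fold zero    g = weight-one
    weight-fold (suc k) g = trans (weight-⊗ (g 0) (ProductP.fold< k (g ∘ suc))) (cong (weight (g 0) ℕ.*_) (weight-fold k (g ∘ suc)))

    w : ℕ → ℕ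
    w e = weight (Ψ e)

    weight-cofactor : ∀ D n → weight (cofactor D n) ≡ Productℕ.fold< n (λ i → Productℕ.select (new? D n (suc i)) (w (suc i)))
    weight-cofactor D n = trans (weight-fold n (λ i → ProductP.select (new? D n (suc i)) (Ψ (suc i))))
      (Productℕ.fold<-cong n (λ i _ → weight-select (new? D n (suc i)) (Ψ (suc i))))

    weight-power : ∀ q k → weight q ≡ 1 → weight (q Fibₓ.^^ k) ≡ 1
    weight-power q zero    h = weight-one
    weight-power q (suc k) h = trans (weight-⊗ (q Fibₓ.^^ k) q) (cong₂ ℕ._*_ (weight-power q k h) h)

    -- Two descriptions of one quotient of Fibonacci polynomials: as a product of Ψ_e it separates
    -- the unknown weights, and as the Fibonacci quotient its total weight can be computed.
    cofactor-quotient : ∀ D k → cofactor (suc D) (suc k ℕ.* suc D) ≋ Fibₓ.quotient D (suc k)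
    cofactor-quotient D k = Monic-cancelʳ (F-monic D) (cofactor (suc D) n) (Fibₓ.quotient D (suc k))
      (≋-trans (⊗-comm (cofactor (suc D) n) (F (suc D)))
      (≋-trans (≋-sym (F-cofactor (suc D) n (s≤s z≤n) (s≤s z≤n) (n∣m*n (suc k))))
      (subst₂ (λ p q → p ≋ Fibₓ.quotient D (suc k) ⊗ q) (sym (F≡f n)) (sym (F≡f (suc D))) (Fibₓ.f-* D (suc k)))))
      where
      n : ℕ
      n = suc k ℕ.* suc D

    weight-quotient : ∀ D k {Q} → Factor (Ψ m) (F (suc D)) →
                      (∃[ h ] (Q ≋ (h ⊗ F (suc D)) ⊕ (Fibₓ.ν (suc k) ⊗ (F D Fibₓ.^^ k)))) →
                      Fibₓ.Comaximal (F D) (F (suc D)) → weight Q ≡ suc k ℕ.^ d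
    weight-quotient D k {Q} (r , F≋) (h , Q≋) (u , v , one) = trans (weight-cong reduced) (trans (weight-mod (h ⊗ r) main)
        (trans (weight-⊗ (Fibₓ.ν (suc k)) (F D Fibₓ.^^ k))
        (trans (cong₂ ℕ._*_ (trans (weight-cong (ν≋constP (suc k))) (weight-const (suc k))) (weight-power (F D) k unit))
          (ℕₚ.*-identityʳ (suc k ℕ.^ d)))))
      where
      main : ℤ[x]
      main = Fibₓ.ν (suc k) ⊗ (F D Fibₓ.^^ k)
      multiple : ∀ c → c ⊗ F (suc D) ≋ (c ⊗ r) ⊗ Ψ m
      multiple c = ≋-trans (⊗-cong (≋-refl {c}) F≋) (≋-sym (⊗-assoc c r (Ψ m)))
      reduced : Q ≋ ((h ⊗ r) ⊗ Ψ m) ⊕ main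
      reduced = ≋-trans Q≋ (⊕-cong (multiple h) (≋-refl {main}))
      -- F_D is invertible modulo F_(D+1) by comaximality of neighbours, hence also modulo its
      -- factor Ψ_m.
      unit : weight (F D) ≡ 1
      unit = weight-unit (v ⊗ r , u , ≋-trans (⊕-cong (≋-sym (multiple v)) (≋-refl {u ⊗ F D}))
        (≋-trans (⊕-comm (v ⊗ F (suc D)) (u ⊗ F D)) one))

    weight-cofactor-multiple : ∀ D k → m ∣ suc D → weight (cofactor (suc D) (suc k ℕ.* suc D)) ≡ suc k ℕ.^ d
    weight-cofactor-multiple D k m∣D = trans (weight-cong (cofactor-quotient D k))
      (weight-quotient D k (Ψ-factor-F m (suc D) 1≤m (s≤s z≤n) m∣D)
        (subst₂ (λ p q → ∃[ h ] (Fibₓ.quotient D (suc k) ≋ (h ⊗ p) ⊕ (Fibₓ.ν (suc k) ⊗ (q Fibₓ.^^ k))))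
          (sym (F≡f (suc D))) (sym (F≡f D)) (Fibₓ.quotient-mod D k))
        (subst₂ Fibₓ.Comaximal (sym (F≡f D)) (sym (F≡f (suc D))) (Fibₓ.f-comaximal D)))

    product-new : ∀ D k → 1 ≤ D → 1 ≤ k → m ∣ D →
                  Productℕ.fold< (k ℕ.* D) (λ i → Productℕ.select (new? D (k ℕ.* D) (suc i)) (w (suc i))) ≡ k ℕ.^ d
    product-new (suc D) (suc k) _ _ h = trans (sym (weight-cofactor (suc D) (suc k ℕ.* suc D))) (weight-cofactor-multiple D k h)

    w-incomparable : ∀ e → 1 ≤ e → m ∤ e → e ∤ m → w e ≡ 1
    w-incomparable e 1≤e m∤e e∤m = weight-unit (Ψ-comaximal m e 1≤m 1≤e m∤e e∤m)

    -- Every new divisor e of p D over D other than p D is incomparable with m: m ∣ e would force e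
    -- = p D, and e ∣ m would make e a divisor of D.
    w-prime-power : ∀ p α → Prime p → w (m ℕ.* p ℕ.^ suc α) ≡ p ℕ.^ d
    w-prime-power p α pr = go (p ℕ.* D) refl
      where
      D : ℕ
      D = m ℕ.* p ℕ.^ α
      p^α≢0 : ∀ α → ℕ.NonZero (p ℕ.^ α)
      p^α≢0 α = ℕₚ.m^n≢0 p α {{prime⇒nonZero pr}}
      1≤D : 1 ≤ D
      1≤D = ℕ.>-nonZero⁻¹ D {{ℕₚ.m*n≢0 m (p ℕ.^ α) {{m-nonZero}} {{p^α≢0 α}}}}
      p>1 : 1 < p
      p>1 = ℕ.nonTrivial⇒n>1 p {{prime⇒nonTrivial pr}}
      pD≡ : p ℕ.* D ≡ m ℕ.* p ℕ.^ suc α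
      pD≡ = trans (sym (ℕₚ.*-assoc p m _)) (trans (cong (ℕ._* p ℕ.^ α) (ℕₚ.*-comm p m)) (ℕₚ.*-assoc m p _))
      D<pD : D < p ℕ.* D
      D<pD = subst (D <_) (ℕₚ.*-comm D p) (ℕₚ.m<m*n D p {{ℕ.>-nonZero 1≤D}} p>1)
      only-top : ∀ e → e ∣ p ℕ.* D → e ∤ D → m ∣ e → e ≡ p ℕ.* D
      only-top e e∣ e∤ (divides j refl) = trans (ℕₚ.*-comm j m) (trans (cong (m ℕ.*_) (prime-power-divisor pr α j
          (*-cancelʳ-∣ m (subst (j ℕ.* m ∣_) (trans pD≡ (ℕₚ.*-comm m (p ℕ.^ suc α))) e∣))
          (λ h → e∤ (subst (j ℕ.* m ∣_) (ℕₚ.*-comm (p ℕ.^ α) m) (*-monoˡ-∣ m h))))) (sym pD≡))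
      -- The divisor e has index e - 1, so p D is matched as a successor to name the index of the
      -- top term.
      go : ∀ n → n ≡ p ℕ.* D → w (m ℕ.* p ℕ.^ suc α) ≡ p ℕ.^ d
      go zero    e = contradiction (subst (D <_) (sym e) D<pD) (λ ())
      go (suc n) e = trans (cong w (trans (sym pD≡) (sym e))) (trans (sym top) (trans (sym (Productℕ.fold<-single (p ℕ.* D) n n< others))
          (product-new D p 1≤D (ℕₚ.<⇒≤ p>1) (m∣m*n (p ℕ.^ α)))))
        where
        term : ℕ → ℕ
        term i = Productℕ.select (new? D (p ℕ.* D) (suc i)) (w (suc i))
        n< : n < p ℕ.* D
        n< = ℕₚ.≤-reflexive e
        top : term n ≡ w (suc n)
        top = Productℕ.select-yes (new? D (p ℕ.* D) (suc n))
          (subst (_∣ p ℕ.* D) (sym e) ∣-refl , >⇒∤ 1≤D (ℕₚ.≤-pred (subst (D <_) (sym e) D<pD)))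
        others : ∀ i → i < p ℕ.* D → i ≢ n → term i ≡ 1
        others i _ i≢n = Productℕ.select-trivial (new? D (p ℕ.* D) (suc i)) λ { (i∣ , i∤) → w-incomparable (suc i) (s≤s z≤n)
          (λ h → i≢n (ℕₚ.suc-injective (trans (only-top (suc i) i∣ i∤ h) (sym e))))
          (λ h → i∤ (∣-trans h (m∣m*n (p ℕ.^ α)))) }

    -- With a, b coprime the new divisors of bm over m are also new for abm over am,
    -- and both products of weights equal b^φ(m), so every other weight is 1.
    w-coprime-product : ∀ a b → 1 < a → 1 < b → Coprime a b → w (a ℕ.* b ℕ.* m) ≡ 1
    w-coprime-product a b 1<a 1<b coprime = go (b ℕ.* (a ℕ.* m)) refl
      where
      N am bm : ℕ
      N = b ℕ.* (a ℕ.* m)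
      am = a ℕ.* m
      bm = b ℕ.* m
      N≡ : N ≡ a ℕ.* b ℕ.* m
      N≡ = trans (sym (ℕₚ.*-assoc b a m)) (cong (ℕ._* m) (ℕₚ.*-comm b a))
      N≡′ : N ≡ a ℕ.* bm
      N≡′ = trans N≡ (ℕₚ.*-assoc a b m)
      1≤am : 1 ≤ am
      1≤am = ℕₚ.*-mono-≤ {1} {a} {1} {m} (ℕₚ.<⇒≤ 1<a) 1≤m
      1≤bm : 1 ≤ bm
      1≤bm = ℕₚ.*-mono-≤ {1} {b} {1} {m} (ℕₚ.<⇒≤ 1<b) 1≤m
      am<N : am < N
      am<N = subst (am <_) (ℕₚ.*-comm am b) (ℕₚ.m<m*n am b {{ℕ.>-nonZero 1≤am}} 1<b)
      bm<N : bm < N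
      bm<N = subst (bm <_) (trans (ℕₚ.*-comm bm a) (sym N≡′)) (ℕₚ.m<m*n bm a {{ℕ.>-nonZero 1≤bm}} 1<a)
      lower? : ∀ e → Dec (e ∣ bm × e ∤ m)
      lower? = new? m bm
      rest? : ∀ e → Dec ((e ∣ N × e ∤ am) × ¬ (e ∣ bm × e ∤ m))
      rest? e = new? am N e ×-dec ¬? (lower? e)
      lower⇒upper : ∀ {e} → e ∣ bm × e ∤ m → e ∣ N × e ∤ am
      lower⇒upper {e} (e∣bm , e∤m) = subst (e ∣_) (sym N≡′) (∣n⇒∣m*n a e∣bm) , λ e∣am → e∤m (common e∣am e∣bm)
        where
        -- A common divisor of a m and b m divides gcd(m a, m b) = m gcd(a, b) = m.
        common : e ∣ am → e ∣ bm → e ∣ m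
        common e∣am e∣bm = coprime-combination a b m e coprime e∣am e∣bm
          where
          open import Data.Nat.GCD using (gcd-greatest; c*gcd[m,n]≡gcd[cm,cn])
          open import Data.Nat.Coprimality using (coprime⇒gcd≡1)
          coprime-combination : ∀ a b m e → Coprime a b → e ∣ a ℕ.* m → e ∣ b ℕ.* m → e ∣ m
          coprime-combination a b m e c h k = subst (e ∣_)
            (trans (sym (c*gcd[m,n]≡gcd[cm,cn] m a b)) (trans (cong (m ℕ.*_) (coprime⇒gcd≡1 c)) (ℕₚ.*-identityʳ m)))
            (gcd-greatest (subst (e ∣_) (ℕₚ.*-comm a m) h) (subst (e ∣_) (ℕₚ.*-comm b m) k))
      upper lower rest : ℕ → ℕ
      upper i = Productℕ.select (new? am N (suc i)) (w (suc i))
      lower i = Productℕ.select (lower? (suc i)) (w (suc i))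
      rest i  = Productℕ.select (rest? (suc i)) (w (suc i))
      Πupper : Productℕ.fold< N upper ≡ b ℕ.^ d
      Πupper = product-new am b 1≤am (ℕₚ.<⇒≤ 1<b) (n∣m*n a)
      Πlower : Productℕ.fold< N lower ≡ b ℕ.^ d
      Πlower = trans (Productℕ.fold<-truncate {bm} {N} lower (ℕₚ.<⇒≤ bm<N)
          (λ i l → Productℕ.select-no (lower? (suc i)) (λ h → >⇒∤ 1≤bm l (proj₁ h))))
        (product-new m b 1≤m (ℕₚ.<⇒≤ 1<b) ∣-refl)
      Πrest : Productℕ.fold< N rest ≡ 1
      Πrest = ℕₚ.*-cancelˡ-≡ (Productℕ.fold< N rest) 1 (b ℕ.^ d) {{ℕₚ.m^n≢0 b d {{ℕ.>-nonZero (ℕₚ.<⇒≤ 1<b)}}}}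
        (trans (cong (ℕ._* Productℕ.fold< N rest) (sym Πlower)) (trans (sym (Productℕ.fold<-∙ N lower rest))
          (trans (Productℕ.fold<-cong N (λ i _ → sym (Productℕ.select-split (new? am N (suc i)) (lower? (suc i)) (rest? (suc i))
              lower⇒upper proj₁ _,_ proj₂)))
            (trans Πupper (sym (ℕₚ.*-identityʳ (b ℕ.^ d)))))))
      go : ∀ n → n ≡ N → w (a ℕ.* b ℕ.* m) ≡ 1
      go zero    e = contradiction (subst (am <_) (sym e) am<N) (λ ())
      -- The top divisor N is new for the first comparison only, so its weight is one factor of the
      -- remaining product, which is 1.
      go (suc n) e = trans (cong w (trans (sym N≡) (sym e))) (trans (sym top)
          (ℕₚ.m*n≡1⇒m≡1 (rest n) _ (trans (sym (Productℕ.fold<-punch n n rest ℕₚ.≤-refl))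
            (trans (cong (λ z → Productℕ.fold< z rest) e) Πrest))))
        where
        top : rest n ≡ w (suc n)
        top = Productℕ.select-yes (rest? (suc n))
          ( (subst (_∣ N) (sym e) ∣-refl , >⇒∤ 1≤am (ℕₚ.≤-pred (subst (am <_) (sym e) am<N)))
          , λ h → >⇒∤ 1≤bm (ℕₚ.≤-pred (subst (bm <_) (sym e) bm<N)) (proj₁ h))

    -- When n = k m with k ≥ 2, the full power of one prime is split off k. If nothing else is left,
    -- k is a prime power, which is excluded; otherwise k is a product of two coprime factors
    -- greater than 1.
    w-otherwise : ∀ n → m < n → ¬ (∃[ p ] ∃[ α ] (Prime p × 1 ≤ α × n ≡ m ℕ.* p ℕ.^ α)) → w n ≡ 1
    w-otherwise n m<n h with m ∣? n
    ... | no m∤n = w-incomparable n (ℕₚ.≤-trans 1≤m (ℕₚ.<⇒≤ m<n)) m∤n (λ n∣m → ℕₚ.<⇒≱ m<n (∣⇒≤ n∣m))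
    ... | yes (divides zero e) = contradiction (subst (m <_) e m<n) ℕₚ.n≮0
    ... | yes (divides (suc zero) e) = contradiction (trans e (ℕₚ.*-identityˡ m)) (λ x → ℕₚ.<⇒≢ m<n (sym x))
    ... | yes (divides k@(suc (suc _)) e) with prime-divisor k (s≤s (s≤s z≤n))
    ...   | p , pr , p∣k with prime-power-part pr k (s≤s z≤n)
    ...     | zero  , b , k≡ , p∤b = contradiction (subst (p ∣_) (trans k≡ (ℕₚ.*-identityˡ b)) p∣k) p∤b
    ...     | suc α , zero , k≡ , p∤b = contradiction (trans k≡ (ℕₚ.*-zeroʳ (p ℕ.^ suc α))) (λ ())
    ...     | suc α , suc zero , k≡ , p∤b = contradiction
                (p , suc α , pr , s≤s z≤n , trans e (trans (ℕₚ.*-comm k m) (cong (m ℕ.*_) (trans k≡ (ℕₚ.*-identityʳ _))))) h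
    ...     | suc α , b@(suc (suc _)) , k≡ , p∤b = trans (cong w (trans e (cong (ℕ._* m) k≡)))
                (w-coprime-product (p ℕ.^ suc α) b pᵅ>1 (s≤s (s≤s z≤n)) (prime-power-coprime pr p∤b (suc α)))
      where
      p>1 : 1 < p
      p>1 = ℕ.nonTrivial⇒n>1 p {{prime⇒nonTrivial pr}}
      pᵅ>1 : 1 < p ℕ.^ suc α
      pᵅ>1 = ℕₚ.<-≤-trans p>1 (ℕₚ.m≤m*n p (p ℕ.^ α) {{ℕₚ.m^n≢0 p α {{prime⇒nonZero pr}}}})

    resultantℤ : ℕ → ℤ
    resultantℤ n = det (φ m ℕ.+ φ n) (sylvester (φ m) (Ψ m) (φ n) (Ψ n))

    resultant-norm : ∀ n → 2 ≤ n → resultantℤ n ≡ norm (Ψ n)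
    resultant-norm n h = trans (cong (λ k → det (k ℕ.+ φ n) (sylvester k (Ψ m) (φ n) (Ψ n))) φ-suc)
      (det-sylvester (φ n) (Ψ n) (above (Ψ-monic n h)))

    norm-at-0 : ∀ p → Ψ m ≋ X → norm p ≡ coeff p 0 ℤ.^ d
    norm-at-0 p e = trans (norm-cong (division p)) (trans (norm-mod (tail p) (constP (coeff p 0))) (norm-const (coeff p 0)))
      where
      tail : ℤ[x] → ℤ[x]
      tail []      = []
      tail (a ∷ p) = p
      division : ∀ p → p ≋ (tail p ⊗ Ψ m) ⊕ constP (coeff p 0)
      division []      = ≋-sym 0∷[]
      division (a ∷ p) = ≋-sym (≋-trans
        (⊕-cong (≋-trans (⊗-cong (≋-refl {p}) e) (≋-trans (⊗-comm p X) (X-⊗ p))) (≋-refl {constP a}))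
        (∷-cong (ℤₚ.+-identityˡ a) (⊕-identityʳ p)))

    Ψ₂≋X : Ψ 2 ≋ X
    Ψ₂≋X = ≋-trans (≋-sym (≋-trans (⊗-cong (≋-refl {Ψ 2}) proper₁) (⊗-identityʳ (Ψ 2)))) (≋-trans (≋-sym (F-proper 1)) F₂≋X)
      where
      proper₁ : proper 1 ≋ oneP
      proper₁ = ≋-trans (⊗-identityʳ _) (≋-trans (ProductP.select-yes (1 ∣? 2) (1∣ 2)) Ψ-one≋)

    -- Here m = 2 needs its own argument because Ψ_2 = x is odd and the checkerboard pattern fails;
    -- the norm modulo x is a power of the positive number Ψ_n(0). For m ≥ 3 the determinant is a
    -- square.
    resultant-nonneg : ∀ n → m < n → resultantℤ n ≡ + w n
    resultant-nonneg n m<n = trans (nonneg (ℕₚ.m≤n⇒m<n∨m≡n 2≤m)) (cong (λ z → + ∣ z ∣) norm-n)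
      where
      3≤n : 3 ≤ n
      3≤n = ℕₚ.≤-trans (s≤s 2≤m) m<n
      norm-n : resultantℤ n ≡ norm (Ψ n)
      norm-n = resultant-norm n (ℕₚ.<⇒≤ 3≤n)
      at-2 : ∀ p → Positive₀ p → Ψ m ≋ X → norm p ≡ + ∣ norm p ∣
      at-2 p (k , eq) e = subst (λ z → z ≡ + ∣ z ∣) (sym (trans (norm-at-0 p e) (cong (ℤ._^ d) eq))) (positive-^ k d)
      square : ∀ {x} → ∃[ D ] (x ≡ D * D) → x ≡ + ∣ x ∣
      square (D , refl) = square-∣∣ D
      nonneg : 2 < m ⊎ 2 ≡ m → resultantℤ n ≡ + ∣ resultantℤ n ∣
      nonneg (inj₂ e)   = subst (λ z → z ≡ + ∣ z ∣) (sym norm-n) (at-2 (Ψ n) (Ψ-positive n 3≤n) (subst (λ k → Ψ k ≋ X) e Ψ₂≋X))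
      nonneg (inj₁ 3≤m) = square (subst₂ (λ a b → ∃[ D ] (det (a ℕ.+ b) (sylvester a (Ψ m) b (Ψ n)) ≡ D * D))
          (sym (φ-even m 3≤m)) (sym (φ-even n 3≤n))
          (det-sylvester-even (half (φ m)) (half (φ n)) (Ψ m) (Ψ n) (Ψ-even m 3≤m) (Ψ-even n 3≤n)))

    Ψhom-homogenize : ∀ n → 2 ≤ n → Ψhom Ψ n ≡ homogenize (φ n) (Ψ n)
    Ψhom-homogenize (suc zero)    (s≤s ())
    Ψhom-homogenize (suc (suc n)) _ = refl

    resultant-Ψ : ∀ n → m < n → resultantₓ (φ m) (Ψhom Ψ m) (φ n) (Ψhom Ψ n) ≈ʸ ZY.monomial (+ w n) (φ m ℕ.* φ n)
    resultant-Ψ n m<n = subst₂ (λ f g → resultantₓ (φ m) f (φ n) g ≈ʸ ZY.monomial (+ w n) (φ m ℕ.* φ n))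
      (sym (Ψhom-homogenize m 2≤m)) (sym (Ψhom-homogenize n (ℕₚ.≤-trans 2≤m (ℕₚ.<⇒≤ m<n))))
      (subst (λ c → resultantₓ (φ m) (homogenize (φ m) (Ψ m)) (φ n) (homogenize (φ n) (Ψ n)) ≈ʸ ZY.monomial c (φ m ℕ.* φ n))
        (resultant-nonneg n m<n) (coeff-≡ (resultant-homogenize (φ m) (Ψ m) (φ n) (Ψ n))))

    resultant-cases : ∀ n → m < n →
      ((p α : ℕ) → Prime p → 1 ≤ α → n ≡ m ℕ.* p ℕ.^ α →
         resultantₓ (φ m) (Ψhom Ψ m) (φ n) (Ψhom Ψ n) ≈ʸ ZY.monomial (+ (p ℕ.^ φ m)) (φ m ℕ.* φ n))
      × (¬ (∃[ p ] ∃[ α ] (Prime p × 1 ≤ α × n ≡ m ℕ.* p ℕ.^ α)) →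
         resultantₓ (φ m) (Ψhom Ψ m) (φ n) (Ψhom Ψ n) ≈ʸ ZY.monomial (+ 1) (φ m ℕ.* φ n))
    resultant-cases n m<n =
        (λ { p (suc α) pr _ e → conclude (trans (cong w e) (trans (w-prime-power p α pr) (cong (p ℕ.^_) (sym φ-suc)))) })
      , (λ h → conclude (w-otherwise n m<n h))
      where
      conclude : ∀ {c} → w n ≡ c → resultantₓ (φ m) (Ψhom Ψ m) (φ n) (Ψhom Ψ n) ≈ʸ ZY.monomial (+ c) (φ m ℕ.* φ n)
      conclude e = subst (λ c → resultantₓ (φ m) (Ψhom Ψ m) (φ n) (Ψhom Ψ n) ≈ʸ ZY.monomial (+ c) (φ m ℕ.* φ n)) e (resultant-Ψ n m<n)

open import Data.Nat using (ℕ; _≤_; _<_; _*_; _^_; s≤s; z≤n)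
open import Data.Nat.Properties using (≤-trans)
open import Data.Nat.Primality using (Prime)
open import Data.Integer using (+_)
open import Data.Product using (_×_; ∃; ∃-syntax)
open import Relation.Nullary using (¬_)
open import Relation.Binary.PropositionalEquality using (_≡_)

theorem1p3 : (Ψ : ℕ → ℤ[x]) → IsFibotomic Ψ →
    (m n : ℕ) → 2 ≤ m → m < n →
    ((p α : ℕ) → Prime p → 1 ≤ α → n ≡ m * p ^ α →
    resultantₓ (φ m) (Ψhom Ψ m) (φ n) (Ψhom Ψ n)
    ≈ʸ ZY.monomial (+ (p ^ φ m)) (φ m * φ n))
    ×
    (¬ (∃[ p ] ∃[ α ] (Prime p × 1 ≤ α × n ≡ m * p ^ α)) →
    resultantₓ (φ m) (Ψhom Ψ m) (φ n) (Ψhom Ψ n)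
    ≈ʸ ZY.monomial (+ 1) (φ m * φ n))
theorem1p3 Ψ fibotomic m n 2≤m m<n =
  Resultants.Weight.resultant-cases Ψ fibotomic m 2≤m _ (TotientSum.φ-positive m (≤-trans (s≤s z≤n) 2≤m)) n m<n
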